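{- Let $D$ be a 2-strong digraph of order $n\geq 3$ satisfying condition $(M)$, i.e. $d(x)+d(y)+d(w)+d(z)\geq 4n-3$ for all distinct pairs $\{x,y\}\neq\{w,z\}$ of non-adjacent vertices of $D$. Then $D$ is Hamiltonian.
   Context: Digraphs are finite, without loops and multiple arcs. For a vertex $x$, $d^+(x)$ and $d^-(x)$ are its out-degree and in-degree and $d(x)=d^+(x)+d^-(x)$. Two distinct vertices $x,y$ are adjacent if $xy\in A(D)$ or $yx\in A(D)$. A digraph $D$ is $k$-strong if $|V(D)|\geq k+1$ and $D$ minus any set of at most $k-1$ vertices is strongly connected. $D$ is Hamiltonian if it contains a (directed) cycle through all its vertices. -}

module Defs where

open import Data.Nat using (ℕ; zero; suc; _+_; _∸_; _*_; _≤_)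
open import Data.Bool using (Bool; true; false; if_then_else_)
open import Data.Fin using (Fin)
open import Data.Fin.Subset using (Subset; _∉_; ∣_∣)
open import Data.List using (List; []; _∷_; _++_; map; allFin)
open import Data.Nat.ListAction using (sum)
open import Data.List.Membership.Propositional using (_∈_)
open import Data.List.Relation.Unary.Unique.Propositional using (Unique)
open import Data.Product using (Σ; _×_)
open import Data.Sum using (_⊎_)
open import Data.Unit using (⊤)
open import Relation.Binary.PropositionalEquality using (_≡_)
open import Relation.Nullary using (¬_)

-- A digraph on vertex set Fin n: arc relation given by a Boolean matrix.
-- Multiple arcs are impossible by construction; loops are excluded by Loopless.
Digraph : ℕ → Set
Digraph n = Fin n → Fin n → Bool

module _ {n : ℕ} (D : Digraph n) where

  Arc : Fin n → Fin n → Set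
  Arc x y = D x y ≡ true

  Loopless : Set
  Loopless = ∀ x → D x x ≡ false

  outdeg : Fin n → ℕ
  outdeg x = sum (map (λ y → if D x y then 1 else 0) (allFin n))

  indeg : Fin n → ℕ
  indeg x = sum (map (λ y → if D y x then 1 else 0) (allFin n))

  deg : Fin n → ℕ
  deg x = outdeg x + indeg x

  Adjacent : Fin n → Fin n → Set
  Adjacent x y = Arc x y ⊎ Arc y x

  data ReachAvoiding (S : Subset n) : Fin n → Fin n → Set where
    here : ∀ {x} → ReachAvoiding S x x
    step : ∀ {x y z} → Arc x y → y ∉ S → ReachAvoiding S y z → ReachAvoiding S x z

  StronglyConnectedMinus : Subset n → Set
  StronglyConnectedMinus S = ∀ x y → x ∉ S → y ∉ S → ReachAvoiding S x y

  KStrong : ℕ → Set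
  KStrong k = (k + 1 ≤ n) × (∀ (S : Subset n) → ∣ S ∣ ≤ k ∸ 1 → StronglyConnectedMinus S)

  ArcsAlong : List (Fin n) → Set
  ArcsAlong [] = ⊤
  ArcsAlong (x ∷ []) = ⊤
  ArcsAlong (x ∷ y ∷ r) = Arc x y × ArcsAlong (y ∷ r)

  Hamiltonian : Set
  Hamiltonian = Σ (Fin n) λ v₀ → Σ (List (Fin n)) λ rest →
    Unique (v₀ ∷ rest) × (∀ x → x ∈ (v₀ ∷ rest)) × ArcsAlong (v₀ ∷ rest ++ v₀ ∷ [])

  ConditionM : Set
  ConditionM = ∀ x y w z → ¬ x ≡ y → ¬ w ≡ z → ¬ Adjacent x y → ¬ Adjacent w z →
    ¬ ((x ≡ w × y ≡ z) ⊎ (x ≡ z × y ≡ w)) →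
    4 * n ∸ 3 ≤ deg x + deg y + deg w + deg z

{-# OPTIONS --safe #-}
-- Call a pair of non-adjacent vertices light if its degree sum is at most 2n − 2. If no pair is light, this is
-- Meyniel's theorem. Otherwise condition (M) makes every pair but one, {x , y}, satisfy Meyniel's condition with
-- surplus, and an exchange argument on cycles yields a cycle missing only x. If D is not Hamiltonian, one gets from it a
-- path R through all vertices but x and y on which no in-neighbour of x (or of y) precedes an out-neighbour of it.
-- Hence d(x) and d(y) are small, and (M) makes every vertex not adjacent to both x and y ("free") so rich in arcs that
-- any cycle through x, y and all other vertices absorbs the free ones. Such a cycle consists of two disjoint paths,
-- from x to y and from y to x, and these are found by exchanging pieces of R along arcs that jump over a vertex of R;
-- 2-strongness provides an arc over every inner vertex, since x and y themselves never lead forward along R.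
module Submission where

-- The obstacle is the pair {x, y} itself. The classical exchange compares the missing vertex with a
-- vertex in a gap of the cycle, so it may be run only on gaps without the partner of the missing
-- vertex; this is why `R` leaves out both `x` and `y`. All insertions rest on one count: a vertex
-- that fits nowhere in a walk with `q` inner vertices has at most `q + 1` arcs with it, apart from
-- the arcs to its first and from its last vertex. On `R` the in- and out-neighbours of x overlap in
-- at most one vertex, so d(x) is at most n - 1 minus the number of non-neighbours of x on `R`; the
-- same holds for y. With μ free vertices, (M) then gives each of them degree at least n + μ + 1,
-- while at most μ of them can ever be left over, too few to block an insertion. The search for the
-- two disjoint paths splits according to the vertices adjacent to both x and y: some vertex leads
-- from one to the other; or at most one is a common out-neighbour (or, reversing all arcs,
-- in-neighbour); or there are at least two of each kind.

open import Defs
open import Data.Nat using (ℕ; zero; suc; _+_; _*_; _∸_; _≤_; _<_; z≤n; s≤s)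
open import Data.Nat.Properties hiding (_≟_)
open import Data.Nat.Tactic.RingSolver using (solve)
open import Data.List using (List; []; _∷_; [_]; _++_; map; length; allFin; reverse)
open import Relation.Binary.PropositionalEquality using (_≡_; _≢_; refl; sym; trans; cong; cong₂; subst)

-- Linear inequalities between degrees and lengths

-- A linear inequality is derived by adding up its hypotheses and comparing the two sums by a semiring identity.
linear : ∀ {a b s t} k → s ≤ t → a + t + k ≡ b + s → a ≤ b
linear {a} {b} {s} {t} k s≤t eq =
  +-cancelʳ-≤ s a b (≤-trans (+-monoʳ-≤ a s≤t) (≤-trans (m≤m+n (a + t) k) (≤-reflexive eq)))

insert-arith : ∀ au uq qu S ub l → au + uq ≤ 1 → qu + S + ub ≤ l + 1 → au + (uq + qu + S) + ub ≤ suc l + 1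
insert-arith au uq qu S ub l p q = linear 0 (+-mono-≤ p q) (solve (au ∷ uq ∷ qu ∷ S ∷ ub ∷ l ∷ []))

+-interchange : ∀ a b c d → a + b + (c + d) ≡ a + c + (b + d)
+-interchange a b c d = solve (a ∷ b ∷ c ∷ d ∷ [])

tight-arith : ∀ xa ax xb bx S l → ax + S + xb ≤ l + 1 → xa ≤ 1 → bx ≤ 1 → (xb + bx) + (xa + ax) + S ≤ l + 3
tight-arith xa ax xb bx S l p₁ p₂ p₃ = linear 0 (+-mono-≤ p₁ (+-mono-≤ p₂ p₃)) (solve (xa ∷ ax ∷ xb ∷ bx ∷ S ∷ l ∷ []))

-- The count behind both Meyniel-type exchanges: a gap of `r` vertices, `t` of which resist
-- insertion into the rest of the cycle (length `q` before, `q′` after), and `e` outer vertices; the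
-- 3 stands for the ends of the gap and the vertex `z`. `δ` is an excess at one exceptional outer
-- vertex, paid for by inserted gap vertices: `t + δ ≤ r`.
degree-sum-arith : ∀ n dz du zE uT uE q q′ t r e δ → n ≡ 3 + r + q + e → q′ + t ≡ q + r →
  dz ≤ q + 3 + zE → du ≤ q′ + 3 + uT + uE → uT + 2 ≤ t * 2 → zE + uE ≤ e * 2 + δ → t + δ ≤ r → dz + du + 2 ≤ 2 * n
degree-sum-arith n dz du zE uT uE q q′ t r e δ refl eq p₁ p₂ p₃ p₄ p₅ =
  linear 0 (+-mono-≤ p₁ (+-mono-≤ p₂ (+-mono-≤ p₃ (+-mono-≤ p₄ (+-mono-≤ p₅ (≤-reflexive eq))))))
    (solve (dz ∷ du ∷ zE ∷ uT ∷ uE ∷ q ∷ q′ ∷ t ∷ r ∷ e ∷ δ ∷ []))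

self-arith : ∀ a b l m → a ≤ l * 2 → b ≤ m * 2 → a + b + 2 ≤ suc (l + m) * 2
self-arith a b l m p q = linear 0 (+-mono-≤ p q) (solve (a ∷ b ∷ l ∷ m ∷ []))

sum-swap : ∀ a b c d → a + b + (c + d) ≡ a + d + (c + b)
sum-swap a b c d = solve (a ∷ b ∷ c ∷ d ∷ [])

sum₄ : ∀ p q r s → p + (q + (r + s)) ≡ p + q + r + s
sum₄ p q r s = solve (p ∷ q ∷ r ∷ s ∷ [])

sum₅ : ∀ p q r s t → p + (q + (r + (s + t))) ≡ p + q + r + s + t
sum₅ p q r s t = solve (p ∷ q ∷ r ∷ s ∷ t ∷ [])

count₅ : ∀ r q e → suc (r + suc (q + suc e)) ≡ 3 + r + q + e
count₅ r q e = solve (r ∷ q ∷ e ∷ [])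

too-small : ∀ {N s} → N ≤ s + 1 → s + 2 ≤ N → 1 ≤ 0
too-small {N} {s} p q = linear 0 (+-mono-≤ p q) (solve (N ∷ s ∷ []))

count₄ : ∀ r q → suc (suc (r + suc q)) ≡ 3 + r + q + 0
count₄ r q = solve (r ∷ q ∷ [])

path-arith : ∀ n dx du uy ua ub uQ uT q q′ t r → du ≡ uy + (ua + (ub + (uQ + uT))) → n ≡ 4 + (q + r) → q′ + t ≡ q + r →
  dx ≤ 2 + q + 1 → ub + ua + uQ ≤ q′ + 3 → uT + 2 ≤ t * 2 → t ≤ r → uy ≤ 2 → dx + du + 2 ≤ 2 * n
path-arith n dx du uy ua ub uQ uT q q′ t r refl refl eq p₁ p₂ p₃ p₄ p₅ =
  linear 0 (+-mono-≤ p₁ (+-mono-≤ p₂ (+-mono-≤ p₃ (+-mono-≤ p₄ (+-mono-≤ p₅ (≤-reflexive eq))))))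
    (solve (dx ∷ uy ∷ ua ∷ ub ∷ uQ ∷ uT ∷ q ∷ q′ ∷ t ∷ r ∷ []))

mono-arith₁ : ∀ a b l ν → a ≤ 2 → b + ν ≤ l → a + b + ν ≤ suc l + 1
mono-arith₁ a b l ν p q = linear 0 (+-mono-≤ p q) (solve (a ∷ b ∷ l ∷ ν ∷ []))

mono-arith₂ : ∀ a b l ν κ → a + κ ≤ 1 → b + ν ≤ l + 1 → a + b + (κ + ν) ≤ suc l + 1
mono-arith₂ a b l ν κ p q = linear 0 (+-mono-≤ p q) (solve (a ∷ b ∷ l ∷ ν ∷ κ ∷ []))

free-arith : ∀ n m dx dy du νx νy μ → n ≡ 2 + m → 4 * n ≤ dx + dy + dx + du + 3 →
  dx + νx ≤ m + 1 → dy + νy ≤ m + 1 → μ ≤ νx + νy → 1 ≤ νx → n + μ + 1 ≤ du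
free-arith n m dx dy du νx νy μ refl p₁ p₂ p₃ p₄ p₅ =
  linear 0 (+-mono-≤ p₁ (+-mono-≤ p₂ (+-mono-≤ p₂ (+-mono-≤ p₃ (+-mono-≤ p₄ p₅)))))
    (solve (m ∷ dx ∷ dy ∷ du ∷ νx ∷ νy ∷ μ ∷ []))

cycle-arith : ∀ n μ q t uv vu uQ uT → n ≡ suc (q + t) → n + μ + 1 ≤ (uv + vu) + (uQ + uT) →
  vu + uQ + uv ≤ q + 1 → uT + 2 ≤ t * 2 → t ≤ μ → 1 ≤ 0
cycle-arith n μ q t uv vu uQ uT refl p₁ p₂ p₃ p₄ =
  linear 2 (+-mono-≤ p₁ (+-mono-≤ p₂ (+-mono-≤ p₃ p₄))) (solve (μ ∷ q ∷ t ∷ uv ∷ vu ∷ uQ ∷ uT ∷ []))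

extend-arith : ∀ n μ q t ux uy ua ub uQ uT → n ≡ 4 + (q + t) → n + μ + 1 ≤ ux + (uy + (ua + (ub + (uQ + uT)))) →
  ub + ua + uQ ≤ q + 3 → uT + 2 ≤ t * 2 → t ≤ μ → ux + uy ≤ 2 → 1 ≤ 0
extend-arith n μ q t ux uy ua ub uQ uT refl p₁ p₂ p₃ p₄ p₅ =
  linear 1 (+-mono-≤ p₁ (+-mono-≤ p₂ (+-mono-≤ p₃ (+-mono-≤ p₄ p₅))))
    (solve (μ ∷ q ∷ t ∷ ux ∷ uy ∷ ua ∷ ub ∷ uQ ∷ uT ∷ []))

neighbour-arith : ∀ n μ e ux uy S F I J → n ≡ 3 + e → n + μ + 1 ≤ ux + (uy + S) → ux + uy ≤ 2 →
  S ≤ e + F + (I + J) → 1 + F ≤ μ → I ≤ 1 → J ≤ 1 → 1 ≤ 0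
neighbour-arith n μ e ux uy S F I J refl p₁ p₂ p₃ p₄ p₅ p₆ =
  linear 0 (+-mono-≤ p₁ (+-mono-≤ p₂ (+-mono-≤ p₃ (+-mono-≤ p₄ (+-mono-≤ p₅ p₆)))))
    (solve (μ ∷ e ∷ ux ∷ uy ∷ S ∷ F ∷ I ∷ J ∷ []))

others-arith : ∀ n s d → 4 * n ≤ s + d + 3 → s + 2 ≤ 2 * n → 2 * n ≤ d + 1
others-arith n s d p q = linear 0 (+-mono-≤ p q) (solve (n ∷ s ∷ d ∷ []))

open import Data.Nat.ListAction using (sum)
open import Data.Nat.ListAction.Properties using (sum-++; sum-↭)
open import Data.Bool using (Bool; true; false; if_then_else_)
import Data.Bool.Properties as Bool
open import Data.Fin using (Fin; _≟_; fromℕ<)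
open import Data.Fin.Subset using (⁅_⁆)
open import Data.Fin.Subset.Properties using (x≢y⇒x∉⁅y⁆; x∉⁅y⁆⇒x≢y; ∣⁅x⁆∣≡1)
open import Data.List.Properties using (map-++; length-++; ++-assoc; ∷-injective; ++-identityʳ; unfold-reverse; length-tabulate)
open import Data.List.Membership.Propositional using (_∈_; _∉_; find; lose)
open import Data.List.Membership.Propositional.Properties using (∈-∃++; ∈-++⁺ˡ; ∈-++⁺ʳ; ∈-++⁻; ∈-insert; ∈-allFin)
open import Data.List.Relation.Unary.All as All using (All; []; _∷_)
import Data.List.Relation.Unary.All.Properties as All
open import Data.List.Relation.Unary.Any as Any using (Any; here; there; any?)
open import Data.List.Relation.Unary.AllPairs as AllPairs using (AllPairs; []; _∷_)
import Data.List.Relation.Unary.AllPairs.Properties as AllPairs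
open import Data.List.Relation.Unary.Unique.Propositional using (Unique)
open import Data.List.Relation.Unary.Unique.Propositional.Properties using (allFin⁺)
open import Data.List.Relation.Binary.Permutation.Propositional using (_↭_; ↭-refl; ↭-sym; ↭-trans; ↭-reflexive; prep; module PermutationReasoning)
import Data.List.Relation.Binary.Permutation.Propositional as ↭
open import Data.List.Relation.Binary.Permutation.Propositional.Properties using (↭-length; ∈-resp-↭; All-resp-↭; map⁺; shift; ↭-reverse; ++-commutativeMonoid; ++⁺; ++⁺ˡ; ++⁺ʳ)
import Algebra.Solver.CommutativeMonoid
open import Data.Product using (Σ; ∃; ∃₂; _×_; _,_; proj₁; proj₂)
open import Data.Sum as Sum using (_⊎_; inj₁; inj₂; swap; [_,_]′)
open import Data.Empty using (⊥-elim)
open import Data.Unit using (⊤; tt)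
open import Function using (_∘_; flip; id; case_of_)
open import Relation.Nullary using (¬_; Dec; yes; no; contradiction; ¬?)
open import Relation.Nullary.Decidable using (_×-dec_; _⊎-dec_)
open import Relation.Unary using (Decidable)

module ↭-Solver {A : Set} = Algebra.Solver.CommutativeMonoid (++-commutativeMonoid {A = A})
open ↭-Solver using (_⊕_; _⊜_) renaming (solve to ↭-solve)


-- Sums over lists, permutations and splittings

module _ {A : Set} where

  ∑ : (A → ℕ) → List A → ℕ
  ∑ f L = sum (map f L)

  ∑-++ : ∀ (f : A → ℕ) L M → ∑ f (L ++ M) ≡ ∑ f L + ∑ f M
  ∑-++ f L M = trans (cong sum (map-++ f L M)) (sum-++ (map f L) (map f M))

  ∑-↭ : ∀ (f : A → ℕ) {L M} → L ↭ M → ∑ f L ≡ ∑ f M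
  ∑-↭ f p = sum-↭ (map⁺ f p)

  ∑-+ : ∀ (f g : A → ℕ) L → ∑ (λ v → f v + g v) L ≡ ∑ f L + ∑ g L
  ∑-+ f g [] = refl
  ∑-+ f g (v ∷ L) rewrite ∑-+ f g L = +-interchange (f v) (g v) (∑ f L) (∑ g L)

  ∑-≤ : ∀ {f g : A → ℕ} {L} → All (λ v → f v ≤ g v) L → ∑ f L ≤ ∑ g L
  ∑-≤ [] = z≤n
  ∑-≤ (p ∷ ps) = +-mono-≤ p (∑-≤ ps)

  ∑-≤-* : ∀ {f : A → ℕ} {L} k → All (λ v → f v ≤ k) L → ∑ f L ≤ length L * k
  ∑-≤-* k [] = z≤n
  ∑-≤-* k (p ∷ ps) = +-mono-≤ p (∑-≤-* k ps)

  ∑-≡0 : ∀ {f : A → ℕ} {L} → All (λ v → f v ≡ 0) L → ∑ f L ≡ 0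
  ∑-≡0 [] = refl
  ∑-≡0 (p ∷ ps) = cong₂ _+_ p (∑-≡0 ps)

  ∑-≡1 : ∀ {f : A → ℕ} {L} → All (λ v → f v ≡ 1) L → ∑ f L ≡ length L
  ∑-≡1 [] = refl
  ∑-≡1 (p ∷ ps) = cong₂ _+_ p (∑-≡1 ps)

  length-∷ʳ-middle : ∀ (L : List A) v M → length (L ++ v ∷ M) ≡ suc (length (L ++ M))
  length-∷ʳ-middle L v M = ↭-length (shift v L M)

  All-middle⁻ : ∀ {P : A → Set} L {v M} → All P (L ++ v ∷ M) → All P L × P v × All P M
  All-middle⁻ L a with All.++⁻ L a
  ... | l , v ∷ m = l , v , m

  All-middle⁺ : ∀ {P : A → Set} {L v M} → All P L → P v → All P M → All P (L ++ v ∷ M)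
  All-middle⁺ l v m = All.++⁺ l (v ∷ m)

  all-∈ : ∀ {P : A → Set} {L} → (∀ {v} → v ∈ L → P v) → All P L
  all-∈ = All.tabulate

  Unique-resp-↭ : {L M : List A} → L ↭ M → Unique L → Unique M
  Unique-resp-↭ ↭.refl u = u
  Unique-resp-↭ (↭.prep v p) (v∉ ∷ u) = All-resp-↭ p v∉ ∷ Unique-resp-↭ p u
  Unique-resp-↭ (↭.swap v w p) ((v≢w ∷ v∉) ∷ w∉ ∷ u) =
    ((λ e → v≢w (sym e)) ∷ All-resp-↭ p w∉) ∷ All-resp-↭ p v∉ ∷ Unique-resp-↭ p u
  Unique-resp-↭ (↭.trans p q) u = Unique-resp-↭ q (Unique-resp-↭ p u)

  AllPairs-++⁻ : ∀ {R : A → A → Set} L {M} → AllPairs R (L ++ M) → AllPairs R L × AllPairs R M × All (λ v → All (R v) M) L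
  AllPairs-++⁻ [] ap = [] , ap , []
  AllPairs-++⁻ (v ∷ L) (p ∷ ap) with AllPairs-++⁻ L ap | All.++⁻ L p
  ... | apL , apM , x | pL , pM = pL ∷ apL , apM , pM ∷ x

  AllPairs-middle⁻ : ∀ {R : A → A → Set} L {v M} → AllPairs R (L ++ v ∷ M) → All (λ w → R w v) L × All (R v) M
  AllPairs-middle⁻ L ap with AllPairs-++⁻ L ap
  ... | _ , p ∷ _ , x = All.map All.head x , p

  AllPairs-insert : ∀ {R : A → A → Set} L {u M} → (∀ v → R u v) → (∀ v → R v u) → AllPairs R (L ++ M) → AllPairs R (L ++ u ∷ M)
  AllPairs-insert [] r s ap = all-∈ (λ {v} _ → r v) ∷ ap
  AllPairs-insert (v ∷ L) r s (p ∷ ap) with All.++⁻ L p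
  ... | pL , pM = All-middle⁺ pL (s v) pM ∷ AllPairs-insert L r s ap

  AllPairs-reverse : ∀ {R : A → A → Set} L → AllPairs R L → AllPairs (flip R) (reverse L)
  AllPairs-reverse [] [] = []
  AllPairs-reverse (v ∷ L) (p ∷ ap) rewrite unfold-reverse v L =
    AllPairs.++⁺ (AllPairs-reverse L ap) ([] ∷ []) (All-resp-↭ (↭-sym (↭-reverse L)) (All.map (λ r → r ∷ []) p))

  ++-split : ∀ {v} (K : List A) {L} M {N} → K ++ L ≡ M ++ v ∷ N →
    (∃ λ X → L ≡ X ++ v ∷ N × M ≡ K ++ X) ⊎ (∃ λ Y → K ≡ M ++ v ∷ Y × N ≡ Y ++ L)
  ++-split [] M eq = inj₁ (M , eq , refl)
  ++-split (v ∷ K) [] refl = inj₂ (K , refl , refl)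
  ++-split (w ∷ K) (w′ ∷ M) eq with ∷-injective eq
  ... | refl , eq′ with ++-split K M eq′
  ... | inj₁ (X , e , refl) = inj₁ (X , e , refl)
  ... | inj₂ (Y , refl , e) = inj₂ (Y , refl , e)

  module _ {P : A → Set} (P? : Decidable P) where

    first-split : ∀ L → All (λ v → ¬ P v) L ⊎ (∃ λ M → ∃ λ v → ∃ λ N → L ≡ M ++ v ∷ N × P v × All (λ w → ¬ P w) M)
    first-split [] = inj₁ []
    first-split (v ∷ L) with P? v
    ... | yes p = inj₂ ([] , v , L , refl , p , [])
    ... | no ¬p with first-split L
    ... | inj₁ none = inj₁ (¬p ∷ none)
    ... | inj₂ (M , w , N , refl , p , none) = inj₂ (v ∷ M , w , N , refl , p , ¬p ∷ none)

    last-split : ∀ L → All (λ v → ¬ P v) L ⊎ (∃ λ M → ∃ λ v → ∃ λ N → L ≡ M ++ v ∷ N × P v × All (λ w → ¬ P w) N)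
    last-split [] = inj₁ []
    last-split (v ∷ L) with last-split L
    ... | inj₂ (M , w , N , refl , p , none) = inj₂ (v ∷ M , w , N , refl , p , none)
    ... | inj₁ none with P? v
    ... | yes p = inj₂ ([] , v , L , refl , p , none)
    ... | no ¬p = inj₁ (¬p ∷ none)

  first-split-∈ : ∀ {P : A → Set} (P? : Decidable P) {L v} → v ∈ L → P v → ∃ λ M → ∃ λ v → ∃ λ N → L ≡ M ++ v ∷ N × P v × All (λ w → ¬ P w) M
  first-split-∈ P? {L} v∈ p with first-split P? L
  ... | inj₁ none = contradiction p (All.lookup none v∈)
  ... | inj₂ s = s

  last-split-∈ : ∀ {P : A → Set} (P? : Decidable P) {L v} → v ∈ L → P v → ∃ λ M → ∃ λ v → ∃ λ N → L ≡ M ++ v ∷ N × P v × All (λ w → ¬ P w) N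
  last-split-∈ P? {L} v∈ p with last-split P? L
  ... | inj₁ none = contradiction p (All.lookup none v∈)
  ... | inj₂ s = s

  all-or : ∀ {R : Set} {P : A → Set} L → (∀ {v} → v ∈ L → R ⊎ P v) → R ⊎ All P L
  all-or [] f = inj₂ []
  all-or (v ∷ L) f with f (here refl)
  ... | inj₁ r = inj₁ r
  ... | inj₂ p with all-or L (f ∘ there)
  ... | inj₁ r = inj₁ r
  ... | inj₂ ps = inj₂ (p ∷ ps)

  complement : ∀ {L : List A} M → Unique L → All (_∈ M) L → ∃ λ N → M ↭ L ++ N
  complement M [] [] = M , ↭-refl
  complement {v ∷ L} M (v∉ ∷ u) (v∈ ∷ L⊆) with ∈-∃++ v∈
  ... | M₁ , M₂ , refl with complement (M₁ ++ M₂) u (all-∈ λ w∈L → rest (All.lookup L⊆ w∈L) (All.lookup v∉ w∈L))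
    where
    rest : ∀ {w} → w ∈ M₁ ++ v ∷ M₂ → v ≢ w → w ∈ M₁ ++ M₂
    rest w∈ v≢w with ∈-resp-↭ (shift v M₁ M₂) w∈
    ... | here w≡v = contradiction (sym w≡v) v≢w
    ... | there w∈′ = w∈′
  ... | N , p = N , ↭-trans (shift v M₁ M₂) (prep v p)

ind : ∀ {n} → ℕ → Fin n → Fin n → ℕ
ind k x v = if Dec.does (v ≟ x) then k else 0

ind-refl : ∀ {n} k (x : Fin n) → ind k x x ≡ k
ind-refl k x with x ≟ x
... | yes _ = refl
... | no x≢x = contradiction refl x≢x

∑-ind≤ : ∀ {n} k (x : Fin n) {L} → Unique L → ∑ (ind k x) L ≤ k
∑-ind≤ k x [] = z≤n
∑-ind≤ k x (_∷_ {v} {L} v∉ u) with v ≟ x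
... | no _ = ∑-ind≤ k x u
... | yes refl = ≤-reflexive (trans (cong (k +_) (∑-≡0 (All.map zeroAt v∉))) (+-identityʳ k))
  where
  zeroAt : ∀ {w} → v ≢ w → ind k v w ≡ 0
  zeroAt {w} v≢w with w ≟ v
  ... | yes e = contradiction (sym e) v≢w
  ... | no _ = refl

-- Walks, insertion of vertices, monotone lists

module Walks {n : ℕ} (D : Digraph n) where

  -- The list holds the inner vertices only: a cycle through `v` is `Links v L v`, and walks are
  -- glued at a named vertex.
  Links : Fin n → List (Fin n) → Fin n → Set
  Links u [] v = Arc D u v
  Links u (w ∷ L) v = Arc D u w × Links w L v

  Links-++ : ∀ {u w v} L {M} → Links u L w → Links w M v → Links u (L ++ w ∷ M) v
  Links-++ [] a l = a , l
  Links-++ (_ ∷ L) (a , k) l = a , Links-++ L k l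

  Links-++⁻ : ∀ {u w v} L {M} → Links u (L ++ w ∷ M) v → Links u L w × Links w M v
  Links-++⁻ [] (a , l) = a , l
  Links-++⁻ (_ ∷ L) (a , l) with Links-++⁻ L l
  ... | k , m = (a , k) , m

  Links⇒ArcsAlong : ∀ {u v} L → Links u L v → ArcsAlong D (u ∷ L ++ v ∷ [])
  Links⇒ArcsAlong [] a = a , tt
  Links⇒ArcsAlong (_ ∷ L) (a , l) = a , Links⇒ArcsAlong L l

  arc? : ∀ u v → Dec (Arc D u v)
  arc? u v = D u v Bool.≟ true

  arc : Fin n → Fin n → ℕ
  arc u v = if D u v then 1 else 0

  adj : Fin n → Fin n → ℕ
  adj u v = arc u v + arc v u

  adjacent? : ∀ u v → Dec (Adjacent D u v)
  adjacent? u v = arc? u v ⊎-dec arc? v u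

  arc≤1 : ∀ u v → arc u v ≤ 1
  arc≤1 u v with D u v
  ... | true = ≤-refl
  ... | false = z≤n

  adj≤2 : ∀ u v → adj u v ≤ 2
  adj≤2 u v = +-mono-≤ (arc≤1 u v) (arc≤1 v u)

  ¬Arc⇒arc≡0 : ∀ {u v} → ¬ Arc D u v → arc u v ≡ 0
  ¬Arc⇒arc≡0 {u} {v} ¬a with D u v
  ... | true = contradiction refl ¬a
  ... | false = refl

  ¬Adjacent⇒adj≡0 : ∀ {u v} → ¬ Adjacent D u v → adj u v ≡ 0
  ¬Adjacent⇒adj≡0 ¬a = cong₂ _+_ (¬Arc⇒arc≡0 (¬a ∘ inj₁)) (¬Arc⇒arc≡0 (¬a ∘ inj₂))

  arcs≤1 : ∀ u v w x → ¬ (Arc D u v × Arc D w x) → arc u v + arc w x ≤ 1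
  arcs≤1 u v w x ¬both with D u v | D w x
  ... | true | true = contradiction (refl , refl) ¬both
  ... | true | false = ≤-refl
  ... | false | true = ≤-refl
  ... | false | false = z≤n

  deg≡∑adj : ∀ u → deg D u ≡ ∑ (adj u) (allFin n)
  deg≡∑adj u = sym (∑-+ (arc u) (λ v → arc v u) (allFin n))

  deg-↭ : ∀ u {L} → L ↭ allFin n → deg D u ≡ ∑ (adj u) L
  deg-↭ u p = trans (deg≡∑adj u) (sym (∑-↭ (adj u) p))

  Insertable : Fin n → Fin n → List (Fin n) → Fin n → Set
  Insertable u a Q b = ∃₂ λ Q₁ Q₂ → Q ≡ Q₁ ++ Q₂ × Links a (Q₁ ++ u ∷ Q₂) b

  -- If `u` fits nowhere, each of the `length Q + 1` consecutive pairs `p`, `q` of the walk carries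
  -- at most one of the arcs `p → u`, `u → q`. The sum counts exactly these arcs and so leaves out
  -- `u → a` and `b → u`.
  Tight : Fin n → Fin n → List (Fin n) → Fin n → Set
  Tight u a Q b = arc a u + ∑ (adj u) Q + arc u b ≤ length Q + 1

  insertable-or-tight : ∀ u a Q b → Links a Q b → Insertable u a Q b ⊎ Tight u a Q b
  insertable-or-tight u a [] b l with arc? a u ×-dec arc? u b
  ... | yes k = inj₁ ([] , [] , refl , k)
  ... | no ¬k = inj₂ (subst (λ k → k + arc u b ≤ 1) (sym (+-identityʳ (arc a u))) (arcs≤1 a u u b ¬k))
  insertable-or-tight u a (q ∷ Q) b (a→q , l) with arc? a u ×-dec arc? u q
  ... | yes (a→u , u→q) = inj₁ ([] , q ∷ Q , refl , a→u , u→q , l)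
  ... | no ¬k with insertable-or-tight u q Q b l
  ... | inj₁ (Q₁ , Q₂ , refl , k) = inj₁ (q ∷ Q₁ , Q₂ , refl , a→q , k)
  ... | inj₂ t = inj₂ (insert-arith (arc a u) (arc u q) (arc q u) (∑ (adj u) Q) (arc u b) (length Q) (arcs≤1 a u u q ¬k) t)

  tight-degree : ∀ u a Q b → Tight u a Q b → adj u b + adj u a + ∑ (adj u) Q ≤ length Q + 3
  tight-degree u a Q b tight =
    tight-arith (arc u a) (arc a u) (arc u b) (arc b u) (∑ (adj u) Q) (length Q) tight (arc≤1 u a) (arc≤1 b u)

  -- `P` carries an invariant of the path through the insertions. `progress` records whether
  -- anything was inserted, because a single insertion buys one unit in the degree count. Tightness
  -- refers to the final path.
  record MaxInsertion (P : List (Fin n) → Set) (a : Fin n) (Q : List (Fin n)) (b : Fin n) (F : List (Fin n)) : Set where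
    constructor maxInsertion
    field
      path left : List (Fin n)
      links : Links a path b
      preserved : P path
      perm : path ++ left ↭ Q ++ F
      left⊆ : All (_∈ F) left
      progress : left ≡ F ⊎ length left < length F
      tight : All (λ u → Tight u a path b) left

  maximal-insertion : ∀ (P : List (Fin n) → Set) a b F →
    (∀ Q₁ u Q₂ → u ∈ F → P (Q₁ ++ Q₂) → P (Q₁ ++ u ∷ Q₂)) →
    ∀ Q → P Q → Links a Q b → MaxInsertion P a Q b F
  maximal-insertion P a b F = go (length F) F ≤-refl
    where
    search : ∀ Q → Links a Q b → ∀ F → All (λ u → Tight u a Q b) F ⊎ (∃ λ u → u ∈ F × Insertable u a Q b)
    search Q l [] = inj₁ []
    search Q l (u ∷ F) with insertable-or-tight u a Q b l | search Q l F
    ... | inj₁ i | _ = inj₂ (u , here refl , i)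
    ... | inj₂ _ | inj₂ (v , v∈ , i) = inj₂ (v , there v∈ , i)
    ... | inj₂ t | inj₁ ts = inj₁ (t ∷ ts)

    go : ∀ k F → length F ≤ k → (∀ Q₁ u Q₂ → u ∈ F → P (Q₁ ++ Q₂) → P (Q₁ ++ u ∷ Q₂)) →
      ∀ Q → P Q → Links a Q b → MaxInsertion P a Q b F
    go k F F≤k ins Q pQ l with search Q l F
    ... | inj₁ ts = maxInsertion Q F l pQ ↭-refl (all-∈ id) (inj₁ refl) ts
    ... | inj₂ (u , u∈ , Q₁ , Q₂ , refl , l′) with ∈-∃++ u∈
    go zero _ F≤k ins _ pQ l | inj₂ (u , u∈ , Q₁ , Q₂ , refl , l′) | F₁ , F₂ , refl =
      contradiction (subst (_≤ 0) (length-∷ʳ-middle F₁ u F₂) F≤k) λ ()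
    go (suc k) _ F≤k ins _ pQ l | inj₂ (u , u∈ , Q₁ , Q₂ , refl , l′) | F₁ , F₂ , refl =
      maxInsertion path left links preserved
        (↭-trans perm (↭-solve 5 (λ q r u f g → (q ⊕ (u ⊕ r)) ⊕ (f ⊕ g) ⊜ (q ⊕ r) ⊕ (f ⊕ (u ⊕ g))) ↭-refl Q₁ Q₂ [ u ] F₁ F₂))
        (All.map widen left⊆)
        (inj₂ (≤-trans (s≤s shorter) (≤-reflexive (sym (length-∷ʳ-middle F₁ u F₂)))))
        tight
      where
      widen : ∀ {v} → v ∈ F₁ ++ F₂ → v ∈ F₁ ++ u ∷ F₂
      widen v∈ with ∈-++⁻ F₁ v∈
      ... | inj₁ p = ∈-++⁺ˡ p
      ... | inj₂ p = ∈-++⁺ʳ F₁ (there p)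
      open MaxInsertion (go k (F₁ ++ F₂) (≤-pred (subst (_≤ suc k) (length-∷ʳ-middle F₁ u F₂) F≤k))
        (λ R₁ v R₂ v∈ → ins R₁ v R₂ (widen v∈)) (Q₁ ++ u ∷ Q₂) (ins Q₁ u Q₂ u∈ pQ) l′)
      shorter : length left ≤ length (F₁ ++ F₂)
      shorter with progress
      ... | inj₁ e = ≤-reflexive (cong length e)
      ... | inj₂ p = <⇒≤ p

  hamiltonian : ∀ {v L} → Links v L v → v ∷ L ↭ allFin n → Hamiltonian D
  hamiltonian {v} {L} l p = v , L , Unique-resp-↭ (↭-sym p) (allFin⁺ n) ,
    (λ u → ∈-resp-↭ (↭-sym p) (∈-allFin u)) , Links⇒ArcsAlong L l

  -- Only different positions are compared: one vertex may be both an in- and an out-neighbour of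
  -- `s`, whence the `+ 1` in `mono-degree`.
  Mono : Fin n → List (Fin n) → Set
  Mono s = AllPairs (λ c c′ → ¬ (Arc D c s × Arc D s c′))

  -- `s` enters at its first out-neighbour. What is cut off before it satisfies `P`, in applications
  -- being free, and is absorbed again later.
  trim-front : ∀ {P : Fin n → Set} {s e t w} S {Z} → All (λ c → Arc D s c ⊎ P c) S → Arc D s w → Links e (S ++ w ∷ Z) t →
    ∃₂ λ S₀ S′ → S ≡ S₀ ++ S′ × All P S₀ × Links s (S′ ++ w ∷ Z) t
  trim-front [] [] s→w l = [] , [] , refl , [] , s→w , proj₂ l
  trim-front (c ∷ S) (inj₁ s→c ∷ _) s→w l = [] , c ∷ S , refl , [] , s→c , proj₂ l
  trim-front (c ∷ S) (inj₂ p ∷ ps) s→w l with trim-front S ps s→w (proj₂ l)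
  ... | S₀ , S′ , refl , p₀ , l′ = c ∷ S₀ , S′ , refl , p ∷ p₀ , l′

  trim-back : ∀ {P : Fin n → Set} {s e t} S → All (λ c → Arc D c s ⊎ P c) S → Arc D e s → Links e S t →
    ∃₂ λ S′ S₀ → S ≡ S′ ++ S₀ × All P S₀ × Links e S′ s
  trim-back {P} {s} {e} {t} S ps e→s l = finish (last-good S ps l)
    where
    last-good : ∀ {e} S → All (λ c → Arc D c s ⊎ P c) S → Links e S t →
      All P S ⊎ (∃ λ S′ → ∃ λ c → ∃ λ S₀ → S ≡ S′ ++ c ∷ S₀ × All P S₀ × Arc D c s × Links e S′ c)
    last-good [] [] l = inj₁ []
    last-good (c ∷ S) (q ∷ ps) (a , l) with last-good S ps l | q
    ... | inj₂ (S′ , d , S₀ , refl , p₀ , d→s , l′) | _ = inj₂ (c ∷ S′ , d , S₀ , refl , p₀ , d→s , a , l′)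
    ... | inj₁ all | inj₁ c→s = inj₂ ([] , c , S , refl , all , c→s , a)
    ... | inj₁ all | inj₂ p = inj₁ (p ∷ all)
    finish : All P S ⊎ (∃ λ S′ → ∃ λ c → ∃ λ S₀ → S ≡ S′ ++ c ∷ S₀ × All P S₀ × Arc D c s × Links e S′ c) →
      ∃₂ λ S′ S₀ → S ≡ S′ ++ S₀ × All P S₀ × Links e S′ s
    finish (inj₁ all) = [] , S , refl , all , e→s
    finish (inj₂ (S′ , c , S₀ , eq , p₀ , c→s , l′)) = S′ ++ [ c ] , S₀ , trans eq (sym (++-assoc S′ [ c ] S₀)) , p₀ , Links-++ S′ l′ c→s

-- The two orders of the pair. A statement over all `Pair x y s t` serves both, which replaces
-- arguments by symmetry.
data Pair {n} (x y : Fin n) : Fin n → Fin n → Set where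
  xy : Pair x y x y
  yx : Pair x y y x

pair-↭ : ∀ {n} {x y s t : Fin n} {L} → Pair x y s t → s ∷ t ∷ L ↭ x ∷ y ∷ L
pair-↭ xy = ↭-refl
pair-↭ yx = ↭.swap _ _ ↭-refl

flip-pair : ∀ {n} {x y s t : Fin n} → Pair x y s t → Pair x y t s
flip-pair xy = yx
flip-pair yx = xy

-- At most one common out-neighbour

-- With at most one common out-neighbour of x and y, every out-neighbour of x or y precedes the first
-- common in-neighbour w on R; one of them other than those needed to reach w is free and jumps into the part beyond w.
module FewSources {n : ℕ} (D : Digraph n) {x y : Fin n} (Free : Fin n → Set) (Goal : Set)
  (extend-cycle : ∀ {v L F} → Walks.Links D v L v → v ∷ L ++ F ↭ allFin n → All Free F → Goal)
  {R} (links : Walks.Links D x R x) (perm : x ∷ y ∷ R ↭ allFin n) (mono : ∀ {s t} → Pair x y s t → Walks.Mono D s R)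
  (out-nbr : ∀ {s t} → Pair x y s t → ∀ v → v ∈ t ∷ R → ∃ λ u → Arc D s u × u ≢ v)
  (core-out : ∀ {u} → Free u → ∀ l m → ∃ λ c → Adjacent D x c × Adjacent D y c × c ≢ l × c ≢ m × Arc D u c)
  (free : ∀ {s t} → Pair x y s t → ∀ {v} → v ∈ R → ¬ Adjacent D s v → Free v)
  (nbr : ∀ {s t} → Pair x y s t → ∀ {v} → Adjacent D s v → v ∈ R)
  (unmixed : ∀ {s t} → Pair x y s t → ∀ {v} → Arc D s v → ¬ Arc D v t)
  (few : ∀ {u v} → Arc D x u → Arc D y u → Arc D x v → Arc D y v → u ≡ v) where

  open Walks D

  LL RR : Fin n → Set
  LL v = Arc D x v × Arc D y v
  RR v = Arc D v x × Arc D v y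

  LL? : ∀ v → Dec (LL v)
  LL? v = arc? x v ×-dec arc? y v

  RR? : ∀ v → Dec (RR v)
  RR? v = arc? v x ×-dec arc? v y

  O : Fin n → Set
  O v = Arc D x v ⊎ Arc D y v

  O? : ∀ v → Dec (O v)
  O? v = arc? x v ⊎-dec arc? y v

  uniqueR : Unique R
  uniqueR with Unique-resp-↭ (↭-sym perm) (allFin⁺ n)
  ... | _ ∷ _ ∷ u = u

  core-split : ∀ {v} → Adjacent D x v → Adjacent D y v → LL v ⊎ RR v
  core-split (inj₁ a) (inj₁ b) = inj₁ (a , b)
  core-split (inj₁ a) (inj₂ b) = contradiction b (unmixed xy a)
  core-split (inj₂ a) (inj₁ b) = contradiction a (unmixed yx b)
  core-split (inj₂ a) (inj₂ b) = inj₂ (a , b)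

  free-unless : ∀ {v} → v ∈ R → ¬ LL v → ¬ RR v → Free v
  free-unless {v} v∈ ¬LL ¬RR with adjacent? x v | adjacent? y v
  ... | no x≁v | _ = free xy v∈ x≁v
  ... | yes _ | no y≁v = free yx v∈ y≁v
  ... | yes x~v | yes y~v with core-split x~v y~v
  ... | inj₁ ll = contradiction ll ¬LL
  ... | inj₂ rr = contradiction rr ¬RR

  LL-arc : ∀ {s t} → Pair x y s t → ∀ {v} → LL v → Arc D s v
  LL-arc xy = proj₁
  LL-arc yx = proj₂

  RR-arc : ∀ {s t} → Pair x y s t → ∀ {v} → RR v → Arc D v s
  RR-arc xy = proj₁
  RR-arc yx = proj₂

  O-arc : ∀ {s t} → Pair x y s t → ∀ {v} → Arc D s v → O v
  O-arc xy = inj₁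
  O-arc yx = inj₂

  pair-of : ∀ {v} → O v → ∃₂ λ s t → Pair x y s t × Arc D s v
  pair-of (inj₁ a) = x , y , xy , a
  pair-of (inj₂ a) = y , x , yx , a

  both-arcs : ∀ {s t} → Pair x y s t → ∀ {v} → Arc D s v → Arc D t v → LL v
  both-arcs xy a b = a , b
  both-arcs yx a b = b , a

  Unless : Fin n → Set
  Unless l = ∀ {v} → LL v → v ≡ l

  exceptional : ∃ Unless
  exceptional with first-split LL? R
  -- Without any common out-neighbour the choice of `x` is a vacuous default.
  ... | inj₁ none = x , λ ll → contradiction ll (All.lookup none (nbr xy (inj₁ (proj₁ ll))))
  ... | inj₂ (_ , l , _ , _ , ll , _) = l , λ ll′ → few (proj₁ ll′) (proj₂ ll′) (proj₁ ll) (proj₂ ll)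

  l₀ : Fin n
  l₀ = proj₁ exceptional

  -- A vertex adjacent to both `x` and `y` is a common out- or a common in-neighbour; avoiding `l₀`
  -- leaves only the latter.
  target : ∀ {u} → Free u → ∀ m → ∃ λ c → RR c × c ≢ m × Arc D u c
  target fu m with core-out fu l₀ m
  ... | c , x~c , y~c , c≢l , c≢m , u→c with core-split x~c y~c
  ... | inj₁ ll = contradiction (proj₂ exceptional ll) c≢l
  ... | inj₂ rr = c , rr , c≢m , u→c

  -- Two-strongness gives `x` two out-neighbours. At most one of them is also an out-neighbour of
  -- `y`, and neither has an arc to `y`, so the other one is not adjacent to `y`.
  some-free : ∃ Free
  some-free with out-nbr xy y (here refl)
  ... | u , x→u , _ with out-nbr xy u (there (nbr xy (inj₁ x→u)))
  ... | v , x→v , v≢u with LL? u | LL? v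
  ... | no ¬LL | _ = u , free-unless (nbr xy (inj₁ x→u)) ¬LL (unmixed xy x→u ∘ proj₂)
  ... | yes _ | no ¬LL = v , free-unless (nbr xy (inj₁ x→v)) ¬LL (unmixed xy x→v ∘ proj₂)
  ... | yes (_ , a) | yes (_ , b) = contradiction (few x→v b x→u a) v≢u

  module AtFirstRR {H w T} (R≡ : R ≡ H ++ w ∷ T) (w-RR : RR w) (H-RR : All (λ v → ¬ RR v) H)
    {T₁ β T₂} (T≡ : T ≡ T₁ ++ β ∷ T₂) (β-RR : RR β) (T₂-RR : All (λ v → ¬ RR v) T₂) where

    H⊆R : ∀ {v} → v ∈ H → v ∈ R
    H⊆R v∈ = subst (_ ∈_) (sym R≡) (∈-++⁺ˡ v∈)

    T⊆R : ∀ {v} → v ∈ T → v ∈ R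
    T⊆R v∈ = subst (_ ∈_) (sym R≡) (∈-++⁺ʳ H (there v∈))

    no-out-T : ∀ {s t} → Pair x y s t → ∀ {v} → v ∈ T → ¬ Arc D s v
    no-out-T p v∈ s→v = All.lookup (proj₂ (AllPairs-middle⁻ H (subst (Mono _) R≡ (mono p)))) v∈ (RR-arc p w-RR , s→v)

    out-in-H : ∀ {s t} → Pair x y s t → ∀ {v} → Arc D s v → v ∈ H
    out-in-H p s→v with ∈-++⁻ H (subst (_ ∈_) R≡ (nbr p (inj₁ s→v)))
    ... | inj₁ v∈H = v∈H
    ... | inj₂ (here refl) = contradiction (RR-arc (flip-pair p) w-RR) (unmixed p s→v)
    ... | inj₂ (there v∈T) = contradiction s→v (no-out-T p v∈T)

    linksT : Links w T x
    linksT = proj₂ (Links-++⁻ H (subst (λ R → Links x R x) R≡ links))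

    linksH : Links x H w
    linksH = proj₁ (Links-++⁻ H (subst (λ R → Links x R x) R≡ links))

    freeT₂ : All Free T₂
    freeT₂ = all-∈ λ {v} v∈ → free-unless (T⊆R (inT v∈)) (λ ll → no-out-T xy (inT v∈) (proj₁ ll)) (All.lookup T₂-RR v∈)
      where
      inT : ∀ {v} → v ∈ T₂ → v ∈ T
      inT v∈ = subst (_ ∈_) (sym T≡) (∈-++⁺ʳ T₁ (there v∈))

    RR-in-T : ∀ {c} → RR c → c ≢ w → c ∈ T₁ ++ [ β ]
    RR-in-T rr c≢w with ∈-++⁻ H (subst (_ ∈_) R≡ (nbr xy (inj₂ (proj₁ rr))))
    ... | inj₁ c∈H = contradiction rr (All.lookup H-RR c∈H)
    ... | inj₂ (here c≡w) = contradiction c≡w c≢w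
    ... | inj₂ (there c∈T) with ∈-++⁻ T₁ (subst (_ ∈_) T≡ c∈T)
    ... | inj₁ c∈T₁ = ∈-++⁺ˡ c∈T₁
    ... | inj₂ (here refl) = ∈-++⁺ʳ T₁ (here refl)
    ... | inj₂ (there c∈T₂) = contradiction rr (All.lookup T₂-RR c∈T₂)

    -- The cycle is `s → S₁ → w → S′ → t → S₂ → u → c → T_b →
    -- s`. The free vertex `u` jumps to a common in-neighbour `c` beyond `w`; this cuts the stretch from `w` to `β` into a part led into `t` and a part led into `s`.
    -- All vertices dropped are free.
    close : ∀ {s t} → Pair x y s t → ∀ {S₁ S₂ u F} → Links s S₁ w → Links t S₂ u → Free u → All Free F → S₁ ++ S₂ ++ u ∷ F ↭ H → Goal
    close {s} {t} p {S₁} {S₂} {u} {F} l₁ l₂ free-u free-F permH with target free-u w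
    ... | c , c-RR , c≢w , u→c with ∈-∃++ (RR-in-T c-RR c≢w)
    ... | Tₐ , T_b , T≡′ with Links-++⁻ Tₐ (subst (λ L → Links w L s) T≡′ (Links-++ T₁ (proj₁ (Links-++⁻ T₁ (subst (λ T → Links w T x) T≡ linksT))) (RR-arc p β-RR)))
    ... | lₐ , l_b with trim-back {P = Free} {s = t} Tₐ (all-∈ in-or-free) (RR-arc (flip-pair p) w-RR) lₐ
      where
      inT : ∀ {v} → v ∈ Tₐ → v ∈ T
      inT v∈ with ∈-++⁻ T₁ (subst (_ ∈_) (sym T≡′) (∈-++⁺ˡ v∈))
      ... | inj₁ v∈T₁ = subst (_ ∈_) (sym T≡) (∈-++⁺ˡ v∈T₁)
      ... | inj₂ (here refl) = subst (_ ∈_) (sym T≡) (∈-insert T₁)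
      in-or-free : ∀ {v} → v ∈ Tₐ → Arc D v t ⊎ Free v
      in-or-free {v} v∈ with arc? v t
      ... | yes v→t = inj₁ v→t
      ... | no ¬v→t = inj₂ (free (flip-pair p) (T⊆R (inT v∈)) λ { (inj₁ t→v) → no-out-T (flip-pair p) (inT v∈) t→v ; (inj₂ v→t) → ¬v→t v→t })
    ... | S′ , S₀ , refl , free-S₀ , l′ =
      extend-cycle {s} {S₁ ++ w ∷ S′ ++ t ∷ S₂ ++ u ∷ c ∷ T_b} {F ++ S₀ ++ T₂}
        (Links-++ S₁ l₁ (Links-++ S′ l′ (Links-++ S₂ l₂ (u→c , l_b))))
        permutation (All.++⁺ free-F (All.++⁺ free-S₀ freeT₂))
      where
      permT : (S′ ++ S₀) ++ c ∷ T_b ++ T₂ ↭ T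
      permT = ↭-reflexive (trans (sym (++-assoc (S′ ++ S₀) (c ∷ T_b) T₂)) (trans (cong (_++ T₂) (sym T≡′)) (trans (++-assoc T₁ [ β ] T₂) (sym T≡))))
      permutation : s ∷ (S₁ ++ w ∷ S′ ++ t ∷ S₂ ++ u ∷ c ∷ T_b) ++ F ++ S₀ ++ T₂ ↭ allFin n
      permutation = ↭-trans
        (↭-solve 11 (λ s t s₁ w s′ s₂ u c f s₀ t₂ → s ⊕ ((s₁ ⊕ (w ⊕ (s′ ⊕ (t ⊕ (s₂ ⊕ (u ⊕ c)))))) ⊕ (f ⊕ (s₀ ⊕ t₂))) ⊜ s ⊕ (t ⊕ ((s₁ ⊕ (s₂ ⊕ (u ⊕ f))) ⊕ (w ⊕ ((s′ ⊕ s₀) ⊕ (c ⊕ t₂)))))) ↭-refl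
          [ s ] [ t ] S₁ [ w ] S′ S₂ [ u ] (c ∷ T_b) F S₀ T₂)
        (↭-trans (prep s (prep t (++⁺ permH (prep w permT))))
          (↭-trans (↭-reflexive (cong (λ L → s ∷ t ∷ L) (sym R≡))) (↭-trans (pair-↭ p) perm)))

    not-RR : ∀ {v} → v ∈ H → ¬ LL v → Free v
    not-RR v∈ ¬LL = free-unless (H⊆R v∈) ¬LL (All.lookup H-RR v∈)

    -- As `g` is the last vertex of `H` with an arc from the pair, a second out-neighbour `u` of `t`
    -- lies before it, and the stretch from `g` to `w` avoids `u`.
    no-sources : All (λ v → ¬ LL v) H → Goal
    no-sources none with out-nbr xy y (here refl)
    ... | o , x→o , _ with last-split-∈ O? (out-in-H xy x→o) (inj₁ x→o)
    ... | H₁ , g , H₂ , refl , g-O , H₂-O with pair-of g-O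
    ... | s , t , p , s→g with out-nbr (flip-pair p) g (there (H⊆R (∈-insert H₁)))
    ... | u , t→u , u≢g with ∈-++⁻ H₁ (out-in-H (flip-pair p) t→u)
    ... | inj₂ (here u≡g) = contradiction u≡g u≢g
    ... | inj₂ (there u∈H₂) = contradiction (O-arc (flip-pair p) t→u) (All.lookup H₂-O u∈H₂)
    ... | inj₁ u∈H₁ with ∈-∃++ u∈H₁
    ... | K₁ , K₂ , refl = close p {g ∷ H₂} {[]} {u} {K₁ ++ K₂} (s→g , proj₂ (Links-++⁻ (K₁ ++ u ∷ K₂) linksH)) t→u
      (All.lookup freeH (∈-++⁺ˡ (∈-insert K₁)))
      (All.++⁺ (proj₁ (All-middle⁻ K₁ (proj₁ (All.++⁻ (K₁ ++ u ∷ K₂) freeH)))) (proj₂ (proj₂ (All-middle⁻ K₁ (proj₁ (All.++⁻ (K₁ ++ u ∷ K₂) freeH))))))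
      (↭-solve 5 (λ g h u k k′ → (g ⊕ h) ⊕ (u ⊕ (k ⊕ k′)) ⊜ (k ⊕ (u ⊕ k′)) ⊕ (g ⊕ h)) ↭-refl [ g ] H₂ [ u ] K₁ K₂)
      where
      freeH : All Free ((K₁ ++ u ∷ K₂) ++ g ∷ H₂)
      freeH = all-∈ λ v∈ → not-RR v∈ (All.lookup none v∈)

    -- Only `l` among the vertices of `H` need not be free, so it has to lie on one of the two
    -- paths. If an out-neighbour precedes `l`, then `l` starts the path to `w`; otherwise it starts
    -- the other path, and its successor on `R` is the vertex that jumps.
    one-source : ∀ {H₁ l H₂} → H ≡ H₁ ++ l ∷ H₂ → LL l → Goal
    one-source {H₁} {l} {H₂} refl l-LL with first-split O? H₁
    ... | inj₂ (K₁ , u , K₂ , refl , u-O , _) with pair-of u-O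
    ... | t , s , p , t→u = close (flip-pair p) {l ∷ H₂} {[]} {u} {K₁ ++ K₂} (LL-arc (flip-pair p) l-LL , proj₂ (Links-++⁻ (K₁ ++ u ∷ K₂) linksH)) t→u
      (proj₁ (proj₂ (All-middle⁻ K₁ freeH₁))) (All.++⁺ (proj₁ (All-middle⁻ K₁ freeH₁)) (proj₂ (proj₂ (All-middle⁻ K₁ freeH₁))))
      (↭-solve 5 (λ g h u k k′ → (g ⊕ h) ⊕ (u ⊕ (k ⊕ k′)) ⊜ (k ⊕ (u ⊕ k′)) ⊕ (g ⊕ h)) ↭-refl [ l ] H₂ [ u ] K₁ K₂)
      where
      uniqueH : Unique ((K₁ ++ u ∷ K₂) ++ l ∷ H₂)
      uniqueH = proj₁ (AllPairs-++⁻ _ (subst Unique R≡ uniqueR))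
      freeH₁ : All Free (K₁ ++ u ∷ K₂)
      freeH₁ = all-∈ λ v∈ → not-RR (∈-++⁺ˡ v∈) λ ll → All.lookup (proj₁ (AllPairs-middle⁻ (K₁ ++ u ∷ K₂) uniqueH)) v∈ (few (proj₁ ll) (proj₂ ll) (proj₁ l-LL) (proj₂ l-LL))
    one-source {H₁} {l} {H₂} refl l-LL | inj₁ H₁-O = in-H₂ last
      where
      uniqueH : Unique (H₁ ++ l ∷ H₂)
      uniqueH = proj₁ (AllPairs-++⁻ _ (subst Unique R≡ uniqueR))
      freeH₁ : All Free H₁
      freeH₁ = all-∈ λ v∈ → not-RR (∈-++⁺ˡ v∈) λ ll → All.lookup (proj₁ (AllPairs-middle⁻ H₁ uniqueH)) v∈ (few (proj₁ ll) (proj₂ ll) (proj₁ l-LL) (proj₂ l-LL))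
      freeH₂ : All Free H₂
      freeH₂ = all-∈ λ v∈ → not-RR (∈-++⁺ʳ H₁ (there v∈)) λ ll → All.lookup (proj₂ (AllPairs-middle⁻ H₁ uniqueH)) v∈ (few (proj₁ l-LL) (proj₂ l-LL) (proj₁ ll) (proj₂ ll))
      other-out : ∀ {s t} → Pair x y s t → ∃ λ u → Arc D s u × u ∈ H₂
      other-out p with out-nbr p l (there (H⊆R (∈-insert H₁)))
      ... | u , s→u , u≢l with ∈-++⁻ H₁ (out-in-H p s→u)
      ... | inj₁ u∈H₁ = contradiction (O-arc p s→u) (All.lookup H₁-O u∈H₁)
      ... | inj₂ (here u≡l) = contradiction u≡l u≢l
      ... | inj₂ (there u∈H₂) = u , s→u , u∈H₂
      LastOut : Set
      LastOut = ∃ λ M → ∃ λ v → ∃ λ N → H₂ ≡ M ++ v ∷ N × O v × All (λ w → ¬ O w) N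
      last : LastOut
      last with other-out xy
      ... | u , x→u , u∈ = last-split-∈ O? u∈ (inj₁ x→u)
      in-H₂ : LastOut → Goal
      in-H₂ (K , g , N , refl , g-O , N-O) with pair-of g-O
      ... | s , t , p , s→g with other-out (flip-pair p)
      ... | u , t→u , u∈ with ∈-++⁻ K u∈
      ... | inj₂ (here refl) = contradiction (few (proj₁ l-LL) (proj₂ l-LL) (proj₁ g-LL) (proj₂ g-LL)) (All.lookup (proj₂ (AllPairs-middle⁻ H₁ uniqueH)) (∈-insert K))
        where
        g-LL : LL g
        g-LL = both-arcs p s→g t→u
      ... | inj₂ (there u∈N) = contradiction (O-arc (flip-pair p) t→u) (All.lookup N-O u∈N)
      -- `u` lies in `K`, so `K` is not empty; its head `v`, the successor of `l`, comes before `g`.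
      in-H₂ (v ∷ K , g , N , refl , g-O , N-O) | s , t , p , s→g | u , t→u , u∈ | inj₁ _ =
        close p {g ∷ N} {[ l ]} {v} {H₁ ++ K} (s→g , proj₂ (Links-++⁻ K (proj₂ lv))) (LL-arc (flip-pair p) l-LL , proj₁ lv)
          (All.head freeH₂) (All.++⁺ freeH₁ (proj₁ (All-middle⁻ K (All.tail freeH₂))))
          (↭-solve 6 (λ g n l v h k → (g ⊕ n) ⊕ (l ⊕ (v ⊕ (h ⊕ k))) ⊜ h ⊕ (l ⊕ (v ⊕ (k ⊕ (g ⊕ n))))) ↭-refl [ g ] N [ l ] [ v ] H₁ K)
        where
        lv : Links l (v ∷ K ++ g ∷ N) w
        lv = proj₂ (Links-++⁻ H₁ linksH)

    conclude : Goal
    conclude with first-split LL? H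
    ... | inj₁ none = no-sources none
    ... | inj₂ (H₁ , l , H₂ , H≡ , l-LL , _) = one-source H≡ l-LL

  goal : Goal
  goal with some-free
  ... | u , free-u with target free-u u
  ... | c , c-RR , _ with first-split-∈ RR? (nbr xy (inj₂ (proj₁ c-RR))) c-RR
  ... | H , w , T , R≡ , w-RR , H-RR with target free-u w
  ... | c′ , c′-RR , c′≢w , _ with last-split-∈ RR? c′∈T c′-RR
    where
    c′∈T : c′ ∈ T
    c′∈T with ∈-++⁻ H (subst (c′ ∈_) R≡ (nbr xy (inj₂ (proj₁ c′-RR))))
    ... | inj₁ c′∈H = contradiction c′-RR (All.lookup H-RR c′∈H)
    ... | inj₂ (here c′≡w) = contradiction c′≡w c′≢w
    ... | inj₂ (there c′∈T) = c′∈T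
  ... | T₁ , β , T₂ , T≡ , β-RR , T₂-RR = AtFirstRR.conclude R≡ w-RR H-RR T≡ β-RR T₂-RR

module _ {P : Set} where

  χ : Dec P → ℕ
  χ d = if Dec.does d then 1 else 0

  χ-yes : (d : Dec P) → P → χ d ≡ 1
  χ-yes (yes _) _ = refl
  χ-yes (no ¬p) p = contradiction p ¬p

  χ-no : (d : Dec P) → ¬ P → χ d ≡ 0
  χ-no (yes p) ¬p = contradiction p ¬p
  χ-no (no _) _ = refl

  χ-≤ : ∀ {k} (d : Dec P) → (P → 1 ≤ k) → χ d ≤ k
  χ-≤ (yes p) f = f p
  χ-≤ (no _) f = z≤n

Links-reverse : ∀ {n} (D : Digraph n) {u v} L → Walks.Links D u L v → Walks.Links (flip D) v (reverse L) u
Links-reverse D [] a = a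
Links-reverse D {u} {v} (w ∷ L) (a , l) rewrite unfold-reverse w L = Walks.Links-++ (flip D) (reverse L) (Links-reverse D L l) a

-- Consequences of 2-strongness

module TwoStrong {n : ℕ} (D : Digraph n) (loopless : Loopless D) (3≤n : 3 ≤ n)
  (strong : ∀ t {u v} → u ≢ t → v ≢ t → ReachAvoiding D ⁅ t ⁆ u v) where

  open Walks D
  open import Data.List.Membership.DecPropositional (_≟_ {n}) using (_∈?_)

  Arc⇒≢ : ∀ {u v} → Arc D u v → u ≢ v
  Arc⇒≢ {u} a refl with trans (sym a) (loopless u)
  ... | ()

  adj-refl : ∀ u → adj u u ≡ 0
  adj-refl u rewrite loopless u = refl

  ∑-adj-self : ∀ {u L} → u ∈ L → ∑ (adj u) L + 2 ≤ length L * 2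
  ∑-adj-self {u} u∈ with ∈-∃++ u∈
  ... | L , M , refl rewrite ∑-++ (adj u) L (u ∷ M) | adj-refl u | length-∷ʳ-middle L u M | length-++ L {M} =
    self-arith (∑ (adj u) L) (∑ (adj u) M) (length L) (length M)
      (∑-≤-* 2 (all-∈ {L = L} λ {v} _ → adj≤2 u v)) (∑-≤-* 2 (all-∈ {L = M} λ {v} _ → adj≤2 u v))

  third-vertex : ∀ (u v : Fin n) → ∃ λ w → w ≢ u × w ≢ v
  third-vertex u v with first-split (λ w → ¬? (w ≟ u) ×-dec ¬? (w ≟ v)) (allFin n)
  ... | inj₂ (_ , w , _ , _ , p , _) = w , p
  ... | inj₁ none = contradiction (≤-trans 3≤n n≤2) λ { (s≤s (s≤s ())) }
    where
    one≤ : ∀ {w} → ¬ (w ≢ u × w ≢ v) → 1 ≤ ind 1 u w + ind 1 v w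
    one≤ {w} h with w ≟ u | w ≟ v
    ... | yes _ | _ = s≤s z≤n
    ... | no _ | yes _ = s≤s z≤n
    ... | no p | no q = contradiction (p , q) h
    n≤2 : n ≤ 2
    n≤2 = begin
      n                                               ≡⟨ length-tabulate id ⟨
      length (allFin n)                               ≡⟨ ∑-≡1 (all-∈ {L = allFin n} λ _ → refl) ⟨
      ∑ (λ _ → 1) (allFin n)                          ≤⟨ ∑-≤ (All.map one≤ none) ⟩
      ∑ (λ w → ind 1 u w + ind 1 v w) (allFin n)      ≡⟨ ∑-+ (ind 1 u) (ind 1 v) (allFin n) ⟩
      ∑ (ind 1 u) (allFin n) + ∑ (ind 1 v) (allFin n) ≤⟨ +-mono-≤ (∑-ind≤ 1 u (allFin⁺ n)) (∑-ind≤ 1 v (allFin⁺ n)) ⟩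
      2                                               ∎
      where open ≤-Reasoning

  out-neighbour : ∀ s t → s ≢ t → ∃ λ v → Arc D s v × v ≢ t
  out-neighbour s t s≢t with third-vertex s t
  ... | w , w≢s , w≢t with strong t s≢t w≢t
  ... | ReachAvoiding.here = contradiction refl w≢s
  ... | ReachAvoiding.step a v∉ _ = _ , a , x∉⁅y⁆⇒x≢y v∉

  in-neighbour : ∀ s t → s ≢ t → ∃ λ v → Arc D v s × v ≢ t
  in-neighbour s t s≢t with third-vertex s t
  ... | w , w≢s , w≢t = last-arc w≢s w≢t (strong t w≢t s≢t)
    where
    last-arc : ∀ {u} → u ≢ s → u ≢ t → ReachAvoiding D ⁅ t ⁆ u s → ∃ λ v → Arc D v s × v ≢ t
    last-arc u≢s u≢t ReachAvoiding.here = contradiction refl u≢s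
    last-arc {u} u≢s u≢t (ReachAvoiding.step {y = w} a w∉ r) with w ≟ s
    ... | yes refl = u , a , u≢t
    ... | no w≢s = last-arc w≢s (x∉⁅y⁆⇒x≢y w∉) r

  -- A walk from `u` to `v` that avoids `t` must leave `Left` somewhere, and `closed` turns the arc
  -- on which it does so into `G`.
  crossing : ∀ {G : Set} (Left : Fin n → Set) t {u v} → u ≢ t → v ≢ t → Left u → ¬ Left v →
    (∀ {p q} → Left p → Arc D p q → q ≢ t → G ⊎ Left q) → G
  crossing {G} Left t u≢t v≢t Lu ¬Lv closed = walk Lu (strong t u≢t v≢t)
    where
    walk : ∀ {u} → Left u → ReachAvoiding D ⁅ t ⁆ u _ → G
    walk Lu ReachAvoiding.here = contradiction Lu ¬Lv
    walk Lu (ReachAvoiding.step a w∉ r) with closed Lu a (x∉⁅y⁆⇒x≢y w∉)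
    ... | inj₁ g = g
    ... | inj₂ Lw = walk Lw r

  -- The walk is cut at the vertex where it first meets `C`, and at each step a return to the
  -- current vertex is short-cut.
  entering-path : ∀ (C : List (Fin n)) {t u v} → u ∉ C → v ∈ C → ReachAvoiding D ⁅ t ⁆ u v →
    ∃₂ λ P a → Links u P a × a ∈ C × a ≢ t × Unique (u ∷ P) × All (_∉ C) (u ∷ P)
  entering-path C u∉ v∈ ReachAvoiding.here = contradiction v∈ u∉
  entering-path C {u = u} u∉ v∈ (ReachAvoiding.step {y = w} a w∉t r) with w ∈? C
  ... | yes w∈ = [] , w , a , w∈ , x∉⁅y⁆⇒x≢y w∉t , [] ∷ [] , u∉ ∷ []
  ... | no w∉ with entering-path C w∉ v∈ r
  ... | P , b , l , b∈ , b≢t , uniq , out with u ∈? (w ∷ P)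
  ... | no u∉P = w ∷ P , b , (a , l) , b∈ , b≢t , all-∈ (λ { v∈P refl → u∉P v∈P }) ∷ uniq , u∉ ∷ out
  ... | yes u∈P with ∈-∃++ u∈P
  ... | [] , M , refl = M , b , l , b∈ , b≢t , uniq , out
  ... | _ ∷ L , M , refl = M , b , proj₂ (Links-++⁻ L l) , b∈ , b≢t ,
    proj₁ (proj₂ (AllPairs-++⁻ (w ∷ L) uniq)) , proj₂ (All.++⁻ (w ∷ L) out)

  rotate : ∀ {v L b} → Links v L v → b ∈ v ∷ L → ∃ λ M → Links b M b × b ∷ M ↭ v ∷ L
  rotate l (here refl) = _ , l , ↭-refl
  rotate {v} l (there b∈) with ∈-∃++ b∈
  ... | L₁ , L₂ , refl with Links-++⁻ L₁ l
  ... | l₁ , l₂ = L₂ ++ v ∷ L₁ , Links-++ L₂ l₂ l₁ ,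
    ↭-solve 4 (λ b v l m → b ⊕ (m ⊕ (v ⊕ l)) ⊜ v ⊕ (l ⊕ (b ⊕ m))) ↭-refl [ _ ] [ v ] L₁ L₂

  -- A cycle through all vertices but one

  -- A special case of the theorem of Berman and Liu on cycles through Meyniel sets.
  module CycleThroughAllBut (x : Fin n)
    (meyniel : ∀ {u v} → u ≢ x → v ≢ x → u ≢ v → ¬ Adjacent D u v → 2 * n ≤ deg D u + deg D v + 1) where

    -- Every other vertex outweighs x, so that an exchange may lose x when it gains another vertex.
    weight : Fin n → ℕ
    weight v = if Dec.does (v ≟ x) then 1 else 2

    weight-≢ : ∀ {v} → v ≢ x → weight v ≡ 2
    weight-≢ {v} v≢x with v ≟ x
    ... | yes e = contradiction e v≢x
    ... | no _ = refl

    1≤weight : ∀ v → 1 ≤ weight v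
    1≤weight v with v ≟ x
    ... | yes _ = s≤s z≤n
    ... | no _ = s≤s z≤n

    record Cycle : Set where
      constructor cycle
      field
        v : Fin n
        on off : List (Fin n)
        links : Links v on v
        perm : v ∷ on ++ off ↭ allFin n

      missing : ℕ
      missing = ∑ weight off

    Better : ℕ → Set
    Better κ = ∃ λ C → Cycle.missing C < κ

    -- The cycle runs through `b`, `gap`, `a`, `rest` and back to `b`; the path `b → z → path → a`
    -- is off it. `κ` is the weight missed by this cycle, so it does not change when an end of the
    -- detour moves into the gap.
    record Detour (κ : ℕ) : Set where
      constructor detour
      field
        b a z : Fin n
        gap rest path off : List (Fin n)
        gap-links : Links b gap a
        rest-links : Links a rest b
        path-links : Links b (z ∷ path) a
        perm : b ∷ gap ++ a ∷ rest ++ z ∷ path ++ off ↭ allFin n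
        missing≡ : ∑ weight (z ∷ path ++ off) ≡ κ

    good : ∀ {κ} → Detour κ → Set
    good d = Detour.z d ≢ x

    -- Over an empty gap nothing is lost, so even a detour that starts with `x` gains. This covers
    -- an exchange out of reach of `from-gap`.
    skip-empty-gap : ∀ {κ} (d : Detour κ) → Detour.gap d ≡ [] → Better κ
    skip-empty-gap (detour b a z [] rest path off g r p perm refl) refl =
      cycle b (z ∷ path ++ a ∷ rest) off (Links-++ (z ∷ path) p r)
        (↭-trans (↭-solve 6 (λ b a z r p o → b ⊕ ((z ⊕ (p ⊕ (a ⊕ r))) ⊕ o) ⊜ b ⊕ (a ⊕ (r ⊕ (z ⊕ (p ⊕ o))))) ↭-refl [ b ] [ a ] [ z ] rest path off) perm) ,
      ≤-trans (s≤s (≤-trans (m≤n+m (∑ weight off) (∑ weight path)) (≤-reflexive (sym (∑-++ weight path off)))))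
        (+-monoˡ-≤ (∑ weight (path ++ off)) (1≤weight z))

    module Shorten {κ} (d : Detour κ) where
      open Detour d

      Result : Set
      Result = Better κ ⊎ (Σ (Detour κ) λ d′ → good d′ × length (Detour.gap d′) < length gap)

      E : List (Fin n)
      E = path ++ off

      b→z : Arc D b z
      b→z = proj₁ path-links

      module AtGapVertex {G₁ u G₂} (split : gap ≡ G₁ ++ u ∷ G₂) where

        gapG : Links b (G₁ ++ u ∷ G₂) a
        gapG = subst (λ G → Links b G a) split gap-links

        permG : b ∷ (G₁ ++ u ∷ G₂) ++ a ∷ rest ++ z ∷ E ↭ allFin n
        permG = subst (λ G → b ∷ G ++ a ∷ rest ++ z ∷ E ↭ allFin n) split perm

        into-gap : ∀ {P O} → good d → Links b (z ∷ P) u → z ∷ P ++ O ↭ z ∷ E → Result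
        into-gap {P} {O} z≢x l p = inj₂ (detour b u z G₁ (G₂ ++ a ∷ rest) P O (proj₁ s) (Links-++ G₂ (proj₂ s) rest-links) l
          (↭-trans (↭-trans (↭-solve 7 (λ b g u h a r e → b ⊕ (g ⊕ (u ⊕ ((h ⊕ (a ⊕ r)) ⊕ e))) ⊜ (b ⊕ ((g ⊕ (u ⊕ h)) ⊕ (a ⊕ r))) ⊕ e) ↭-refl [ b ] G₁ [ u ] G₂ [ a ] rest (z ∷ P ++ O))
            (++⁺ˡ (b ∷ (G₁ ++ u ∷ G₂) ++ a ∷ rest) p))
            (↭-trans (↭-reflexive (cong (b ∷_) (++-assoc (G₁ ++ u ∷ G₂) (a ∷ rest) (z ∷ E)))) permG))
          (trans (∑-↭ weight p) missing≡) , z≢x ,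
          ≤-trans (s≤s (≤-trans (m≤m+n (length G₁) (length G₂)) (≤-reflexive (sym (length-++ G₁ {G₂})))))
            (≤-reflexive (trans (sym (length-∷ʳ-middle G₁ u G₂)) (cong length (sym split)))))
          where s = Links-++⁻ G₁ gapG

        from-gap-detour : ∀ {q P O} → Links u (q ∷ P) a → q ∷ P ++ O ↭ z ∷ E → Σ (Detour κ) λ d′ → Detour.z d′ ≡ q × Detour.gap d′ ≡ G₂
        from-gap-detour {q} {P} {O} l p = detour u a q G₂ (rest ++ b ∷ G₁) P O (proj₂ s) (Links-++ rest rest-links (proj₁ s)) l
          (↭-trans (↭-trans (↭-solve 7 (λ b g u h a r e → u ⊕ (h ⊕ (a ⊕ ((r ⊕ (b ⊕ g)) ⊕ e))) ⊜ (b ⊕ ((g ⊕ (u ⊕ h)) ⊕ (a ⊕ r))) ⊕ e) ↭-refl [ b ] G₁ [ u ] G₂ [ a ] rest (q ∷ P ++ O))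
            (++⁺ˡ (b ∷ (G₁ ++ u ∷ G₂) ++ a ∷ rest) p))
            (↭-trans (↭-reflexive (cong (b ∷_) (++-assoc (G₁ ++ u ∷ G₂) (a ∷ rest) (z ∷ E)))) permG))
          (trans (∑-↭ weight p) missing≡) , refl , refl
          where s = Links-++⁻ G₁ gapG

        from-gap : ∀ {q P O} → q ≢ x → Links u (q ∷ P) a → q ∷ P ++ O ↭ z ∷ E → Result
        from-gap q≢x l p with from-gap-detour l p
        ... | d′ , refl , refl = inj₂ (d′ , q≢x ,
          ≤-trans (s≤s (≤-trans (m≤n+m (length G₂) (length G₁)) (≤-reflexive (sym (length-++ G₁ {G₂})))))
            (≤-reflexive (trans (sym (length-∷ʳ-middle G₁ u G₂)) (cong length (sym split)))))

        nonadjacent : good d → Result ⊎ ¬ Adjacent D z u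
        nonadjacent z≢x with arc? z u | arc? u z
        ... | yes z→u | _ = inj₁ (into-gap z≢x (b→z , z→u) ↭-refl)
        ... | no _ | yes u→z = inj₁ (from-gap z≢x (u→z , proj₂ path-links) ↭-refl)
        ... | no ¬z→u | no ¬u→z = inj₂ λ { (inj₁ p) → ¬z→u p ; (inj₂ p) → ¬u→z p }

        forward : good d → ∀ {q} → q ∈ E → Arc D z q → Arc D q u → Result
        forward z≢x q∈ z→q q→u with ∈-∃++ q∈
        ... | E₁ , E₂ , eq = into-gap z≢x (b→z , z→q , q→u) (prep z (↭-trans (↭-sym (shift _ E₁ E₂)) (↭-reflexive (sym eq))))

        -- A vertex `q` on the detour continues along it; a vertex off the detour enters it through
        -- `z`.
        backward-path : ∀ {q} → q ∈ E → Arc D u q → Arc D q z → ∃₂ λ P O → Links u (q ∷ P) a × q ∷ P ++ O ↭ z ∷ E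
        backward-path {q} q∈ u→q q→z with ∈-++⁻ path q∈
        ... | inj₂ q∈off with ∈-∃++ q∈off
        ... | O₁ , O₂ , eq = z ∷ path , O₁ ++ O₂ , (u→q , q→z , proj₂ path-links) ,
          ↭-trans (↭-solve 5 (λ q z p o o′ → q ⊕ (z ⊕ (p ⊕ (o ⊕ o′))) ⊜ z ⊕ (p ⊕ (o ⊕ (q ⊕ o′)))) ↭-refl [ q ] [ z ] path O₁ O₂)
            (↭-reflexive (cong (λ o → z ∷ path ++ o) (sym eq)))
        backward-path {q} q∈ u→q q→z | inj₁ q∈path with ∈-∃++ q∈path
        ... | P₁ , P₂ , eq = P₂ , z ∷ P₁ ++ off ,
          (u→q , proj₂ (Links-++⁻ P₁ (subst (λ p → Links z p a) eq (proj₂ path-links)))) ,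
          ↭-trans (↭-solve 5 (λ q z p p′ o → q ⊕ (p′ ⊕ (z ⊕ (p ⊕ o))) ⊜ z ⊕ ((p ⊕ (q ⊕ p′)) ⊕ o)) ↭-refl [ q ] [ z ] P₁ P₂ off)
            (↭-reflexive (cong (λ p → z ∷ p ++ off) (sym eq)))

        two-arcs : good d → ∀ {q} → q ∈ E → (Arc D u q → Arc D q z → Result) → Result ⊎ adj z q + adj u q ≤ 2
        two-arcs z≢x {q} q∈ back with arc? z q ×-dec arc? q u
        ... | yes (z→q , q→u) = inj₁ (forward z≢x q∈ z→q q→u)
        ... | no ¬f with arc? u q ×-dec arc? q z
        ... | yes (u→q , q→z) = inj₁ (back u→q q→z)
        ... | no ¬b = inj₂ (subst (_≤ 2) (sum-swap (arc z q) (arc q u) (arc u q) (arc q z)) (+-mono-≤ (arcs≤1 z q q u ¬f) (arcs≤1 u q q z ¬b)))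

        -- The weaker bound is meant for `q ≡ x`: a detour `u → x → …` would start with `x` and not
        -- be good, so the arcs `u → q` and `q → z` cannot be excluded together.
        three-arcs : good d → ∀ {q} → q ∈ E → Result ⊎ adj z q + adj u q ≤ 3
        three-arcs z≢x {q} q∈ with arc? z q ×-dec arc? q u
        ... | yes (z→q , q→u) = inj₁ (forward z≢x q∈ z→q q→u)
        ... | no ¬f = inj₂ (subst (_≤ 3) (sum-swap (arc z q) (arc q u) (arc u q) (arc q z)) (+-mono-≤ (arcs≤1 z q q u ¬f) (+-mono-≤ (arc≤1 u q) (arc≤1 q z))))

        outer-bound : good d → ∀ δ → (∀ {q} → q ∈ E → q ≡ x → Result ⊎ adj z q + adj u q ≤ 2 + δ) →
          Result ⊎ ∑ (adj z) E + ∑ (adj u) E ≤ length E * 2 + δ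
        outer-bound z≢x δ atx with all-or E bound
          where
          bound : ∀ {q} → q ∈ E → Result ⊎ adj z q + adj u q ≤ 2 + ind δ x q
          bound {q} q∈ with q ≟ x
          ... | yes e = atx q∈ e
          ... | no q≢x with two-arcs z≢x q∈ (λ u→q q→z → let P , O , l , p = backward-path q∈ u→q q→z in from-gap q≢x l p)
          ... | inj₁ r = inj₁ r
          ... | inj₂ le = inj₂ (≤-trans le (≤-reflexive (sym (+-identityʳ 2))))
        ... | inj₁ r = inj₁ r
        ... | inj₂ bounds = inj₂ (begin
          ∑ (adj z) E + ∑ (adj u) E          ≡⟨ ∑-+ (adj z) (adj u) E ⟨
          ∑ (λ q → adj z q + adj u q) E      ≤⟨ ∑-≤ bounds ⟩
          ∑ (λ q → 2 + ind δ x q) E          ≡⟨ ∑-+ (λ _ → 2) (ind δ x) E ⟩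
          ∑ (λ _ → 2) E + ∑ (ind δ x) E      ≤⟨ +-mono-≤ (∑-≤-* 2 (all-∈ {L = E} λ _ → ≤-refl)) (∑-ind≤ δ x uniqueE) ⟩
          length E * 2 + δ                   ∎)
          where
          open ≤-Reasoning
          uniqueE : Unique E
          uniqueE with proj₁ (proj₂ (AllPairs-++⁻ (b ∷ gap ++ a ∷ rest ++ [ z ])
            (Unique-resp-↭ (↭-trans (↭-sym perm) (↭-solve 6 (λ b g a r z e → b ⊕ (g ⊕ (a ⊕ (r ⊕ (z ⊕ e)))) ⊜ (b ⊕ (g ⊕ (a ⊕ (r ⊕ z)))) ⊕ e) ↭-refl [ b ] gap [ a ] rest [ z ] E)) (allFin⁺ n))))
          ... | uE = uE

      module Gain (z≢x : good d) where
        module I = MaxInsertion (maximal-insertion (λ _ → ⊤) a b gap (λ _ _ _ _ _ → tt) rest tt rest-links)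

        T rest′ : List (Fin n)
        T = I.left
        rest′ = I.path

        allUnique : Unique (b ∷ gap ++ a ∷ rest ++ z ∷ E)
        allUnique = Unique-resp-↭ (↭-sym perm) (allFin⁺ n)

        z∉gap : z ∉ gap
        z∉gap z∈ with AllPairs-++⁻ (b ∷ gap) allUnique
        ... | _ , _ , x = All.lookup (All.lookup x (there z∈)) (there (∈-++⁺ʳ rest (here refl))) refl

        perm′ : b ∷ a ∷ rest′ ++ T ++ z ∷ E ↭ allFin n
        perm′ = ↭-trans (prep b (prep a (↭-trans (↭-reflexive (sym (++-assoc rest′ T (z ∷ E)))) (++⁺ʳ (z ∷ E) I.perm))))
          (↭-trans (↭-solve 5 (λ b a r g e → b ⊕ (a ⊕ ((r ⊕ g) ⊕ e)) ⊜ b ⊕ (g ⊕ (a ⊕ (r ⊕ e)))) ↭-refl [ b ] [ a ] rest gap (z ∷ E)) perm)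

        T∩x≤1 : All (λ v → ¬ v ≢ x) T → ∑ weight T ≤ 1
        T∩x≤1 all≡x = ≤-trans (∑-≤ (All.map weight≤ all≡x)) (∑-ind≤ 1 x uniqueT)
          where
          uniqueT : Unique T
          uniqueT = proj₁ (AllPairs-++⁻ T (proj₁ (proj₂ (AllPairs-++⁻ (b ∷ a ∷ rest′) (Unique-resp-↭ (↭-sym perm′) (allFin⁺ n))))))
          weight≤ : ∀ {v} → ¬ v ≢ x → weight v ≤ ind 1 x v
          weight≤ {v} h with v ≟ x
          ... | yes _ = ≤-refl
          ... | no v≢x = contradiction v≢x h

        -- The new cycle gains `z`, of weight 2, and `T` contributes at most 1 to what is lost; the
        -- inserted gap vertices stay on it.
        detour-improves : ∑ weight T ≤ 1 → Better κ
        detour-improves T≤1 = cycle b (z ∷ path ++ a ∷ rest′) (T ++ off) (Links-++ (z ∷ path) path-links I.links)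
          (↭-trans (↭-solve 7 (λ b a z r p t o → b ⊕ ((z ⊕ (p ⊕ (a ⊕ r))) ⊕ (t ⊕ o)) ⊜ b ⊕ (a ⊕ (r ⊕ (t ⊕ (z ⊕ (p ⊕ o)))))) ↭-refl [ b ] [ a ] [ z ] rest′ path T off) perm′) ,
          (begin-strict
            ∑ weight (T ++ off)                      ≡⟨ ∑-++ weight T off ⟩
            ∑ weight T + ∑ weight off                <⟨ s≤s (+-monoˡ-≤ (∑ weight off) T≤1) ⟩
            2 + ∑ weight off                         ≤⟨ +-mono-≤ (≤-reflexive (sym (weight-≢ z≢x))) (m≤n+m (∑ weight off) (∑ weight path)) ⟩
            weight z + (∑ weight path + ∑ weight off) ≡⟨ cong (weight z +_) (∑-++ weight path off) ⟨
            weight z + ∑ weight E                    ≡⟨ missing≡ ⟩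
            κ                                        ∎)
          where open ≤-Reasoning

        insertion-improves : Insertable z a rest b → Better κ
        insertion-improves (Q₁ , Q₂ , refl , l) = cycle b (gap ++ a ∷ Q₁ ++ z ∷ Q₂) E (Links-++ gap gap-links l)
          (↭-trans (↭-solve 7 (λ b a z g q r e → b ⊕ ((g ⊕ (a ⊕ (q ⊕ (z ⊕ r)))) ⊕ e) ⊜ b ⊕ (g ⊕ (a ⊕ ((q ⊕ r) ⊕ (z ⊕ e))))) ↭-refl [ b ] [ a ] [ z ] gap Q₁ Q₂ E) perm) ,
          ≤-trans (+-monoˡ-≤ (∑ weight E) (1≤weight z)) (≤-reflexive missing≡)

        deg-z : All (λ v → ¬ Adjacent D z v) gap → deg D z ≡ adj z b + adj z a + ∑ (adj z) rest + ∑ (adj z) E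
        deg-z nonadj = trans (deg-↭ z (↭-trans (↭-solve 6 (λ b a z g r e → b ⊕ (a ⊕ (r ⊕ (g ⊕ (z ⊕ e)))) ⊜ b ⊕ (g ⊕ (a ⊕ (r ⊕ (z ⊕ e))))) ↭-refl [ b ] [ a ] [ z ] gap rest E) perm))
          (trans (cong (λ s → adj z b + (adj z a + s)) (trans (∑-++ (adj z) rest _) (cong (∑ (adj z) rest +_)
            (trans (∑-++ (adj z) gap _) (cong₂ _+_ (∑-≡0 (All.map ¬Adjacent⇒adj≡0 nonadj)) (cong (_+ ∑ (adj z) E) (adj-refl z)))))))
            (sum₄ (adj z b) (adj z a) (∑ (adj z) rest) (∑ (adj z) E)))

        deg-u : ∀ u → ¬ Adjacent D u z → deg D u ≡ adj u b + adj u a + ∑ (adj u) rest′ + ∑ (adj u) T + ∑ (adj u) E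
        deg-u u nonadj = trans (deg-↭ u perm′)
          (trans (cong (λ s → adj u b + (adj u a + s)) (trans (∑-++ (adj u) rest′ _) (cong (∑ (adj u) rest′ +_)
            (trans (∑-++ (adj u) T _) (cong (∑ (adj u) T +_) (cong (_+ ∑ (adj u) E) (¬Adjacent⇒adj≡0 nonadj)))))))
            (sum₅ (adj u b) (adj u a) (∑ (adj u) rest′) (∑ (adj u) T) (∑ (adj u) E)))

        n≡ : n ≡ 3 + length gap + length rest + length E
        n≡ = trans (sym (length-tabulate id)) (trans (sym (↭-length perm)) (trans (cong suc (trans (length-++ gap) (cong (λ k → length gap + suc k) (length-++ rest)))) (count₅ (length gap) (length rest) (length E))))

        lengths : length rest′ + length T ≡ length rest + length gap
        lengths = trans (sym (length-++ rest′)) (trans (↭-length I.perm) (length-++ rest))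

        -- `z` is adjacent to nothing in the gap and does not fit into `rest`, and `u` does not fit
        -- into `rest′`. If the outer arcs are bounded too, the degree sum is at most 2n - 2,
        -- against `meyniel`.
        count : ∀ {u} → u ∈ gap → u ∈ T → u ≢ x → ∀ δ → length T + δ ≤ length gap →
          Result ⊎ ∑ (adj z) E + ∑ (adj u) E ≤ length E * 2 + δ → Result
        count u∈gap u∈T u≢x δ T<gap (inj₁ r) = r
        count {u} u∈gap u∈T u≢x δ T<gap (inj₂ outer) with insertable-or-tight z a rest b rest-links
        ... | inj₁ i = inj₁ (insertion-improves i)
        ... | inj₂ tight-z with all-or gap (λ v∈ → AtGapVertex.nonadjacent (proj₂ (proj₂ (∈-∃++ v∈))) z≢x)
        ... | inj₁ r = r
        ... | inj₂ nonadj = contradiction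
          (too-small (meyniel z≢x u≢x (λ { refl → z∉gap u∈gap }) (All.lookup nonadj u∈gap))
            (degree-sum-arith n (deg D z) (deg D u) (∑ (adj z) E) (∑ (adj u) T) (∑ (adj u) E)
              (length rest) (length rest′) (length T) (length gap) (length E) δ n≡ lengths
              (≤-trans (≤-reflexive (deg-z nonadj)) (+-monoˡ-≤ (∑ (adj z) E) (tight-degree z a rest b tight-z)))
              (≤-trans (≤-reflexive (deg-u u (All.lookup nonadj u∈gap ∘ swap)))
                (+-monoˡ-≤ (∑ (adj u) E) (+-monoˡ-≤ (∑ (adj u) T) (tight-degree u a rest′ b (All.lookup I.tight u∈T)))))
              (∑-adj-self u∈T) outer T<gap))
          λ ()

        shorten : Result
        shorten with first-split (λ v → ¬? (v ≟ x)) T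
        ... | inj₁ all≡x = inj₁ (detour-improves (T∩x≤1 all≡x))
        ... | inj₂ (T₁ , u , T₂ , eqT , u≢x , _) = choose I.progress
          where
          u∈T : u ∈ T
          u∈T = subst (u ∈_) (sym eqT) (∈-insert T₁)
          u∈gap : u ∈ gap
          u∈gap = All.lookup I.left⊆ u∈T
          choose : T ≡ gap ⊎ length T < length gap → Result
          -- At least one gap vertex was inserted, which pays for a third arc at `x`.
          choose (inj₂ T<gap) = count u∈gap u∈T u≢x 1 (≤-trans (≤-reflexive (+-comm (length T) 1)) T<gap)
            (outer-bound z≢x 1 (λ q∈ _ → three-arcs z≢x q∈))
            where open AtGapVertex (proj₂ (proj₂ (∈-∃++ u∈gap)))
          choose (inj₁ T≡gap) with last-split (λ _ → yes tt) gap
          ... | inj₁ none = contradiction tt (All.lookup none u∈gap)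
          ... | inj₂ (G , g , w ∷ G′ , split , _ , none) = contradiction tt (All.head none)
          ... | inj₂ (G , g , [] , split , _ , _) with g ≟ x
          -- Nothing was inserted, so no excess is affordable. For the last gap vertex `g` there is
          -- none: a path `g → q → z` leaves an empty gap behind it and improves the cycle at once,
          -- even for `q ≡ x`.
          ... | no g≢x = count g∈gap (subst (g ∈_) (sym T≡gap) g∈gap) g≢x 0 T≤gap
            (outer-bound z≢x 0 λ q∈ _ → two-arcs z≢x q∈ λ g→q q→z →
              let P , O , l , p = backward-path q∈ g→q q→z
                  d′ , _ , gap≡[] = from-gap-detour l p
              in inj₁ (skip-empty-gap d′ gap≡[]))
            where
            open AtGapVertex split
            g∈gap : g ∈ gap
            g∈gap = subst (g ∈_) (sym split) (∈-insert G)
            T≤gap : length T + 0 ≤ length gap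
            T≤gap = ≤-reflexive (trans (+-identityʳ _) (cong length T≡gap))
          -- Here `x` is on the cycle, so the exceptional outer vertex does not occur.
          ... | yes g≡x = count u∈gap u∈T u≢x 0 T≤gap
            (outer-bound z≢x 0 λ q∈ q≡x → ⊥-elim (g∉E (subst (_∈ E) (trans q≡x (sym g≡x)) q∈)))
            where
            open AtGapVertex (proj₂ (proj₂ (∈-∃++ u∈gap)))
            T≤gap : length T + 0 ≤ length gap
            T≤gap = ≤-reflexive (trans (+-identityʳ _) (cong length T≡gap))
            g∉E : g ∉ E
            g∉E g∈E with AllPairs-++⁻ (b ∷ gap) allUnique
            ... | _ , _ , x = All.lookup (All.lookup x (there (subst (g ∈_) (sym split) (∈-insert G)))) (there (∈-++⁺ʳ rest (there g∈E))) refl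

    improve : ∀ {κ} k (d : Detour κ) → good d → length (Detour.gap d) ≤ k → Better κ
    improve k d g gap≤k with Shorten.Gain.shorten d g
    ... | inj₁ better = better
    improve zero d g gap≤k | inj₂ (d′ , g′ , shorter) = contradiction (≤-trans shorter gap≤k) λ ()
    improve (suc k) d g gap≤k | inj₂ (d′ , g′ , shorter) = improve k d′ g′ (≤-pred (≤-trans shorter gap≤k))

    -- The walk is taken in `D` minus `x`, so that the outside vertex found differs from `x` and
    -- starts a good detour.
    exit : ∀ C {z₀ c} → z₀ ∉ C → z₀ ≢ x → c ∈ C → c ≢ x → ∃₂ λ b z → b ∈ C × z ∉ C × z ≢ x × Arc D b z
    exit C z₀∉ z₀≢x c∈ c≢x = crossing (_∈ C) x c≢x z₀≢x c∈ z₀∉ λ {p} {q} p∈ a q≢x → case q ∈? C of λ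
      { (yes q∈) → inj₂ q∈ ; (no q∉) → inj₁ (p , q , p∈ , q∉ , q≢x , a) }

    two-elements : ∀ {v : Fin n} {w L} t → Unique (v ∷ w ∷ L) → ∃ λ c → c ∈ v ∷ w ∷ L × c ≢ t
    two-elements {v} {w} t ((v≢w ∷ _) ∷ _) with v ≟ t
    ... | no v≢t = v , here refl , v≢t
    ... | yes refl = w , there (here refl) , λ { refl → v≢w refl }

    cycle-step : (C : Cycle) → All (_≡ x) (Cycle.off C) ⊎ Better (Cycle.missing C)
    cycle-step (cycle v [] off l perm) = contradiction refl (Arc⇒≢ l)
    cycle-step (cycle v (w ∷ on) off l perm) with first-split (λ u → ¬? (u ≟ x)) off
    ... | inj₁ all≡x = inj₁ (All.map (λ {u} h → case u ≟ x of λ { (yes e) → e ; (no ¬e) → contradiction ¬e h }) all≡x)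
    ... | inj₂ (O₁ , z₀ , O₂ , refl , z₀≢x , _) = inj₂ result
      where
      C = v ∷ w ∷ on
      off′ = O₁ ++ z₀ ∷ O₂
      unique : Unique (C ++ off′)
      unique = Unique-resp-↭ (↭-sym perm) (allFin⁺ n)
      uniqueC : Unique C
      uniqueC = proj₁ (AllPairs-++⁻ C unique)
      z₀∉C : z₀ ∉ C
      z₀∉C z₀∈ = All.lookup (All.lookup (proj₂ (proj₂ (AllPairs-++⁻ C unique))) z₀∈) (∈-insert O₁) refl
      inOff : ∀ {u} → u ∉ C → u ∈ off′
      inOff {u} u∉ with ∈-++⁻ C (∈-resp-↭ (↭-sym perm) (∈-allFin u))
      ... | inj₁ u∈ = contradiction u∈ u∉
      ... | inj₂ u∈ = u∈
      result : Better (∑ weight off′)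
      result with two-elements x uniqueC
      ... | c , c∈ , c≢x with exit C z₀∉C z₀≢x c∈ c≢x
      -- The return path avoids `b`, so it ends at another vertex of the cycle and the two ends
      -- delimit a gap.
      ... | b , z , b∈ , z∉ , z≢x , b→z with two-elements b uniqueC
      ... | c′ , c′∈ , c′≢b with entering-path C z∉ c′∈ (strong b (λ { refl → z∉ b∈ }) c′≢b)
      ... | P , a , l′ , a∈ , a≢b , uniqueP , P∉ with rotate l b∈
      ... | M , lM , pM with ∈-resp-↭ (↭-sym pM) a∈
      ... | here a≡b = contradiction a≡b a≢b
      ... | there a∈M with ∈-∃++ a∈M
      ... | U , Q , refl with complement off′ uniqueP (All.map inOff P∉)
      ... | O , pO = improve (length U) (detour b a z U Q P O (proj₁ s) (proj₂ s) (b→z , l′)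
          (↭-trans (↭-trans (↭-reflexive (cong (b ∷_) (sym (++-assoc U (a ∷ Q) (z ∷ P ++ O))))) (++⁺ pM (↭-sym pO))) perm)
          (∑-↭ weight (↭-sym pO))) z≢x ≤-refl
        where s = Links-++⁻ U lM

    initial-cycle : Cycle
    initial-cycle with third-vertex x x
    ... | t , t≢x , _ with out-neighbour x t (λ e → t≢x (sym e))
    ... | w , x→w , w≢t with entering-path [ x ] (λ { (here e) → Arc⇒≢ x→w (sym e) }) (here refl) (strong t w≢t (λ e → t≢x (sym e)))
    ... | P , a , l , here refl , _ , uniqueP , P∉ with complement (allFin n) (All.map (λ { u∉ refl → u∉ (here refl) }) P∉ ∷ uniqueP) (all-∈ λ {u} _ → ∈-allFin u)
    ... | O , p = cycle x (w ∷ P) O (x→w , l) (↭-sym p)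

    spanning : ∃ λ C → All (_≡ x) (Cycle.off C)
    spanning = go (Cycle.missing initial-cycle) initial-cycle ≤-refl
      where
      go : ∀ k C → Cycle.missing C ≤ k → ∃ λ C → All (_≡ x) (Cycle.off C)
      go k C m≤k with cycle-step C
      ... | inj₁ done = C , done
      go zero C m≤k | inj₂ (C′ , m<) = contradiction (≤-trans m< m≤k) λ ()
      go (suc k) C m≤k | inj₂ (C′ , m<) = go k C′ (≤-pred (≤-trans m< m≤k))

    spanning-all-but : (∃₂ λ v L → Links v L v × v ∷ L ↭ allFin n) ⊎ (∃₂ λ v L → Links v L v × x ∷ v ∷ L ↭ allFin n)
    spanning-all-but with spanning
    ... | cycle v L [] l p , _ = inj₁ (v , L , l , ↭-trans (↭-reflexive (cong (v ∷_) (sym (++-identityʳ L)))) p)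
    ... | cycle v L (_ ∷ []) l p , refl ∷ [] = inj₂ (v , L , l , ↭-trans (↭-solve 3 (λ x v l → x ⊕ (v ⊕ l) ⊜ v ⊕ (l ⊕ x)) ↭-refl [ x ] [ v ] L) p)
    ... | cycle v L (_ ∷ _ ∷ O) l p , refl ∷ refl ∷ _ with AllPairs-++⁻ (v ∷ L) (Unique-resp-↭ (↭-sym p) (allFin⁺ n))
    ... | _ , (x≢x ∷ _) ∷ _ , _ = contradiction refl x≢x

  -- Inserting a single missing vertex

  left≤ : ∀ {P a Q b F} (I : MaxInsertion P a Q b F) → length (MaxInsertion.left I) ≤ length F
  left≤ I with MaxInsertion.progress I
  ... | inj₁ e = ≤-reflexive (cong length e)
  ... | inj₂ p = <⇒≤ p

  Heavy : Fin n → Fin n → Set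
  Heavy u v = ¬ Adjacent D u v → 2 * n ≤ deg D u + deg D v + 1

  -- A neighbour of `x` in the gap yields a shorter gap. When none is left, either `x` fits into
  -- `Q`, or all of `G` moves into `Q` and `x` takes its place; otherwise `x` and a stuck gap vertex
  -- have degree sum at most 2n - 2. Heaviness is asked of the gap alone, so a light partner of `x`
  -- may stand elsewhere on the cycle.
  gap-hamiltonian : ∀ {x} k c G c′ Q → length G ≤ k → Links c G c′ → Links c′ Q c → Arc D c x → Arc D x c′ →
    x ∷ c ∷ G ++ c′ ∷ Q ↭ allFin n → (∀ {u} → u ∈ G → Heavy x u) → Hamiltonian D
  gap-hamiltonian {x} k c G c′ Q G≤k lG lQ c→x x→c′ perm heavy with first-split (adjacent? x) G
  gap-hamiltonian {x} zero c _ c′ Q G≤k lG lQ c→x x→c′ perm heavy | inj₂ (G₁ , g , G₂ , refl , _ , _) =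
    contradiction (subst (_≤ 0) (length-∷ʳ-middle G₁ g G₂) G≤k) λ ()
  gap-hamiltonian {x} (suc k) c _ c′ Q G≤k lG lQ c→x x→c′ perm heavy | inj₂ (G₁ , g , G₂ , refl , adjacent , _)
    with Links-++⁻ G₁ lG | ≤-pred (subst (_≤ suc k) (trans (length-∷ʳ-middle G₁ g G₂) (cong suc (length-++ G₁))) G≤k)
  ... | l₁ , l₂ | len with adjacent
  ... | inj₁ x→g = gap-hamiltonian k c G₁ g (G₂ ++ c′ ∷ Q) (≤-trans (m≤m+n _ _) len) l₁ (Links-++ G₂ l₂ lQ) c→x x→g
    (↭-trans (↭-reflexive (cong (λ L → x ∷ c ∷ L) (sym (++-assoc G₁ (g ∷ G₂) (c′ ∷ Q))))) perm) (heavy ∘ ∈-++⁺ˡ)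
  ... | inj₂ g→x = gap-hamiltonian k g G₂ c′ (Q ++ c ∷ G₁) (≤-trans (m≤n+m _ _) len) l₂ (Links-++ Q lQ l₁) g→x x→c′
    (↭-trans (↭-solve 7 (λ x c g₁ g g₂ c′ q → x ⊕ (g ⊕ (g₂ ⊕ (c′ ⊕ (q ⊕ (c ⊕ g₁))))) ⊜ x ⊕ (c ⊕ ((g₁ ⊕ (g ⊕ g₂)) ⊕ (c′ ⊕ q)))) ↭-refl [ x ] [ c ] G₁ [ g ] G₂ [ c′ ] Q) perm)
    (heavy ∘ ∈-++⁺ʳ G₁ ∘ there)
  gap-hamiltonian {x} k c G c′ Q G≤k lG lQ c→x x→c′ perm heavy | inj₁ nonadj = by-insertion I.left refl
    where
    I : MaxInsertion (λ _ → ⊤) c′ Q c G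
    I = maximal-insertion (λ _ → ⊤) c′ c G (λ _ _ _ _ _ → tt) Q tt lQ
    module I = MaxInsertion I
    perm′ : c ∷ c′ ∷ I.path ++ I.left ++ [ x ] ↭ allFin n
    perm′ = ↭-trans (prep c (prep c′ (↭-trans (↭-reflexive (sym (++-assoc I.path I.left [ x ]))) (++⁺ʳ [ x ] I.perm))))
      (↭-trans (↭-solve 5 (λ x c g c′ q → c ⊕ (c′ ⊕ ((q ⊕ g) ⊕ x)) ⊜ x ⊕ (c ⊕ (g ⊕ (c′ ⊕ q)))) ↭-refl [ x ] [ c ] G [ c′ ] Q) perm)
    deg-x : deg D x ≡ adj x c + adj x c′ + ∑ (adj x) Q + 0
    deg-x = trans (deg-↭ x (↭-trans (↭-solve 5 (λ x c g c′ q → c ⊕ (c′ ⊕ (q ⊕ (g ⊕ x))) ⊜ x ⊕ (c ⊕ (g ⊕ (c′ ⊕ q)))) ↭-refl [ x ] [ c ] G [ c′ ] Q) perm))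
      (trans (cong (λ s → adj x c + (adj x c′ + s)) (trans (∑-++ (adj x) Q _) (cong (∑ (adj x) Q +_)
        (trans (∑-++ (adj x) G _) (cong₂ _+_ (∑-≡0 (All.map ¬Adjacent⇒adj≡0 nonadj)) (cong (_+ 0) (adj-refl x)))))))
        (sum₄ (adj x c) (adj x c′) (∑ (adj x) Q) 0))
    deg-u : ∀ u → ¬ Adjacent D u x → deg D u ≡ adj u c + adj u c′ + ∑ (adj u) I.path + ∑ (adj u) I.left + 0
    deg-u u ¬adj = trans (deg-↭ u perm′)
      (trans (cong (λ s → adj u c + (adj u c′ + s)) (trans (∑-++ (adj u) I.path _) (cong (∑ (adj u) I.path +_)
        (trans (∑-++ (adj u) I.left _) (cong (∑ (adj u) I.left +_) (cong (_+ 0) (¬Adjacent⇒adj≡0 ¬adj)))))))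
        (sum₅ (adj u c) (adj u c′) (∑ (adj u) I.path) (∑ (adj u) I.left) 0))
    n≡ : n ≡ 3 + length G + length Q + 0
    n≡ = trans (sym (length-tabulate id)) (trans (sym (↭-length perm)) (trans (cong (suc ∘ suc) (length-++ G)) (count₄ (length G) (length Q))))
    lengths : length I.path + length I.left ≡ length Q + length G
    lengths = trans (sym (length-++ I.path)) (trans (↭-length I.perm) (length-++ Q))
    by-insertion : ∀ T → I.left ≡ T → Hamiltonian D
    by-insertion [] left≡[] = hamiltonian {c} {x ∷ c′ ∷ I.path} (c→x , x→c′ , I.links)
      (↭-trans (↭-solve 4 (λ x c c′ p → c ⊕ (x ⊕ (c′ ⊕ p)) ⊜ c ⊕ (c′ ⊕ (p ⊕ x))) ↭-refl [ x ] [ c ] [ c′ ] I.path)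
        (subst (λ T → c ∷ c′ ∷ I.path ++ T ++ [ x ] ↭ allFin n) left≡[] perm′))
    by-insertion (u ∷ T) left≡ with insertable-or-tight x c′ Q c lQ
    ... | inj₁ (Q₁ , Q₂ , refl , l) = hamiltonian (Links-++ G lG l)
      (↭-trans (↭-solve 6 (λ x c g c′ q r → c ⊕ (g ⊕ (c′ ⊕ (q ⊕ (x ⊕ r)))) ⊜ x ⊕ (c ⊕ (g ⊕ (c′ ⊕ (q ⊕ r))))) ↭-refl [ x ] [ c ] G [ c′ ] Q₁ Q₂) perm)
    ... | inj₂ tight = contradiction
      (too-small (heavy u∈G (All.lookup nonadj u∈G))
        (degree-sum-arith n (deg D x) (deg D u) 0 (∑ (adj u) I.left) 0
          (length Q) (length I.path) (length I.left) (length G) 0 0 n≡ lengths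
          (≤-trans (≤-reflexive deg-x) (+-monoˡ-≤ 0 (tight-degree x c′ Q c tight)))
          (≤-trans (≤-reflexive (deg-u u (All.lookup nonadj u∈G ∘ swap)))
            (+-monoˡ-≤ 0 (+-monoˡ-≤ (∑ (adj u) I.left) (tight-degree u c′ I.path c (All.lookup I.tight u∈left)))))
          (∑-adj-self u∈left) z≤n (≤-trans (≤-reflexive (+-identityʳ _)) (left≤ I))))
      λ ()
      where
      u∈left : u ∈ I.left
      u∈left = subst (u ∈_) (sym left≡) (here refl)
      u∈G : u ∈ G
      u∈G = All.lookup I.left⊆ u∈left

  -- An in-neighbour and a different out-neighbour of `x` delimit a gap on the cycle that misses
  -- `x`.
  meyniel-hamiltonian : (∀ {u v} → u ≢ v → Heavy u v) → Fin n → Hamiltonian D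
  meyniel-hamiltonian heavy x with CycleThroughAllBut.spanning-all-but x (λ _ _ u≢v → heavy u≢v)
  ... | inj₁ (v , L , l , p) = hamiltonian l p
  ... | inj₂ (v , L , l , p) with third-vertex x x
  ... | t , t≢x , _ with out-neighbour x t (t≢x ∘ sym)
  ... | a , x→a , _ with in-neighbour x a (Arc⇒≢ x→a)
  ... | b , b→x , b≢a with rotate l (on-cycle (Arc⇒≢ b→x))
    where
    on-cycle : ∀ {u} → u ≢ x → u ∈ v ∷ L
    on-cycle {u} u≢x with ∈-resp-↭ (↭-sym p) (∈-allFin u)
    ... | here u≡x = contradiction u≡x u≢x
    ... | there u∈ = u∈
  ... | M , lM , pM with ∈-resp-↭ (↭-sym (↭-trans (prep x pM) p)) (∈-allFin a)
  ... | here a≡x = contradiction (sym a≡x) (Arc⇒≢ x→a)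
  ... | there (here a≡b) = contradiction (sym a≡b) b≢a
  ... | there (there a∈) with ∈-∃++ a∈
  ... | G , Q , refl with Links-++⁻ G lM
  ... | lG , lQ = gap-hamiltonian (length G) b G a Q ≤-refl lG lQ b→x x→a perm (λ u∈ → heavy (x≢ u∈))
    where
    perm : x ∷ b ∷ G ++ a ∷ Q ↭ allFin n
    perm = ↭-trans (prep x pM) p
    x≢ : ∀ {u} → u ∈ G → x ≢ u
    x≢ u∈ with Unique-resp-↭ (↭-sym perm) (allFin⁺ n)
    ... | x∉ ∷ _ = All.lookup x∉ (there (∈-++⁺ˡ u∈))

  -- Monotone lists and degrees

  mono? : ∀ s R → Mono s R ⊎ (∃ λ R₁ → ∃ λ c → ∃ λ G → ∃ λ c′ → ∃ λ R₂ → R ≡ R₁ ++ c ∷ G ++ c′ ∷ R₂ × Arc D c s × Arc D s c′)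
  mono? s [] = inj₁ []
  mono? s (c ∷ R) with mono? s R
  ... | inj₂ (R₁ , d , G , d′ , R₂ , refl , a , b) = inj₂ (c ∷ R₁ , d , G , d′ , R₂ , refl , a , b)
  ... | inj₁ mono with arc? c s
  ... | no ¬c→s = inj₁ (all-∈ (λ _ → ¬c→s ∘ proj₁) ∷ mono)
  ... | yes c→s with first-split (arc? s) R
  ... | inj₁ none = inj₁ (All.map (_∘ proj₂) none ∷ mono)
  ... | inj₂ (G , c′ , R₂ , refl , s→c′ , _) = inj₂ ([] , c , G , c′ , R₂ , refl , c→s , s→c′)

  -- A violation of monotonicity is a gap from an in-neighbour to an out-neighbour of `s`. It lies
  -- within `R` and hence does not contain `t`, the only vertex that may be light against `s`.
  mono-or-hamiltonian : ∀ {s t R} → (∀ {u} → s ≢ u → t ≢ u → Heavy s u) → Links t R t → s ∷ t ∷ R ↭ allFin n → Hamiltonian D ⊎ Mono s R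
  mono-or-hamiltonian {s} {t} {R} heavy l perm with mono? s R
  ... | inj₁ mono = inj₂ mono
  ... | inj₂ (R₁ , c , G , c′ , R₂ , refl , c→s , s→c′) with Links-++⁻ R₁ l
  ... | l₁ , l₂ with Links-++⁻ G l₂
  ... | lG , l₃ = inj₁ (gap-hamiltonian (length G) c G c′ (R₂ ++ t ∷ R₁) ≤-refl lG (Links-++ R₂ l₃ l₁) c→s s→c′
    (↭-trans (↭-solve 7 (λ s t r c g c′ r′ → s ⊕ (c ⊕ (g ⊕ (c′ ⊕ (r′ ⊕ (t ⊕ r))))) ⊜ s ⊕ (t ⊕ (r ⊕ (c ⊕ (g ⊕ (c′ ⊕ r′)))))) ↭-refl [ s ] [ t ] R₁ [ c ] G [ c′ ] R₂) perm)
    (λ u∈ → heavy (All.lookup s∉ (there (inR u∈))) (All.lookup t∉ (inR u∈))))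
    where
    unique : Unique (s ∷ t ∷ R₁ ++ c ∷ G ++ c′ ∷ R₂)
    unique = Unique-resp-↭ (↭-sym perm) (allFin⁺ n)
    s∉ : All (s ≢_) (t ∷ R₁ ++ c ∷ G ++ c′ ∷ R₂)
    s∉ with unique
    ... | p ∷ _ = p
    t∉ : All (t ≢_) (R₁ ++ c ∷ G ++ c′ ∷ R₂)
    t∉ with unique
    ... | _ ∷ p ∷ _ = p
    inR : ∀ {u} → u ∈ G → u ∈ R₁ ++ c ∷ G ++ c′ ∷ R₂
    inR u∈ = ∈-++⁺ʳ R₁ (there (∈-++⁺ˡ u∈))

  nonadj : Fin n → Fin n → ℕ
  nonadj s v = if Dec.does (adjacent? s v) then 0 else 1

  adj+nonadj≤1 : ∀ s v → ¬ (Arc D s v × Arc D v s) → adj s v + nonadj s v ≤ 1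
  adj+nonadj≤1 s v ¬both with D s v | D v s
  ... | true | true = contradiction (refl , refl) ¬both
  ... | true | false = ≤-refl
  ... | false | true = ≤-refl
  ... | false | false = ≤-refl

  -- Before the first in-neighbour `c` of `s` there are only arcs from `s`, after it only arcs to
  -- `s`: every vertex gives at most one arc, a non-neighbour none, and `c` alone may give two.
  mono-degree : ∀ s L → Mono s L → ∑ (adj s) L + ∑ (nonadj s) L ≤ length L + 1
  mono-degree s [] [] = z≤n
  mono-degree s (c ∷ L) (p ∷ mono) = by (arc? c s)
    where
    nonadj≡0 : Arc D c s → nonadj s c ≡ 0
    nonadj≡0 c→s rewrite c→s with D s c
    ... | true = refl
    ... | false = refl
    by : Dec (Arc D c s) → ∑ (adj s) (c ∷ L) + ∑ (nonadj s) (c ∷ L) ≤ length (c ∷ L) + 1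
    by (no ¬c→s) = mono-arith₂ (adj s c) (∑ (adj s) L) (length L) (∑ (nonadj s) L) (nonadj s c)
      (adj+nonadj≤1 s c (¬c→s ∘ proj₂)) (mono-degree s L mono)
    by (yes c→s) = subst (λ k → adj s c + ∑ (adj s) L + (k + ∑ (nonadj s) L) ≤ suc (length L) + 1) (sym (nonadj≡0 c→s))
      (mono-arith₁ (adj s c) (∑ (adj s) L) (length L) (∑ (nonadj s) L) (adj≤2 s c)
        (≤-trans (≤-reflexive (sym (∑-+ (adj s) (nonadj s) L)))
          (≤-trans (∑-≤-* 1 (All.map (λ {v} h → adj+nonadj≤1 s v (λ { (s→v , _) → h (c→s , s→v) })) p)) (≤-reflexive (*-identityʳ (length L))))))

  AllPairs-insert-inside : ∀ {ρ : Fin n → Fin n → Set} {a b u} Q₁ Q₂ → (∀ v → ρ u v) → (∀ v → ρ v u) →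
    AllPairs ρ (a ∷ (Q₁ ++ Q₂) ++ [ b ]) → AllPairs ρ (a ∷ (Q₁ ++ u ∷ Q₂) ++ [ b ])
  AllPairs-insert-inside {ρ} {a} {b} {u} Q₁ Q₂ r s ap =
    subst (λ L → AllPairs ρ (a ∷ L)) (sym (++-assoc Q₁ (u ∷ Q₂) [ b ]))
      (AllPairs-insert (a ∷ Q₁) r s (subst (λ L → AllPairs ρ (a ∷ L)) (++-assoc Q₁ Q₂ [ b ]) ap))

  -- The light pair and its monotone path

  module BadPair {x y : Fin n} (x≢y : x ≢ y) (x≁y : ¬ Adjacent D x y) (light : deg D x + deg D y + 2 ≤ 2 * n)
    (others : ∀ {u v} → u ≢ v → ¬ Adjacent D u v → ¬ ((x ≡ u × y ≡ v) ⊎ (x ≡ v × y ≡ u)) → 4 * n ≤ deg D x + deg D y + (deg D u + deg D v) + 3) where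

    heavy : ∀ {u v} → u ≢ v → ¬ ((x ≡ u × y ≡ v) ⊎ (x ≡ v × y ≡ u)) → Heavy u v
    heavy {u} {v} u≢v distinct u≁v = others-arith n (deg D x + deg D y) (deg D u + deg D v) (others u≢v u≁v distinct) light

    heavy-x : ∀ {u} → x ≢ u → y ≢ u → Heavy x u
    heavy-x x≢u y≢u = heavy x≢u λ { (inj₁ (_ , y≡u)) → y≢u y≡u ; (inj₂ (x≡u , _)) → x≢u x≡u }

    heavy-y : ∀ {u} → y ≢ u → x ≢ u → Heavy y u
    heavy-y y≢u x≢u = heavy y≢u λ { (inj₁ (x≡y , _)) → x≢y x≡y ; (inj₂ (x≡u , _)) → x≢u x≡u }

    module Spanning {R} (perm : x ∷ y ∷ R ↭ allFin n) where

      unique : Unique (x ∷ y ∷ R)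
      unique = Unique-resp-↭ (↭-sym perm) (allFin⁺ n)

      x∉ : All (x ≢_) R
      x∉ with unique
      ... | (_ ∷ p) ∷ _ = p

      y∉ : All (y ≢_) R
      y∉ with unique
      ... | _ ∷ p ∷ _ = p

      uniqueR : Unique R
      uniqueR with unique
      ... | _ ∷ _ ∷ p = p

      covers : ∀ {u} → x ≢ u → y ≢ u → u ∈ R
      covers {u} x≢u y≢u with ∈-resp-↭ (↭-sym perm) (∈-allFin u)
      ... | here e = contradiction (sym e) x≢u
      ... | there (here e) = contradiction (sym e) y≢u
      ... | there (there u∈) = u∈

      x-nbr : ∀ {u} → Adjacent D x u → u ∈ R
      x-nbr a@(inj₁ x→u) = covers (Arc⇒≢ x→u) λ { refl → x≁y a }
      x-nbr a@(inj₂ u→x) = covers (Arc⇒≢ u→x ∘ sym) λ { refl → x≁y a }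

      y-nbr : ∀ {u} → Adjacent D y u → u ∈ R
      y-nbr a@(inj₁ y→u) = covers (λ { refl → x≁y (swap a) }) (Arc⇒≢ y→u)
      y-nbr a@(inj₂ u→y) = covers (λ { refl → x≁y (swap a) }) (Arc⇒≢ u→y ∘ sym)

    record MonoPath : Set where
      constructor monoPath
      field
        {R} : List (Fin n)
        links : Links x R x
        perm : x ∷ y ∷ R ↭ allFin n
        mono-x : Mono x R
        mono-y : Mono y R

    -- Monotonicity puts all neighbours of `x` between its first out-neighbour `a` and its last
    -- in-neighbour `b`. The vertices outside are non-adjacent to `x`, and one that could not be
    -- absorbed between `a` and `b` would form a pair with `x` that is too light. The cycle then
    -- misses `y` instead of `x`, as the monotonicity argument for `y` requires.
    switch : ∀ {R} → Links y R y → x ∷ y ∷ R ↭ allFin n → Mono x R →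
      ∃ λ R′ → Links x R′ x × x ∷ y ∷ R′ ↭ allFin n × Mono x R′
    switch {R} l perm mono with out-neighbour x y x≢y
    ... | a₀ , x→a₀ , _ with first-split-∈ (arc? x) (Spanning.x-nbr perm (inj₁ x→a₀)) x→a₀
    ... | R₁ , a , Rₐ , refl , x→a , R₁-out with in-neighbour x a (Arc⇒≢ x→a)
    ... | b₀ , b₀→x , b₀≢a with last-split-∈ (λ b → arc? b x) b₀∈ b₀→x
      where
      b₀∈ : b₀ ∈ Rₐ
      b₀∈ with ∈-++⁻ R₁ (Spanning.x-nbr perm (inj₂ b₀→x))
      ... | inj₁ b₀∈R₁ = contradiction (b₀→x , x→a) (All.lookup (proj₁ (AllPairs-middle⁻ R₁ mono)) b₀∈R₁)
      ... | inj₂ (here e) = contradiction e b₀≢a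
      ... | inj₂ (there b₀∈) = b₀∈
    ... | Q , b , R₂ , refl , b→x , R₂-in = by-insertion I.left refl
      where
      F : List (Fin n)
      F = R₁ ++ R₂
      lQ : Links a Q b
      lQ = proj₁ (Links-++⁻ Q (proj₂ (Links-++⁻ R₁ l)))
      mono₂ : Mono x (a ∷ Q ++ b ∷ R₂)
      mono₂ = proj₁ (proj₂ (AllPairs-++⁻ R₁ mono))
      monoQ : Mono x (a ∷ Q ++ [ b ])
      monoQ = proj₁ (AllPairs-++⁻ (a ∷ Q ++ [ b ]) (subst (λ L → Mono x (a ∷ L)) (sym (++-assoc Q [ b ] R₂)) mono₂))
      nonadjR₁ : All (λ v → ¬ Adjacent D x v) R₁
      nonadjR₁ = all-∈ λ v∈ → λ { (inj₁ x→v) → All.lookup R₁-out v∈ x→v ; (inj₂ v→x) → All.lookup (proj₁ (AllPairs-middle⁻ R₁ mono)) v∈ (v→x , x→a) }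
      nonadjR₂ : All (λ v → ¬ Adjacent D x v) R₂
      nonadjR₂ = all-∈ λ v∈ → λ { (inj₁ x→v) → All.lookup (proj₂ (AllPairs-middle⁻ (a ∷ Q) mono₂)) v∈ (b→x , x→v) ; (inj₂ v→x) → All.lookup R₂-in v∈ v→x }
      nonadjF : All (λ v → ¬ Adjacent D x v) F
      nonadjF = All.++⁺ nonadjR₁ nonadjR₂
      I : MaxInsertion (λ Q → Mono x (a ∷ Q ++ [ b ])) a Q b F
      I = maximal-insertion (λ Q → Mono x (a ∷ Q ++ [ b ])) a b F
        (λ Q₁ u Q₂ u∈ → AllPairs-insert-inside Q₁ Q₂
          (λ v → λ { (u→x , _) → All.lookup nonadjF u∈ (inj₂ u→x) }) (λ v → λ { (_ , x→u) → All.lookup nonadjF u∈ (inj₁ x→u) }))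
        Q monoQ lQ
      module I = MaxInsertion I
      permF : x ∷ y ∷ a ∷ b ∷ Q ++ F ↭ allFin n
      permF = ↭-trans (↭-solve 7 (λ x y a b q f g → x ⊕ (y ⊕ (a ⊕ (b ⊕ (q ⊕ (f ⊕ g))))) ⊜ x ⊕ (y ⊕ (f ⊕ (a ⊕ (q ⊕ (b ⊕ g)))))) ↭-refl [ x ] [ y ] [ a ] [ b ] Q R₁ R₂) perm
      perm′ : x ∷ y ∷ a ∷ b ∷ I.path ++ I.left ↭ allFin n
      perm′ = ↭-trans (++⁺ˡ (x ∷ y ∷ a ∷ b ∷ []) I.perm) permF
      deg-x : deg D x ≤ 2 + length Q + 1
      deg-x = begin
        deg D x                        ≡⟨ deg-↭ x (↭-trans (↭-solve 6 (λ x y a b q f → x ⊕ (y ⊕ (f ⊕ (a ⊕ (q ⊕ b)))) ⊜ x ⊕ (y ⊕ (a ⊕ (b ⊕ (q ⊕ f))))) ↭-refl [ x ] [ y ] [ a ] [ b ] Q F) permF) ⟩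
        adj x x + (adj x y + ∑ (adj x) (F ++ a ∷ Q ++ [ b ]))  ≡⟨ cong₂ (λ i j → i + (j + ∑ (adj x) (F ++ a ∷ Q ++ [ b ]))) (adj-refl x) (¬Adjacent⇒adj≡0 x≁y) ⟩
        ∑ (adj x) (F ++ a ∷ Q ++ [ b ])             ≡⟨ ∑-++ (adj x) F _ ⟩
        ∑ (adj x) F + ∑ (adj x) (a ∷ Q ++ [ b ])    ≡⟨ cong (_+ ∑ (adj x) (a ∷ Q ++ [ b ])) (∑-≡0 (All.map ¬Adjacent⇒adj≡0 nonadjF)) ⟩
        ∑ (adj x) (a ∷ Q ++ [ b ])                  ≤⟨ m≤m+n _ _ ⟩
        ∑ (adj x) (a ∷ Q ++ [ b ]) + ∑ (nonadj x) (a ∷ Q ++ [ b ]) ≤⟨ mono-degree x (a ∷ Q ++ [ b ]) monoQ ⟩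
        length (a ∷ Q ++ [ b ]) + 1                 ≡⟨ cong (λ k → suc k + 1) (trans (length-++ Q) (+-comm (length Q) 1)) ⟩
        2 + length Q + 1                            ∎
        where open ≤-Reasoning
      by-insertion : ∀ T → I.left ≡ T → ∃ λ R′ → Links x R′ x × x ∷ y ∷ R′ ↭ allFin n × Mono x R′
      by-insertion [] left≡[] = a ∷ I.path ++ [ b ] , (x→a , Links-++ I.path I.links b→x) ,
        ↭-trans (↭-solve 5 (λ x y a b p → x ⊕ (y ⊕ (a ⊕ (p ⊕ b))) ⊜ x ⊕ (y ⊕ (a ⊕ (b ⊕ p)))) ↭-refl [ x ] [ y ] [ a ] [ b ] I.path)
          (subst (λ L → x ∷ y ∷ a ∷ b ∷ L ↭ allFin n) (trans (cong (I.path ++_) left≡[]) (++-identityʳ I.path)) perm′) ,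
        I.preserved
      by-insertion (u ∷ T) left≡ = contradiction
        (too-small (heavy-x (All.lookup (Spanning.x∉ perm) u∈R) (All.lookup (Spanning.y∉ perm) u∈R) x≁u)
          (path-arith n (deg D x) (deg D u) (adj u y) (adj u a) (adj u b) (∑ (adj u) I.path) (∑ (adj u) I.left)
            (length Q) (length I.path) (length I.left) (length F)
            (trans (deg-↭ u perm′) (cong₂ (λ i j → i + (adj u y + (adj u a + (adj u b + j)))) (¬Adjacent⇒adj≡0 (x≁u ∘ swap)) (∑-++ (adj u) I.path I.left)))
            (trans (sym (length-tabulate id)) (trans (sym (↭-length permF)) (cong (4 +_) (length-++ Q))))
            (trans (sym (length-++ I.path)) (trans (↭-length I.perm) (length-++ Q)))
            deg-x (tight-degree u a I.path b (All.lookup I.tight u∈left)) (∑-adj-self u∈left) (left≤ I) (adj≤2 u y)))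
        λ ()
        where
        u∈left : u ∈ I.left
        u∈left = subst (u ∈_) (sym left≡) (here refl)
        u∈F : u ∈ F
        u∈F = All.lookup I.left⊆ u∈left
        x≁u : ¬ Adjacent D x u
        x≁u = All.lookup nonadjF u∈F
        u∈R : u ∈ R₁ ++ a ∷ Q ++ b ∷ R₂
        u∈R with ∈-++⁻ R₁ u∈F
        ... | inj₁ u∈R₁ = ∈-++⁺ˡ u∈R₁
        ... | inj₂ u∈R₂ = ∈-++⁺ʳ R₁ (there (∈-++⁺ʳ Q (there u∈R₂)))

    mono-path-from : ∀ {v L} → Links v L v → x ∷ v ∷ L ↭ allFin n → Hamiltonian D ⊎ MonoPath
    mono-path-from {v} {L} l p with rotate l y∈
      where
      y∈ : y ∈ v ∷ L
      y∈ with ∈-resp-↭ (↭-sym p) (∈-allFin y)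
      ... | here y≡x = contradiction (sym y≡x) x≢y
      ... | there y∈ = y∈
    ... | R , lR , pR = [ inj₁ , (λ mono → switched (switch lR permR mono)) ]′ (mono-or-hamiltonian heavy-x lR permR)
      where
      permR : x ∷ y ∷ R ↭ allFin n
      permR = ↭-trans (prep x pR) p
      switched : (∃ λ R′ → Links x R′ x × x ∷ y ∷ R′ ↭ allFin n × Mono x R′) → Hamiltonian D ⊎ MonoPath
      switched (R′ , l′ , p′ , mono-x) = Sum.map₂ (monoPath l′ p′ mono-x)
        (mono-or-hamiltonian heavy-y l′ (↭-trans (↭.swap y x ↭-refl) p′))

    mono-path : Hamiltonian D ⊎ MonoPath
    mono-path =
      [ (λ (v , L , l , p) → inj₁ (hamiltonian l p))
      , (λ (v , L , l , p) → mono-path-from l p)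
      ]′ (CycleThroughAllBut.spanning-all-but x λ u≢x v≢x u≢v →
        heavy u≢v λ { (inj₁ (x≡u , _)) → u≢x (sym x≡u) ; (inj₂ (x≡v , _)) → v≢x (sym x≡v) })

    -- Free vertices: high degree and absorption

    Free : Fin n → Set
    Free v = x ≢ v × y ≢ v × (¬ Adjacent D x v ⊎ ¬ Adjacent D y v)

    free? : ∀ v → Dec (Free v)
    free? v = ¬? (x ≟ v) ×-dec (¬? (y ≟ v) ×-dec (¬? (adjacent? x v) ⊎-dec ¬? (adjacent? y v)))

    Core : Fin n → Set
    Core v = Adjacent D x v × Adjacent D y v

    core? : ∀ v → Dec (Core v)
    core? v = adjacent? x v ×-dec adjacent? y v

    core-or-free : ∀ {v} → x ≢ v → y ≢ v → ¬ Core v → Free v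
    core-or-free {v} x≢v y≢v ¬core with adjacent? x v
    ... | no x≁v = x≢v , y≢v , inj₁ x≁v
    ... | yes x~v = x≢v , y≢v , inj₂ (λ y~v → ¬core (x~v , y~v))

    free : Fin n → ℕ
    free v = χ (free? v)

    μ : ℕ
    μ = ∑ free (allFin n)

    free-adj : ∀ {u} → Free u → adj u x + adj u y ≤ 2
    free-adj {u} (_ , _ , inj₁ x≁u) = +-mono-≤ (≤-reflexive (¬Adjacent⇒adj≡0 (x≁u ∘ swap))) (adj≤2 u y)
    free-adj {u} (_ , _ , inj₂ y≁u) = +-mono-≤ (adj≤2 u x) (≤-reflexive (¬Adjacent⇒adj≡0 (y≁u ∘ swap)))

    nonadj≡1 : ∀ {s v} → ¬ Adjacent D s v → nonadj s v ≡ 1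
    nonadj≡1 {s} {v} h with D s v | D v s
    ... | true | _ = contradiction (inj₁ refl) h
    ... | false | true = contradiction (inj₂ refl) h
    ... | false | false = refl

    1≤∑ : ∀ (f : Fin n → ℕ) {v L} → v ∈ L → 1 ≤ f v → 1 ≤ ∑ f L
    1≤∑ f (here refl) p = ≤-trans p (m≤m+n _ _)
    1≤∑ f (there v∈) p = ≤-trans (1≤∑ f v∈ p) (m≤n+m _ _)

    module FreeDegrees (mp : MonoPath) where
      open MonoPath mp

      open Spanning perm using () renaming (covers to R-covers)

      n≡ : n ≡ 2 + length R
      n≡ = trans (sym (length-tabulate id)) (sym (↭-length perm))

      νx νy : ℕ
      νx = ∑ (nonadj x) R
      νy = ∑ (nonadj y) R

      deg-x : deg D x + νx ≤ length R + 1
      deg-x = ≤-trans (≤-reflexive (cong (_+ νx) (trans (deg-↭ x perm) (cong₂ (λ i j → i + (j + ∑ (adj x) R)) (adj-refl x) (¬Adjacent⇒adj≡0 x≁y))))) (mono-degree x R mono-x)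

      deg-y : deg D y + νy ≤ length R + 1
      deg-y = ≤-trans (≤-reflexive (cong (_+ νy) (trans (deg-↭ y perm) (cong₂ (λ i j → i + (j + ∑ (adj y) R)) (¬Adjacent⇒adj≡0 (x≁y ∘ swap)) (adj-refl y))))) (mono-degree y R mono-y)

      μ≤ : μ ≤ νx + νy
      μ≤ = begin
        μ                                   ≡⟨ ∑-↭ free perm ⟨
        free x + (free y + ∑ free R)        ≡⟨ cong₂ (λ i j → i + (j + ∑ free R)) (χ-no (free? x) (λ f → proj₁ f refl)) (χ-no (free? y) (λ f → proj₁ (proj₂ f) refl)) ⟩
        ∑ free R                            ≤⟨ ∑-≤ (all-∈ {L = R} λ {v} _ → χ-≤ (free? v) (free≤ v)) ⟩
        ∑ (λ v → nonadj x v + nonadj y v) R ≡⟨ ∑-+ (nonadj x) (nonadj y) R ⟩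
        νx + νy                             ∎
        where
        open ≤-Reasoning
        free≤ : ∀ v → Free v → 1 ≤ nonadj x v + nonadj y v
        free≤ v (_ , _ , inj₁ h) = ≤-trans (≤-reflexive (sym (nonadj≡1 h))) (m≤m+n _ _)
        free≤ v (_ , _ , inj₂ h) = ≤-trans (≤-reflexive (sym (nonadj≡1 h))) (m≤n+m _ _)

      -- Say `u` is not adjacent to `x`. Condition (M) for {x, y} and {x, u} contains `deg D x`
      -- twice, and `mono-degree` bounds the degrees of `x` and `y` by n - 1 - `νx` and n - 1 -
      -- `νy`. Here `νx + νy` is at least `μ`, and the second `νx`, at least 1 because of `u`, gives
      -- the final 1.
      free-degree : ∀ {u} → Free u → n + μ + 1 ≤ deg D u
      free-degree {u} (x≢u , y≢u , inj₁ x≁u) =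
        free-arith n (length R) (deg D x) (deg D y) (deg D u) νx νy μ n≡
          (subst (λ k → 4 * n ≤ k + 3) (sym (+-assoc (deg D x + deg D y) (deg D x) (deg D u)))
            (others x≢u x≁u λ { (inj₁ (_ , y≡u)) → y≢u y≡u ; (inj₂ (x≡u , _)) → x≢u x≡u }))
          deg-x deg-y μ≤ (1≤∑ (nonadj x) (R-covers x≢u y≢u) (≤-reflexive (sym (nonadj≡1 x≁u))))
      free-degree {u} (x≢u , y≢u , inj₂ y≁u) =
        free-arith n (length R) (deg D y) (deg D x) (deg D u) νy νx μ n≡
          (subst (λ k → 4 * n ≤ k + 3) (trans (cong (_+ (deg D y + deg D u)) (+-comm (deg D x) (deg D y))) (sym (+-assoc (deg D y + deg D x) (deg D y) (deg D u))))
            (others y≢u y≁u λ { (inj₁ (x≡y , _)) → x≢y x≡y ; (inj₂ (x≡u , _)) → x≢u x≡u }))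
          deg-y deg-x (≤-trans μ≤ (≤-reflexive (+-comm νx νy))) (1≤∑ (nonadj y) (R-covers x≢u y≢u) (≤-reflexive (sym (nonadj≡1 y≁u))))

      free-count : ∀ {T} L → L ++ T ↭ allFin n → All Free T → length T ≤ μ
      free-count {T} L p freeT = begin
        length T            ≡⟨ ∑-≡1 (All.map (λ {v} → χ-yes (free? v)) freeT) ⟨
        ∑ free T            ≤⟨ m≤n+m _ _ ⟩
        ∑ free L + ∑ free T ≡⟨ ∑-++ free L T ⟨
        ∑ free (L ++ T)     ≡⟨ ∑-↭ free p ⟩
        μ                   ∎
        where open ≤-Reasoning

      -- With t vertices left over, a stuck one has degree at most n + t - 2, where t ≤ `μ`;
      -- `free-degree` forbids this.
      extend-cycle : ∀ {v L F} → Links v L v → v ∷ L ++ F ↭ allFin n → All Free F → Hamiltonian D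
      extend-cycle {v} {L} {F} l perm freeF = by-insertion I.left refl
        where
        module I = MaxInsertion (maximal-insertion (λ _ → ⊤) v v F (λ _ _ _ _ _ → tt) L tt l)
        perm′ : v ∷ I.path ++ I.left ↭ allFin n
        perm′ = ↭-trans (prep v I.perm) perm
        freeT : All Free I.left
        freeT = All.map (All.lookup freeF) I.left⊆
        by-insertion : ∀ T → I.left ≡ T → Hamiltonian D
        by-insertion [] left≡ = hamiltonian I.links (subst (λ L → v ∷ L ↭ allFin n) (trans (cong (I.path ++_) left≡) (++-identityʳ I.path)) perm′)
        by-insertion (u ∷ T) left≡ = contradiction
          (cycle-arith n μ (length I.path) (length I.left) (arc u v) (arc v u) (∑ (adj u) I.path) (∑ (adj u) I.left)
            (trans (sym (length-tabulate id)) (trans (sym (↭-length perm′)) (cong suc (length-++ I.path))))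
            (≤-trans (free-degree (All.lookup freeT u∈)) (≤-reflexive (trans (deg-↭ u perm′) (cong (adj u v +_) (∑-++ (adj u) I.path I.left)))))
            (All.lookup I.tight u∈) (∑-adj-self u∈) (free-count (v ∷ I.path) perm′ freeT))
          λ ()
          where
          u∈ : u ∈ I.left
          u∈ = subst (u ∈_) (sym left≡) (here refl)

      -- The count for cycles, with at most two further arcs between a free vertex and the pair and
      -- with the two extra arcs at the ends: degree at most n + t - 1.
      extend-path : ∀ (P : List (Fin n) → Set) {a Q b F} → (∀ Q₁ u Q₂ → u ∈ F → P (Q₁ ++ Q₂) → P (Q₁ ++ u ∷ Q₂)) → P Q →
        Links a Q b → x ∷ y ∷ a ∷ b ∷ Q ++ F ↭ allFin n → All Free F →
        ∃ λ Q′ → Links a Q′ b × P Q′ × x ∷ y ∷ a ∷ b ∷ Q′ ↭ allFin n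
      extend-path P {a} {Q} {b} {F} ins pQ l perm freeF = by-insertion I.left refl
        where
        module I = MaxInsertion (maximal-insertion P a b F ins Q pQ l)
        perm′ : x ∷ y ∷ a ∷ b ∷ I.path ++ I.left ↭ allFin n
        perm′ = ↭-trans (++⁺ˡ (x ∷ y ∷ a ∷ b ∷ []) I.perm) perm
        freeT : All Free I.left
        freeT = All.map (All.lookup freeF) I.left⊆
        by-insertion : ∀ T → I.left ≡ T → ∃ λ Q′ → Links a Q′ b × P Q′ × x ∷ y ∷ a ∷ b ∷ Q′ ↭ allFin n
        by-insertion [] left≡ = I.path , I.links , I.preserved ,
          subst (λ L → x ∷ y ∷ a ∷ b ∷ L ↭ allFin n) (trans (cong (I.path ++_) left≡) (++-identityʳ I.path)) perm′
        by-insertion (u ∷ T) left≡ = contradiction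
          (extend-arith n μ (length I.path) (length I.left) (adj u x) (adj u y) (adj u a) (adj u b) (∑ (adj u) I.path) (∑ (adj u) I.left)
            (trans (sym (length-tabulate id)) (trans (sym (↭-length perm′)) (cong (4 +_) (length-++ I.path))))
            (≤-trans (free-degree (All.lookup freeT u∈)) (≤-reflexive (trans (deg-↭ u perm′) (cong (λ s → adj u x + (adj u y + (adj u a + (adj u b + s)))) (∑-++ (adj u) I.path I.left)))))
            (tight-degree u a I.path b (All.lookup I.tight u∈)) (∑-adj-self u∈) (free-count (x ∷ y ∷ a ∷ b ∷ I.path) perm′ freeT)
            (free-adj (All.lookup freeT u∈)))
          λ ()
          where
          u∈ : u ∈ I.left
          u∈ = subst (u ∈_) (sym left≡) (here refl)

      -- Otherwise every core vertex but `l` and `m` gives at most one arc, `l`, `m` and the other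
      -- free vertices at most two each, and `x` and `y` together at most two: the degree of `u`
      -- would be at most n + `μ`. `Dir` stands for either direction.
      core-neighbour : ∀ {u} (Dir : Fin n → Set) → Decidable Dir → (∀ {c} → ¬ Dir c → adj u c ≤ 1) → Free u →
        ∀ l m → ∃ λ c → Core c × c ≢ l × c ≢ m × Dir c
      core-neighbour {u} Dir dir? one-way fu@(x≢u , y≢u , _) l m
        with first-split (λ c → core? c ×-dec (¬? (c ≟ l) ×-dec (¬? (c ≟ m) ×-dec dir? c))) (allFin n)
      ... | inj₂ (_ , c , _ , _ , found , _) = c , found
      ... | inj₁ none with complement (allFin n) ((x≢y ∷ x≢u ∷ []) ∷ (y≢u ∷ []) ∷ [] ∷ []) (all-∈ λ {v} _ → ∈-allFin v)
      ... | E , perm = contradiction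
        (neighbour-arith n μ (length E) (adj u x) (adj u y) (∑ (adj u) E) (∑ free E) (∑ (ind 1 l) E) (∑ (ind 1 m) E)
          (trans (sym (length-tabulate id)) (↭-length perm))
          (≤-trans (free-degree fu) (≤-reflexive (trans (deg-↭ u (↭-sym perm)) (cong (λ k → adj u x + (adj u y + (k + ∑ (adj u) E))) (adj-refl u)))))
          (free-adj fu)
          bound
          (≤-trans (≤-trans (+-monoˡ-≤ (∑ free E) (≤-reflexive (sym (χ-yes (free? u) fu)))) (≤-trans (m≤n+m _ (free y)) (m≤n+m _ (free x)))) (≤-reflexive (sym (∑-↭ free perm))))
          (∑-ind≤ 1 l uniqueE) (∑-ind≤ 1 m uniqueE))
        λ ()
        where
        uniqueAll : Unique (x ∷ y ∷ u ∷ E)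
        uniqueAll = Unique-resp-↭ perm (allFin⁺ n)
        uniqueE : Unique E
        uniqueE = proj₁ (proj₂ (AllPairs-++⁻ (x ∷ y ∷ u ∷ []) uniqueAll))
        outside : ∀ {c} → c ∈ E → x ≢ c × y ≢ c
        outside c∈ with uniqueAll
        ... | (_ ∷ _ ∷ p) ∷ (_ ∷ q) ∷ _ = All.lookup p c∈ , All.lookup q c∈
        pointwise : ∀ {c} → c ∈ E → adj u c ≤ (1 + free c) + (ind 1 l c + ind 1 m c)
        pointwise {c} c∈ = by (free? c) (c ≟ l) (c ≟ m)
          where
          by : Dec (Free c) → Dec (c ≡ l) → Dec (c ≡ m) → adj u c ≤ (1 + free c) + (ind 1 l c + ind 1 m c)
          by (yes f) _ _ = ≤-trans (adj≤2 u c) (≤-trans (≤-reflexive (cong suc (sym (χ-yes (free? c) f)))) (m≤m+n _ _))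
          by (no _) (yes refl) _ = ≤-trans (adj≤2 u c) (+-mono-≤ (m≤m+n 1 (free c)) (≤-trans (≤-reflexive (sym (ind-refl 1 c))) (m≤m+n _ _)))
          by (no _) (no _) (yes refl) = ≤-trans (adj≤2 u c) (+-mono-≤ (m≤m+n 1 (free c)) (≤-trans (≤-reflexive (sym (ind-refl 1 c))) (m≤n+m _ _)))
          by (no ¬free) (no c≢l) (no c≢m) = ≤-trans (one-way λ dir → All.lookup none (∈-allFin c) (core , c≢l , c≢m , dir)) (≤-trans (m≤m+n 1 (free c)) (m≤m+n _ _))
            where
            core : Core c
            core with core? c
            ... | yes p = p
            ... | no ¬p = contradiction (core-or-free (proj₁ (outside c∈)) (proj₂ (outside c∈)) ¬p) ¬free
        bound : ∑ (adj u) E ≤ length E + ∑ free E + (∑ (ind 1 l) E + ∑ (ind 1 m) E)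
        bound = begin
          ∑ (adj u) E                                                              ≤⟨ ∑-≤ (all-∈ {L = E} pointwise) ⟩
          ∑ (λ c → (1 + free c) + (ind 1 l c + ind 1 m c)) E                       ≡⟨ ∑-+ (λ c → 1 + free c) (λ c → ind 1 l c + ind 1 m c) E ⟩
          ∑ (λ c → 1 + free c) E + ∑ (λ c → ind 1 l c + ind 1 m c) E               ≡⟨ cong₂ _+_ (∑-+ (λ _ → 1) free E) (∑-+ (ind 1 l) (ind 1 m) E) ⟩
          ∑ (λ _ → 1) E + ∑ free E + (∑ (ind 1 l) E + ∑ (ind 1 m) E)               ≡⟨ cong (λ k → k + ∑ free E + (∑ (ind 1 l) E + ∑ (ind 1 m) E)) (∑-≡1 (all-∈ {L = E} λ _ → refl)) ⟩
          length E + ∑ free E + (∑ (ind 1 l) E + ∑ (ind 1 m) E)                    ∎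
          where open ≤-Reasoning

      core-out-neighbour : ∀ {u} → Free u → ∀ l m → ∃ λ c → Core c × c ≢ l × c ≢ m × Arc D u c
      core-out-neighbour {u} = core-neighbour (Arc D u) (arc? u)
        (λ {c} ¬u→c → +-mono-≤ (≤-reflexive (¬Arc⇒arc≡0 ¬u→c)) (arc≤1 c u))

      core-in-neighbour : ∀ {u} → Free u → ∀ l m → ∃ λ c → Core c × c ≢ l × c ≢ m × Arc D c u
      core-in-neighbour {u} = core-neighbour (λ c → Arc D c u) (λ c → arc? c u)
        (λ {c} ¬c→u → ≤-trans (+-mono-≤ (arc≤1 u c) (≤-reflexive (¬Arc⇒arc≡0 ¬c→u))) (≤-reflexive refl))

      Pr : Fin n → Fin n → Set
      Pr = Pair x y

      pair-≢ : ∀ {s t} → Pr s t → s ≢ t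
      pair-≢ xy = x≢y
      pair-≢ yx = x≢y ∘ sym

      pair-no-arc : ∀ {s t q r} → Pr s t → Pr q r → ¬ Arc D s q
      pair-no-arc xy xy a = Arc⇒≢ a refl
      pair-no-arc xy yx a = x≁y (inj₁ a)
      pair-no-arc yx xy a = x≁y (inj₂ a)
      pair-no-arc yx yx a = Arc⇒≢ a refl

      pair-free : ∀ {s t v} → Pr s t → x ≢ v → y ≢ v → ¬ Adjacent D s v → Free v
      pair-free xy x≢v y≢v h = x≢v , y≢v , inj₁ h
      pair-free yx x≢v y≢v h = x≢v , y≢v , inj₂ h

      module Full {L} (permL : x ∷ y ∷ L ↭ allFin n) where
        open Spanning permL public

        nbr : ∀ {s t v} → Pr s t → Adjacent D s v → v ∈ L
        nbr xy = x-nbr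
        nbr yx = y-nbr

        locate : ∀ v → v ∈ L ⊎ ∃ (Pr v)
        locate v with x ≟ v | y ≟ v
        ... | yes refl | _ = inj₂ (y , xy)
        ... | no _ | yes refl = inj₂ (x , yx)
        ... | no x≢v | no y≢v = inj₁ (covers x≢v y≢v)

        not-pair : ∀ {v} → v ∈ L → ∀ {t} → ¬ Pr v t
        not-pair v∈ xy = All.lookup x∉ v∈ refl
        not-pair v∈ yx = All.lookup y∉ v∈ refl

        nonadj-free : ∀ {s t v} → Pr s t → v ∈ L → ¬ Adjacent D s v → Free v
        nonadj-free p v∈ = pair-free p (All.lookup x∉ v∈) (All.lookup y∉ v∈)

        noncore-free : ∀ {v} → v ∈ L → ¬ Core v → Free v
        noncore-free v∈ = core-or-free (All.lookup x∉ v∈) (All.lookup y∉ v∈)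

        disjoint : ∀ {A B u v} → L ≡ A ++ B → u ∈ A → v ∈ B → u ≢ v
        disjoint {A} refl u∈ v∈ = All.lookup (All.lookup (proj₂ (proj₂ (AllPairs-++⁻ A uniqueR))) u∈) v∈

      open Full perm using (nbr; nonadj-free; noncore-free)

      mono : ∀ {s t} → Pr s t → Mono s R
      mono xy = mono-x
      mono yx = mono-y

      -- A vertex leading from `t` to `s`

      -- The cycle t → Pre e C₁ → s → Pre₂ w C₂ → t, up to dropping free vertices of Pre₂.
      close-fork : ∀ {s t e w Pre C₁ Pre₂ C₂ F} → Links t Pre e → Links e C₁ s → Arc D s w → Links e (Pre₂ ++ w ∷ C₂) t →
        All (λ c → Arc D s c ⊎ Free c) Pre₂ → s ∷ t ∷ Pre ++ e ∷ Pre₂ ++ w ∷ C₂ ++ C₁ ++ F ↭ allFin n → All Free F → Hamiltonian D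
      close-fork {s} {t} {e} {w} {Pre} {C₁} {Pre₂} {C₂} {F} l₀ l₁ s→w l₂ good permF freeF with trim-front Pre₂ good s→w l₂
      ... | S₀ , S′ , refl , freeS₀ , l₂′ =
        extend-cycle {t} {Pre ++ e ∷ C₁ ++ s ∷ S′ ++ w ∷ C₂} {S₀ ++ F} (Links-++ Pre l₀ (Links-++ C₁ l₁ l₂′))
          (↭-trans (↭-solve 10 (λ s t p e c₁ s₀ s′ w c₂ f → t ⊕ ((p ⊕ (e ⊕ (c₁ ⊕ (s ⊕ (s′ ⊕ (w ⊕ c₂)))))) ⊕ (s₀ ⊕ f)) ⊜ s ⊕ (t ⊕ (p ⊕ (e ⊕ ((s₀ ⊕ s′) ⊕ (w ⊕ (c₂ ⊕ (c₁ ⊕ f)))))))) ↭-refl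
            [ s ] [ t ] Pre [ e ] C₁ S₀ S′ [ w ] C₂ F) permF)
          (All.++⁺ freeS₀ freeF)

      module Mixed {s t} (p : Pr s t) {v} (t→v : Arc D t v) (v→s : Arc D v s) where

        -- By monotonicity, `t → v` forbids arcs to `t` from before `v`, and `v → s` forbids arcs
        -- from `s` to after `v`. The free vertices absorbed into the path must not destroy this, so
        -- it is carried as an invariant.
        SplitAt : List (Fin n) → Set
        SplitAt Q = ∃₂ λ A B → Q ≡ A ++ v ∷ B × All (λ c → ¬ Arc D c t) A × All (λ c → ¬ Arc D s c) B

        insert-split : ∀ Q₁ u Q₂ → ¬ Arc D u t → ¬ Arc D s u → SplitAt (Q₁ ++ Q₂) → SplitAt (Q₁ ++ u ∷ Q₂)
        insert-split Q₁ u Q₂ ¬u→t ¬s→u (A , B , eq , hA , hB) with ++-split Q₁ A eq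
        ... | inj₁ (X , refl , refl) = Q₁ ++ u ∷ X , B , sym (++-assoc Q₁ (u ∷ X) (v ∷ B)) ,
          All-middle⁺ (proj₁ (All.++⁻ Q₁ hA)) ¬u→t (proj₂ (All.++⁻ Q₁ hA)) , hB
        ... | inj₂ (Y , refl , refl) = A , Y ++ u ∷ Q₂ , ++-assoc A (v ∷ Y) (u ∷ Q₂) ,
          hA , All-middle⁺ (proj₁ (All.++⁻ Y hB)) ¬s→u (proj₂ (All.++⁻ Y hB))

        -- With an arc `i → k` over `v`, the cycle is `s → A₁ → i → k → B₂ → t → A₂ → v → B₁ →
        -- s`, where free vertices at the start of `A₂` and at the end of `B₁` may be dropped.
        module Jump {a b A B} (s→a : Arc D s a) (b→t : Arc D b t) (l : Links a (A ++ v ∷ B) b)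
          (perm′ : x ∷ y ∷ (a ∷ A) ++ v ∷ (B ++ [ b ]) ↭ allFin n)
          (hA : All (λ c → ¬ Arc D c t) (a ∷ A)) (hB : All (λ c → ¬ Arc D s c) (B ++ [ b ])) where
          open Full perm′ using (locate; disjoint; not-pair) renaming (nonadj-free to free′)

          Left : Fin n → Set
          Left u = u ∈ a ∷ A ⊎ u ≡ s

          -- In `D` minus `v`, the vertices before `v` together with `s` can be left only by an arc
          -- over `v`: none of them has an arc to `t`, and `s` has none to the vertices after `v`.
          crossing-arc : ∃₂ λ i k → i ∈ a ∷ A × k ∈ B ++ [ b ] × Arc D i k
          crossing-arc = crossing Left v (disjoint refl (here refl) (here refl))
            (λ b≡v → disjoint (sym (++-assoc (a ∷ A) [ v ] (B ++ [ b ]))) (∈-++⁺ʳ (a ∷ A) (here refl)) (∈-++⁺ʳ B (here refl)) (sym b≡v))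
            (inj₁ (here refl)) ¬Left-b closed
            where
            ¬Left-b : ¬ Left b
            ¬Left-b (inj₁ b∈) = disjoint refl b∈ (there (∈-++⁺ʳ B (here refl))) refl
            ¬Left-b (inj₂ refl) = not-pair (∈-++⁺ʳ (a ∷ A) (there (∈-++⁺ʳ B (here refl)))) p
            closed : ∀ {i q} → Left i → Arc D i q → q ≢ v → (∃₂ λ i k → i ∈ a ∷ A × k ∈ B ++ [ b ] × Arc D i k) ⊎ Left q
            closed {i} {q} Li i→q q≢v with locate q
            closed (inj₂ refl) i→q q≢v | inj₂ (_ , p′) = contradiction i→q (pair-no-arc p p′)
            closed {i} {q} (inj₁ i∈) i→q q≢v | inj₂ (_ , p′) with q ≟ s
            ... | yes q≡s = inj₂ (inj₂ q≡s)
            ... | no q≢s = contradiction (subst (Arc D i) (only p p′ q≢s) i→q) (All.lookup hA i∈)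
              where
              only : ∀ {s t q r} → Pr s t → Pr q r → q ≢ s → q ≡ t
              only xy xy h = contradiction refl h
              only xy yx h = refl
              only yx xy h = refl
              only yx yx h = contradiction refl h
            closed Li i→q q≢v | inj₁ q∈ with ∈-++⁻ (a ∷ A) q∈
            ... | inj₁ q∈A = inj₂ (inj₁ q∈A)
            ... | inj₂ (here q≡v) = contradiction q≡v q≢v
            closed (inj₁ i∈) i→q q≢v | inj₁ q∈ | inj₂ (there q∈B) = inj₁ (_ , _ , i∈ , q∈B , i→q)
            closed (inj₂ refl) i→q q≢v | inj₁ q∈ | inj₂ (there q∈B) = contradiction i→q (All.lookup hB q∈B)

          conclude : Hamiltonian D
          conclude with crossing-arc
          ... | i , k , i∈ , k∈ , i→k with ∈-∃++ i∈ | ∈-∃++ k∈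
          ... | A₁ , A₂ , A≡ | B₁ , B₂ , B≡
            with Links-++⁻ A₁ (subst (λ L → Links s L v) A≡ (s→a , proj₁ (Links-++⁻ A l)))
               | Links-++⁻ B₁ (subst (λ L → Links v L t) B≡ (Links-++ B (proj₂ (Links-++⁻ A l)) b→t))
          ... | lA₁ , lA₂ | lB₁ , lB₂ with trim-back {P = Free} {s = s} B₁ (all-∈ to-s) v→s lB₁
            where
            to-s : ∀ {c} → c ∈ B₁ → Arc D c s ⊎ Free c
            to-s {c} c∈ with arc? c s
            ... | yes c→s = inj₁ c→s
            ... | no ¬c→s = inj₂ (free′ p (∈-++⁺ʳ (a ∷ A) (there c∈B)) λ { (inj₁ s→c) → All.lookup hB c∈B s→c ; (inj₂ c→s) → ¬c→s c→s })
              where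
              c∈B : c ∈ B ++ [ b ]
              c∈B = subst (c ∈_) (sym B≡) (∈-++⁺ˡ c∈)
          ... | B₁′ , B₀ , refl , freeB₀ , lB₁′ =
            close-fork {s = t} {t = s} {e = i} {w = v} {Pre = A₁} {C₁ = k ∷ B₂} {Pre₂ = A₂} {C₂ = B₁′} {F = B₀}
              lA₁ (i→k , lB₂) t→v (Links-++ A₂ lA₂ lB₁′) (all-∈ from-t)
              (↭-trans (↭-solve 9 (λ s t p i q v b b₀ k → t ⊕ (s ⊕ (p ⊕ (i ⊕ (q ⊕ (v ⊕ (b ⊕ (k ⊕ b₀))))))) ⊜ s ⊕ (t ⊕ ((p ⊕ (i ⊕ q)) ⊕ (v ⊕ ((b ⊕ b₀) ⊕ k))))) ↭-refl
                 [ s ] [ t ] A₁ [ i ] A₂ [ v ] B₁′ B₀ (k ∷ B₂))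
                (↭-trans (↭-reflexive (cong₂ (λ A B → s ∷ t ∷ A ++ v ∷ B) (sym A≡) (sym B≡))) (↭-trans (pair-↭ p) perm′)))
              freeB₀
            where
            from-t : ∀ {c} → c ∈ A₂ → Arc D t c ⊎ Free c
            from-t {c} c∈ with arc? t c
            ... | yes t→c = inj₁ t→c
            ... | no ¬t→c = inj₂ (free′ (flip-pair p) (∈-++⁺ˡ c∈A) λ { (inj₁ t→c) → ¬t→c t→c ; (inj₂ c→t) → All.lookup hA c∈A c→t })
              where
              c∈A : c ∈ a ∷ A
              c∈A = subst (c ∈_) (sym A≡) (∈-++⁺ʳ A₁ (there c∈))

        result : Hamiltonian D
        result with ∈-∃++ (nbr p (inj₂ v→s))
        ... | A , B , R≡ = at-v
          where
          monoS : Mono s (A ++ v ∷ B)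
          monoS = subst (Mono s) R≡ (mono p)
          monoT : Mono t (A ++ v ∷ B)
          monoT = subst (Mono t) R≡ (mono (flip-pair p))
          no-out-B : ∀ {c} → c ∈ B → ¬ Arc D s c
          no-out-B c∈ s→c = All.lookup (proj₂ (AllPairs-middle⁻ A monoS)) c∈ (v→s , s→c)
          no-in-A : ∀ {c} → c ∈ A → ¬ Arc D c t
          no-in-A c∈ c→t = All.lookup (proj₁ (AllPairs-middle⁻ A monoT)) c∈ (c→t , t→v)
          A⊆R : ∀ {c} → c ∈ A → c ∈ R
          A⊆R c∈ = subst (_ ∈_) (sym R≡) (∈-++⁺ˡ c∈)
          B⊆R : ∀ {c} → c ∈ B → c ∈ R
          B⊆R c∈ = subst (_ ∈_) (sym R≡) (∈-++⁺ʳ A (there c∈))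
          first-out : ∃ λ M → ∃ λ a → ∃ λ N → A ≡ M ++ a ∷ N × Arc D s a × All (λ c → ¬ Arc D s c) M
          first-out with out-neighbour s v (Arc⇒≢ v→s ∘ sym)
          ... | o , s→o , o≢v with ∈-++⁻ A (subst (o ∈_) R≡ (nbr p (inj₁ s→o)))
          ... | inj₁ o∈A = first-split-∈ (arc? s) o∈A s→o
          ... | inj₂ (here o≡v) = contradiction o≡v o≢v
          ... | inj₂ (there o∈B) = contradiction s→o (no-out-B o∈B)
          last-in : ∃ λ M → ∃ λ b → ∃ λ N → B ≡ M ++ b ∷ N × Arc D b t × All (λ c → ¬ Arc D c t) N
          last-in with in-neighbour t v (Arc⇒≢ t→v)
          ... | o , o→t , o≢v with ∈-++⁻ A (subst (o ∈_) R≡ (nbr (flip-pair p) (inj₂ o→t)))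
          ... | inj₁ o∈A = contradiction o→t (no-in-A o∈A)
          ... | inj₂ (here o≡v) = contradiction o≡v o≢v
          ... | inj₂ (there o∈B) = last-split-∈ (λ c → arc? c t) o∈B o→t
          at-v : Hamiltonian D
          -- The vertices before `a` are non-adjacent to `s` and those after `b` to `t`; being free,
          -- they are absorbed between `a` and `b`.
          at-v with first-out | last-in
          ... | A₀ , a , A₁ , refl , s→a , A₀-out | B₁ , b , B₂ , refl , b→t , B₂-in
            with extend-path SplitAt {a} {A₁ ++ v ∷ B₁} {b} {A₀ ++ B₂}
              (λ Q₁ u Q₂ u∈ → insert-split Q₁ u Q₂ (proj₁ (neutral u∈)) (proj₂ (neutral u∈)))
              (A₁ , B₁ , refl , all-∈ (λ c∈ → no-in-A (∈-++⁺ʳ A₀ (there c∈))) , all-∈ (λ c∈ → no-out-B (∈-++⁺ˡ c∈)))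
              (Links-++ A₁ (proj₂ (Links-++⁻ A₀ (proj₁ linksAB))) (proj₁ (Links-++⁻ B₁ (proj₂ linksAB))))
              (↭-trans (↭-solve 9 (λ x y a b a₀ a₁ v b₁ b₂ → x ⊕ (y ⊕ (a ⊕ (b ⊕ ((a₁ ⊕ (v ⊕ b₁)) ⊕ (a₀ ⊕ b₂))))) ⊜ x ⊕ (y ⊕ ((a₀ ⊕ (a ⊕ a₁)) ⊕ (v ⊕ (b₁ ⊕ (b ⊕ b₂)))))) ↭-refl
                 [ x ] [ y ] [ a ] [ b ] A₀ A₁ [ v ] B₁ B₂) (↭-trans (↭-reflexive (cong (λ L → x ∷ y ∷ L) (sym R≡))) perm))
              (All.++⁺ freeA₀ freeB₂)
            where
            linksAB : Links x (A₀ ++ a ∷ A₁) v × Links v (B₁ ++ b ∷ B₂) x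
            linksAB = Links-++⁻ (A₀ ++ a ∷ A₁) (subst (λ L → Links x L x) R≡ links)
            neutral : ∀ {u} → u ∈ A₀ ++ B₂ → ¬ Arc D u t × ¬ Arc D s u
            neutral u∈ with ∈-++⁻ A₀ u∈
            ... | inj₁ u∈A₀ = no-in-A (∈-++⁺ˡ u∈A₀) , All.lookup A₀-out u∈A₀
            ... | inj₂ u∈B₂ = All.lookup B₂-in u∈B₂ , no-out-B (∈-++⁺ʳ B₁ (there u∈B₂))
            freeA₀ : All Free A₀
            freeA₀ = all-∈ λ c∈ → nonadj-free p (A⊆R (∈-++⁺ˡ c∈)) λ
              { (inj₁ s→c) → All.lookup A₀-out c∈ s→c
              ; (inj₂ c→s) → All.lookup (proj₁ (AllPairs-middle⁻ A₀ (proj₁ (AllPairs-++⁻ (A₀ ++ a ∷ A₁) monoS)))) c∈ (c→s , s→a) }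
            freeB₂ : All Free B₂
            freeB₂ = all-∈ λ c∈ → nonadj-free (flip-pair p) (B⊆R (∈-++⁺ʳ B₁ (there c∈))) λ
              { (inj₁ t→c) → All.lookup (proj₂ (AllPairs-middle⁻ (v ∷ B₁) (proj₁ (proj₂ (AllPairs-++⁻ (A₀ ++ a ∷ A₁) monoT))))) c∈ (b→t , t→c)
              ; (inj₂ c→t) → All.lookup B₂-in c∈ c→t }
          ... | _ , l , (A′ , B′ , refl , hA , hB) , perm′ = Jump.conclude s→a b→t l
            (↭-trans (↭-solve 7 (λ x y a b a′ v b′ → x ⊕ (y ⊕ ((a ⊕ a′) ⊕ (v ⊕ (b′ ⊕ b)))) ⊜ x ⊕ (y ⊕ (a ⊕ (b ⊕ (a′ ⊕ (v ⊕ b′)))))) ↭-refl [ x ] [ y ] [ a ] [ b ] A′ [ v ] B′) perm′)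
            (no-in-A (∈-++⁺ʳ A₀ (here refl)) ∷ hA) (All.++⁺ hB (no-out-B (∈-insert B₁) ∷ []))

      -- Common neighbours, arcs over a vertex and interlaced paths

      LL RR : Fin n → Set
      LL v = Arc D x v × Arc D y v
      RR v = Arc D v x × Arc D v y

      LL? : ∀ v → Dec (LL v)
      LL? v = arc? x v ×-dec arc? y v

      RR? : ∀ v → Dec (RR v)
      RR? v = arc? v x ×-dec arc? v y

      LL-arc : ∀ {s t v} → Pr s t → LL v → Arc D s v
      LL-arc xy = proj₁
      LL-arc yx = proj₂

      RR-arc : ∀ {s t v} → Pr s t → RR v → Arc D v s
      RR-arc xy = proj₁
      RR-arc yx = proj₂

      FirstArc : List (Fin n) → List (Fin n) → Set
      FirstArc A B = ∃ λ A₁ → ∃ λ i → ∃ λ A₂ → ∃ λ k → A ≡ A₁ ++ i ∷ A₂ × k ∈ B × Arc D i k × All (λ c → ∀ k → k ∈ B → ¬ Arc D c k) A₁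

      -- A walk from `A` to `B` cannot get past `v` through `x` or `y`: either of them, when entered
      -- from `A`, has by monotonicity no arc into `B`. The tail is chosen earliest so that the next
      -- arc, starting before it, cannot land far ahead.
      first-arc : ∀ {A v B} (permL : x ∷ y ∷ A ++ v ∷ B ↭ allFin n) → (∀ {s t} → Pr s t → Mono s (A ++ v ∷ B)) →
        ∀ {a b} → a ∈ A → b ∈ B → FirstArc A B
      first-arc {A} {v} {B} permL monoL {a} {b} a∈ b∈ with crossing Left v (disjoint refl a∈ (here refl))
        (λ b≡v → disjoint (sym (++-assoc A [ v ] B)) (∈-++⁺ʳ A (here refl)) b∈ (sym b≡v)) (inj₁ a∈) ¬Left-b closed
        where
        open Full permL
        Left : Fin n → Set
        Left u = u ∈ A ⊎ ((∃ (Pr u)) × All (λ c → ¬ Arc D u c) B)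
        ¬Left-b : ¬ Left b
        ¬Left-b (inj₁ b∈A) = disjoint refl b∈A (there b∈) refl
        ¬Left-b (inj₂ ((_ , p) , _)) = not-pair (∈-++⁺ʳ A (there b∈)) p
        closed : ∀ {i q} → Left i → Arc D i q → q ≢ v → (∃₂ λ i k → i ∈ A × k ∈ B × Arc D i k) ⊎ Left q
        closed {i} {q} Li i→q q≢v with locate q
        closed (inj₂ ((_ , p) , _)) i→q q≢v | inj₂ (_ , p′) = contradiction i→q (pair-no-arc p p′)
        closed {i} {q} (inj₁ i∈) i→q q≢v | inj₂ (t , p′) with first-split (arc? q) B
        ... | inj₁ none = inj₂ (inj₂ ((t , p′) , none))
        ... | inj₂ (B₁ , c , B₂ , refl , q→c , _) = contradiction (i→q , q→c)
          (All.lookup (All.lookup (proj₂ (proj₂ (AllPairs-++⁻ A (monoL p′)))) i∈) (there (∈-insert B₁)))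
        closed Li i→q q≢v | inj₁ q∈ with ∈-++⁻ A q∈
        ... | inj₁ q∈A = inj₂ (inj₁ q∈A)
        ... | inj₂ (here q≡v) = contradiction q≡v q≢v
        closed (inj₁ i∈) i→q q≢v | inj₁ q∈ | inj₂ (there q∈B) = inj₁ (_ , _ , i∈ , q∈B , i→q)
        closed (inj₂ (_ , none)) i→q q≢v | inj₁ q∈ | inj₂ (there q∈B) = contradiction i→q (All.lookup none q∈B)
      ... | i , k , i∈ , k∈ , i→k with first-split-∈ (λ c → any? (arc? c) B) i∈ (lose k∈ i→k)
      ... | A₁ , i′ , A₂ , A≡ , hits , none with find hits
      ... | k′ , k′∈ , i′→k′ = A₁ , i′ , A₂ , k′ , A≡ , k′∈ , i′→k′ , All.map (λ h k k∈ c→k → h (lose k∈ c→k)) none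

      -- Two interlaced paths are grown backwards from w′: at each stage they continue from a common vertex i, one by C₁
      -- and the other along the path R up to g and then by C₂; the first arc over i moves the fork towards P until it lies in P.
      module Interlace {P w Z w′ B} (permL : x ∷ y ∷ (P ++ w ∷ Z) ++ w′ ∷ B ↭ allFin n)
        (monoL : ∀ {s t} → Pr s t → Mono s ((P ++ w ∷ Z) ++ w′ ∷ B))
        (fromP : ∀ {s t} → Pr s t → Links s P w) (mid : Links w Z w′) (toB : ∀ {s t} → Pr s t → Links w′ B s)
        (w-LL : LL w) (w′-RR : RR w′) (freeZ : All Free Z) {l r} (l∈P : l ∈ P) (r∈B : r ∈ B) where
        open Full permL using () renaming (nonadj-free to free′)

        full : List (Fin n)
        full = (P ++ w ∷ Z) ++ w′ ∷ B

        P-good : ∀ {s t c} → Pr s t → c ∈ P → Arc D s c ⊎ Free c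
        P-good {s} {t} {c} p c∈ with arc? s c
        ... | yes s→c = inj₁ s→c
        ... | no ¬s→c = inj₂ (free′ p (∈-++⁺ˡ (∈-++⁺ˡ c∈)) λ
          { (inj₁ s→c) → ¬s→c s→c
          ; (inj₂ c→s) → All.lookup (proj₁ (AllPairs-middle⁻ P (proj₁ (AllPairs-++⁻ (P ++ w ∷ Z) (monoL p))))) c∈ (c→s , LL-arc p w-LL) })

        B-good : ∀ {s t c} → Pr s t → c ∈ B → Arc D c s ⊎ Free c
        B-good {s} {t} {c} p c∈ with arc? c s
        ... | yes c→s = inj₁ c→s
        ... | no ¬c→s = inj₂ (free′ p (∈-++⁺ʳ (P ++ w ∷ Z) (there c∈)) λ
          { (inj₁ s→c) → All.lookup (proj₂ (AllPairs-middle⁻ (P ++ w ∷ Z) (monoL p))) c∈ (RR-arc p w′-RR , s→c)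
          ; (inj₂ c→s) → ¬c→s c→s })

        -- The stretch from `w` to `g` with free vertices strictly between; in the first case it is
        -- the single vertex `w`.
        Head : List (Fin n) → Fin n → Set
        Head Zₚ g = (Zₚ ≡ [] × g ≡ w) ⊎ (∃ λ Z′ → Zₚ ≡ w ∷ Z′ × All Free Z′)

        head-tail : ∀ {Zₚ g} C → Head Zₚ g → ∃ λ C′ → Zₚ ++ g ∷ C ≡ w ∷ C′
        head-tail C (inj₁ (refl , refl)) = C , refl
        head-tail C (inj₂ (Z′ , refl , _)) = Z′ ++ _ ∷ C , refl

        head-split : ∀ X {i A g} → Head (X ++ i ∷ A) g → Head X i × All Free A
        head-split [] (inj₂ (Z′ , refl , f)) = inj₁ (refl , refl) , f
        head-split (_ ∷ X) (inj₂ (_ , refl , f)) = inj₂ (X , refl , proj₁ (All-middle⁻ X f)) , proj₂ (proj₂ (All-middle⁻ X f))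
        head-split [] (inj₁ (() , _))
        head-split (_ ∷ _) (inj₁ (() , _))

        land : ∀ {i s k} A g C → Links i (A ++ g ∷ C) s → All Free A → k ∈ A ⊎ k ≡ g →
          ∃₂ λ X K → A ++ g ∷ C ≡ X ++ k ∷ K × All Free X × Links k K s
        land A g C l freeA (inj₂ refl) = A , C , refl , freeA , proj₂ (Links-++⁻ A l)
        land A g C l freeA (inj₁ k∈) with ∈-∃++ k∈
        ... | X , Y , refl = X , Y ++ g ∷ C , ++-assoc X (_ ∷ Y) (g ∷ C) , proj₁ (All.++⁻ X freeA) ,
          proj₂ (Links-++⁻ X (subst (λ L → Links _ L _) (++-assoc X (_ ∷ Y) (g ∷ C)) l))

        -- `t` follows `P` up to `i` and then `C₁` to `s`; `s` follows the remainder of `P` through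
        -- `w` to `g` and then `C₂` to `t`. Since `P` precedes `w`, an out-neighbour of `s`, the
        -- vertices skipped when `s` enters that remainder are free.
        close-in-P : ∀ Zₚ {g Rest C₁ C₂ F s t A i Y} → Head Zₚ g → full ≡ (P ++ Zₚ) ++ g ∷ Rest → Links x (P ++ Zₚ) g →
          Pr s t → P ≡ A ++ i ∷ Y → Links i C₁ s → Links g C₂ t → C₁ ++ C₂ ++ F ↭ Rest → All Free F → Hamiltonian D
        close-in-P Zₚ {g} {Rest} {C₁} {C₂} {F} {s} {t} {A} {i} {Y} hd full≡ upto p refl l₁ l₂ permC freeF =
          close-fork {s = s} {t = t} {e = i} {w = w} {Pre = A} {C₁ = C₁} {Pre₂ = Y} {C₂ = C₂′} {F = F}
            (proj₁ (Links-++⁻ A (fromP (flip-pair p)))) l₁ (LL-arc p w-LL) links₂ (all-∈ λ c∈ → P-good p (∈-++⁺ʳ A (there c∈))) permutation freeF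
          where
          C₂′ : List (Fin n)
          C₂′ = proj₁ (head-tail C₂ hd)
          tail≡ : Zₚ ++ g ∷ C₂ ≡ w ∷ C₂′
          tail≡ = proj₂ (head-tail C₂ hd)
          links₂ : Links i (Y ++ w ∷ C₂′) t
          links₂ = subst (λ L → Links i L t) (trans (++-assoc Y Zₚ (g ∷ C₂)) (cong (Y ++_) tail≡))
            (Links-++ (Y ++ Zₚ) (proj₂ (Links-++⁻ A (subst (λ L → Links x L g) (++-assoc A (i ∷ Y) Zₚ) upto))) l₂)
          reorder : s ∷ t ∷ A ++ i ∷ Y ++ (Zₚ ++ g ∷ C₂) ++ C₁ ++ F ↭ s ∷ t ∷ ((A ++ i ∷ Y) ++ Zₚ) ++ g ∷ C₁ ++ C₂ ++ F
          reorder = ↭-solve 10 (λ s t a i y z g c₂ c₁ f → s ⊕ (t ⊕ (a ⊕ (i ⊕ (y ⊕ ((z ⊕ (g ⊕ c₂)) ⊕ (c₁ ⊕ f)))))) ⊜ s ⊕ (t ⊕ (((a ⊕ (i ⊕ y)) ⊕ z) ⊕ (g ⊕ (c₁ ⊕ (c₂ ⊕ f)))))) ↭-refl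
            [ s ] [ t ] A [ i ] Y Zₚ [ g ] C₂ C₁ F
          permutation : s ∷ t ∷ A ++ i ∷ Y ++ w ∷ C₂′ ++ C₁ ++ F ↭ allFin n
          permutation = begin
            s ∷ t ∷ A ++ i ∷ Y ++ w ∷ C₂′ ++ C₁ ++ F             ≡⟨ cong (λ L → s ∷ t ∷ A ++ i ∷ Y ++ L ++ C₁ ++ F) tail≡ ⟨
            s ∷ t ∷ A ++ i ∷ Y ++ (Zₚ ++ g ∷ C₂) ++ C₁ ++ F      ↭⟨ reorder ⟩
            s ∷ t ∷ ((A ++ i ∷ Y) ++ Zₚ) ++ g ∷ C₁ ++ C₂ ++ F    ↭⟨ prep s (prep t (++⁺ˡ ((A ++ i ∷ Y) ++ Zₚ) (prep g permC))) ⟩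
            s ∷ t ∷ ((A ++ i ∷ Y) ++ Zₚ) ++ g ∷ Rest             ≡⟨ cong (λ L → s ∷ t ∷ L) full≡ ⟨
            s ∷ t ∷ full                                         ↭⟨ pair-↭ p ⟩
            x ∷ y ∷ full                                         ↭⟨ permL ⟩
            allFin n                                             ∎
            where open PermutationReasoning

        regroup : ∀ X {i A g Rest} → full ≡ (P ++ X ++ i ∷ A) ++ g ∷ Rest → full ≡ (P ++ X) ++ i ∷ A ++ g ∷ Rest
        regroup X {i} {A} {g} {Rest} full≡ = trans full≡ (trans (cong (_++ g ∷ Rest) (sym (++-assoc P X (i ∷ A)))) (++-assoc (P ++ X) (i ∷ A) (g ∷ Rest)))

        arc-over : ∀ {A i B} → full ≡ (P ++ A) ++ i ∷ B → ∀ {b} → b ∈ B → FirstArc (P ++ A) B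
        arc-over full≡ = first-arc (subst (λ L → x ∷ y ∷ L ↭ allFin n) full≡ permL) (λ q → subst (Mono _) full≡ (monoL q)) (∈-++⁺ˡ l∈P)

        exchange : ∀ X k K A g {C₁ C₂ F Rest : List (Fin n)} → A ++ g ∷ C₂ ≡ X ++ k ∷ K → C₁ ++ C₂ ++ F ↭ Rest → (k ∷ K) ++ C₁ ++ X ++ F ↭ A ++ g ∷ Rest
        exchange X k K A g {C₁} {C₂} {F} {Rest} land≡ permC = begin
          (k ∷ K) ++ C₁ ++ X ++ F       ↭⟨ ↭-solve 4 (λ k c x f → k ⊕ (c ⊕ (x ⊕ f)) ⊜ (x ⊕ k) ⊕ (c ⊕ f)) ↭-refl (k ∷ K) C₁ X F ⟩
          (X ++ k ∷ K) ++ C₁ ++ F       ≡⟨ cong (_++ C₁ ++ F) land≡ ⟨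
          (A ++ g ∷ C₂) ++ C₁ ++ F      ↭⟨ ↭-solve 5 (λ a g c₂ c₁ f → (a ⊕ (g ⊕ c₂)) ⊕ (c₁ ⊕ f) ⊜ a ⊕ (g ⊕ (c₁ ⊕ (c₂ ⊕ f)))) ↭-refl A [ g ] C₂ C₁ F ⟩
          A ++ g ∷ C₁ ++ C₂ ++ F        ↭⟨ ++⁺ˡ A (prep g permC) ⟩
          A ++ g ∷ Rest                 ∎
          where open PermutationReasoning

        -- `C₁`, `C₂` and the free vertices `F` partition `Rest`, into which nothing before `i` has
        -- an arc. Hence the first arc `i′ → k` over `i` lands after `i` and not beyond `g`, and the
        -- vertices skipped between `i` and `k` are free. The old `C₁` becomes the new `C₂`, and `s`
        -- and `t` change roles.
        unfork : ∀ m Zₚ {g Rest C₁ C₂ F s t A₁ i A₂} → length Zₚ ≤ m → Head Zₚ g → full ≡ (P ++ Zₚ) ++ g ∷ Rest → Links x (P ++ Zₚ) g →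
          Pr s t → P ++ Zₚ ≡ A₁ ++ i ∷ A₂ → All (λ c → ∀ k → k ∈ Rest → ¬ Arc D c k) A₁ →
          Links i C₁ s → Links g C₂ t → C₁ ++ C₂ ++ F ↭ Rest → All Free F → Hamiltonian D
        unfork m Zₚ {A₁ = A₁} Zₚ≤m hd full≡ upto p split none l₁ l₂ permC freeF with ++-split P A₁ split
        ... | inj₂ (Y , P≡ , _) = close-in-P Zₚ hd full≡ upto p P≡ l₁ l₂ permC freeF
        unfork zero _ Zₚ≤m hd full≡ upto p split none l₁ l₂ permC freeF | inj₁ (X , refl , refl) =
          contradiction (subst (_≤ 0) (length-∷ʳ-middle X _ _) Zₚ≤m) λ ()
        unfork (suc m) _ {g} {Rest} {C₁} {C₂} {F} {s} {t} {_} {i} {A₂} Zₚ≤m hd full≡ upto p split none l₁ l₂ permC freeF | inj₁ (X , refl , refl) =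
          advance (arc-over (regroup X full≡) (∈-insert A₂))
          where
          hd′ : Head X i × All Free A₂
          hd′ = head-split X hd
          linksX : Links x (P ++ X) i × Links i A₂ g
          linksX = Links-++⁻ (P ++ X) (subst (λ L → Links x L g) (sym (++-assoc P X (i ∷ A₂))) upto)
          shorter : length X < length (X ++ i ∷ A₂)
          shorter = ≤-trans (s≤s (≤-trans (m≤m+n _ _) (≤-reflexive (sym (length-++ X {A₂}))))) (≤-reflexive (sym (length-∷ʳ-middle X i A₂)))
          advance : FirstArc (P ++ X) (A₂ ++ g ∷ Rest) → Hamiltonian D
          advance (A₁′ , i′ , A₂′ , k , split′ , k∈ , i′→k , none′) = landed (land A₂ g C₂ (Links-++ A₂ (proj₂ linksX) l₂) (proj₂ hd′) near)
            where
            near : k ∈ A₂ ⊎ k ≡ g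
            near with ∈-++⁻ A₂ k∈
            ... | inj₁ k∈A₂ = inj₁ k∈A₂
            ... | inj₂ (here k≡g) = inj₂ k≡g
            ... | inj₂ (there k∈Rest) = contradiction i′→k (All.lookup none (subst (i′ ∈_) (sym split′) (∈-insert A₁′)) k k∈Rest)
            landed : (∃₂ λ X K → A₂ ++ g ∷ C₂ ≡ X ++ k ∷ K × All Free X × Links k K t) → Hamiltonian D
            landed (X₀ , K , land≡ , freeX₀ , lK) =
              unfork m X {F = X₀ ++ F} (≤-pred (≤-trans shorter Zₚ≤m)) (proj₁ hd′) (regroup X full≡) (proj₁ linksX) (flip-pair p) split′ none′
                (i′→k , lK) l₁ (exchange X₀ k K A₂ g {C₁} {C₂} {F} land≡ permC) (All.++⁺ freeX₀ freeF)

        result : Hamiltonian D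
        result with arc-over {w ∷ Z} {w′} {B} refl r∈B
        ... | A₁ , i , A₂ , k , split , k∈ , i→k , none with ∈-∃++ k∈
        ... | B₁ , B₂ , refl with Links-++⁻ B₁ (toB yx)
        ... | lB₁ , lB₂ with trim-back {P = Free} {s = x} B₁ (all-∈ λ c∈ → B-good xy (∈-++⁺ˡ c∈)) (proj₁ w′-RR) lB₁
        ... | B₁′ , B₀ , refl , freeB₀ , lB₁′ =
          -- The first fork: `i` jumps over `w′` to `k` and follows `B` to `y`, while `w′` follows
          -- the part of `B` before `k`, trimmed to end at `x`.
          unfork (length (w ∷ Z)) (w ∷ Z) {w′} {(B₁′ ++ B₀) ++ k ∷ B₂} {k ∷ B₂} {B₁′} {B₀} ≤-refl (inj₂ (Z , refl , freeZ)) refl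
            (Links-++ P (fromP xy) mid) yx split none (i→k , lB₂) lB₁′
            (↭-solve 3 (λ k b b₀ → k ⊕ (b ⊕ b₀) ⊜ (b ⊕ b₀) ⊕ k) ↭-refl (k ∷ B₂) B₁′ B₀) freeB₀

      -- The case distinction on common neighbours

      two-or-few : ∀ {P : Fin n → Set} → Decidable P → (∀ {v} → P v → v ∈ R) → (∃₂ λ u v → P u × P v × u ≢ v) ⊎ (∀ {u v} → P u → P v → u ≡ v)
      two-or-few {P} P? P⊆R with first-split P? R
      ... | inj₁ none = inj₂ λ pu _ → contradiction pu (All.lookup none (P⊆R pu))
      ... | inj₂ (_ , l , _ , _ , pl , _) with first-split (λ v → P? v ×-dec ¬? (v ≟ l)) R
      ... | inj₂ (_ , u , _ , _ , (pu , u≢l) , _) = inj₁ (u , l , pu , pl , u≢l)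
      ... | inj₁ none = inj₂ λ pu pv → trans (only pu) (sym (only pv))
        where
        only : ∀ {u} → P u → u ≡ l
        only {u} pu with u ≟ l
        ... | yes e = e
        ... | no u≢l = contradiction (pu , u≢l) (All.lookup none (P⊆R pu))

      other-than : ∀ {P : Fin n → Set} → (∃₂ λ u v → P u × P v × u ≢ v) → ∀ l → ∃ λ u → P u × u ≢ l
      other-than (u , v , pu , pv , u≢v) l with u ≟ l
      ... | no u≢l = u , pu , u≢l
      ... | yes refl = v , pv , u≢v ∘ sym

      module Unmixed (unmixed : ∀ {s t v} → Pr s t → Arc D s v → ¬ Arc D v t) where

        few-sources : (∀ {u v} → LL u → LL v → u ≡ v) → Hamiltonian D
        few-sources few = FewSources.goal D Free (Hamiltonian D) extend-cycle links perm mono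
          (λ p v v∈ → out-neighbour _ v (s≢ p v∈))
          (λ fu l m → let c , (x~c , y~c) , rest = core-out-neighbour fu l m in c , x~c , y~c , rest)
          (λ p → nonadj-free p) (λ p → nbr p) (λ p → unmixed p) (λ a b c d → few (a , b) (c , d))
          where
          s≢ : ∀ {s t v} → Pr s t → v ∈ t ∷ R → s ≢ v
          s≢ p (here refl) = pair-≢ p
          s≢ p (there v∈) refl = Full.not-pair perm v∈ p

        -- Reversal of all arcs exchanges common in- and out-neighbours; monotonicity survives when
        -- the list is reversed as well.
        few-sinks : (∀ {u v} → RR u → RR v → u ≡ v) → Hamiltonian D
        few-sinks few = FewSources.goal (flip D) Free (Hamiltonian D)
          (λ {v} {L} {F} l p → extend-cycle (Links-reverse (flip D) L l) (↭-trans (prep v (++⁺ʳ F (↭-reverse L))) p))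
          (Links-reverse D R links) (↭-trans (prep x (prep y (↭-reverse R))) perm)
          (λ p → AllPairs.map (λ h ab → h (proj₂ ab , proj₁ ab)) (AllPairs-reverse R (mono p)))
          (λ p v v∈ → in-neighbour _ v (s≢ p v∈))
          (λ fu l m → let c , (x~c , y~c) , rest = core-in-neighbour fu l m in c , swap x~c , swap y~c , rest)
          (λ p v∈ h → nonadj-free p (∈-resp-↭ (↭-reverse R) v∈) (h ∘ swap))
          (λ p a → ∈-resp-↭ (↭-sym (↭-reverse R)) (nbr p (swap a)))
          (λ p v→s t→v → unmixed (flip-pair p) t→v v→s) (λ a b c d → few (a , b) (c , d))
          where
          s≢ : ∀ {s t v} → Pr s t → v ∈ t ∷ reverse R → s ≢ v
          s≢ p (here refl) = pair-≢ p
          s≢ p (there v∈) refl = Full.not-pair perm (∈-resp-↭ (↭-reverse R) v∈) p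

        LL∌RR : ∀ {v} → LL v → ¬ RR v
        LL∌RR ll rr = unmixed xy (proj₁ ll) (proj₂ rr)

        noncore : ∀ {v} → ¬ LL v → ¬ RR v → ¬ Core v
        noncore ¬ll ¬rr (inj₁ a , inj₁ b) = ¬ll (a , b)
        noncore ¬ll ¬rr (inj₁ a , inj₂ b) = unmixed xy a b
        noncore ¬ll ¬rr (inj₂ a , inj₁ b) = unmixed yx b a
        noncore ¬ll ¬rr (inj₂ a , inj₂ b) = ¬rr (a , b)

        module Many (twoL : ∃₂ λ u v → LL u × LL v × u ≢ v) (twoR : ∃₂ λ u v → RR u × RR v × u ≢ v) where

          RR-after : ∀ {L A v B} → Mono x L → L ≡ A ++ v ∷ B → LL v → ∀ {c} → RR c → c ∈ L → c ∈ B
          RR-after {A = A} m refl v-LL c-RR c∈ with ∈-++⁻ A c∈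
          ... | inj₁ c∈A = contradiction (proj₁ c-RR , proj₁ v-LL) (All.lookup (proj₁ (AllPairs-middle⁻ A m)) c∈A)
          ... | inj₂ (here refl) = contradiction c-RR (LL∌RR v-LL)
          ... | inj₂ (there c∈B) = c∈B

          -- No core vertex lies between the last common out-neighbour `w` and the first common
          -- in-neighbour `w′` after it, so `Z` is free. The second witnesses `l₂` and `r₂` make `w`
          -- differ from `l` and `w′` from `r`, so that there are vertices on both sides for arcs to
          -- start from and to land in.
          spread : ∀ {l Q r} → LL l → RR r → Links l Q r → x ∷ y ∷ l ∷ Q ++ [ r ] ↭ allFin n →
            (∀ {s t} → Pr s t → Mono s (l ∷ Q ++ [ r ])) → Hamiltonian D
          spread {l} {Q} {r} l-LL r-RR lQ permL monoL with other-than twoL l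
          ... | l₂ , l₂-LL , l₂≢l with last-split-∈ LL? l₂∈Q l₂-LL
            where
            l₂∈Q : l₂ ∈ Q
            l₂∈Q with Full.nbr permL xy (inj₁ (proj₁ l₂-LL))
            ... | here e = contradiction e l₂≢l
            ... | there l₂∈ with ∈-++⁻ Q l₂∈
            ... | inj₁ l₂∈Q = l₂∈Q
            ... | inj₂ (here refl) = contradiction r-RR (LL∌RR l₂-LL)
          ... | Q₁ , w , Q₂ , refl , w-LL , Q₂-LL with other-than twoR r
          ... | r₂ , r₂-RR , r₂≢r with first-split-∈ RR? r₂∈Q₂ r₂-RR
            where
            r₂∈Q₂ : r₂ ∈ Q₂
            r₂∈Q₂ with ∈-++⁻ Q₂ (RR-after {A = l ∷ Q₁} (monoL xy) (cong (l ∷_) (++-assoc Q₁ (w ∷ Q₂) [ r ])) w-LL r₂-RR (Full.nbr permL xy (inj₂ (proj₁ r₂-RR))))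
            ... | inj₁ r₂∈ = r₂∈
            ... | inj₂ (here e) = contradiction e r₂≢r
          ... | Z , w′ , Q₃ , refl , w′-RR , Z-RR =
            Interlace.result {l ∷ Q₁} {w} {Z} {w′} {Q₃ ++ [ r ]} (subst (λ L → x ∷ y ∷ L ↭ allFin n) shape permL) (λ p → subst (Mono _) shape (monoL p))
              (λ p → LL-arc p l-LL , proj₁ (Links-++⁻ Q₁ lQ)) (proj₁ lZ) (λ p → Links-++ Q₃ (proj₂ lZ) (RR-arc p r-RR))
              w-LL w′-RR freeZ (here refl) (∈-++⁺ʳ Q₃ (here refl))
            where
            shape : l ∷ (Q₁ ++ w ∷ Z ++ w′ ∷ Q₃) ++ [ r ] ≡ (l ∷ Q₁ ++ w ∷ Z) ++ w′ ∷ Q₃ ++ [ r ]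
            shape = cong (l ∷_) (trans (cong (_++ [ r ]) (sym (++-assoc Q₁ (w ∷ Z) (w′ ∷ Q₃)))) (++-assoc (Q₁ ++ w ∷ Z) (w′ ∷ Q₃) [ r ]))
            lZ : Links w Z w′ × Links w′ Q₃ r
            lZ = Links-++⁻ Z (proj₂ (Links-++⁻ Q₁ lQ))
            freeZ : All Free Z
            freeZ = all-∈ λ c∈ → Full.noncore-free permL (there (∈-++⁺ˡ (∈-++⁺ʳ Q₁ (there (∈-++⁺ˡ c∈)))))
              (noncore (All.lookup Q₂-LL (∈-++⁺ˡ c∈)) (All.lookup Z-RR c∈))

          l₀-LL : LL (proj₁ twoL)
          l₀-LL = proj₁ (proj₂ (proj₂ twoL))

          r₀-RR : RR (proj₁ twoR)
          r₀-RR = proj₁ (proj₂ (proj₂ twoR))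

          result : Hamiltonian D
          result with first-split-∈ LL? (nbr xy (inj₁ (proj₁ l₀-LL))) l₀-LL
          ... | N₁ , l , N , R≡ , l-LL , N₁-LL with last-split-∈ RR? (RR-after mono-x R≡ l-LL r₀-RR (nbr xy (inj₂ (proj₁ r₀-RR)))) r₀-RR
          ... | M , r , N₂ , refl , r-RR , N₂-RR
            with extend-path (λ _ → ⊤) {l} {M} {r} {N₁ ++ N₂} (λ _ _ _ _ _ → tt) tt (proj₁ (Links-++⁻ M (proj₂ (Links-++⁻ N₁ (subst (λ L → Links x L x) R≡ links)))))
              (↭-trans (↭-solve 7 (λ x y l r m n₁ n₂ → x ⊕ (y ⊕ (l ⊕ (r ⊕ (m ⊕ (n₁ ⊕ n₂))))) ⊜ x ⊕ (y ⊕ (n₁ ⊕ (l ⊕ (m ⊕ (r ⊕ n₂)))))) ↭-refl [ x ] [ y ] [ l ] [ r ] M N₁ N₂)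
                (↭-trans (↭-reflexive (cong (λ L → x ∷ y ∷ L) (sym R≡))) perm))
              (All.++⁺ freeN₁ freeN₂)
            where
            monoR : Mono x (N₁ ++ l ∷ M ++ r ∷ N₂)
            monoR = subst (Mono x) R≡ mono-x
            freeN₁ : All Free N₁
            freeN₁ = all-∈ λ c∈ → noncore-free (subst (_ ∈_) (sym R≡) (∈-++⁺ˡ c∈)) (noncore (All.lookup N₁-LL c∈)
              λ rr → All.lookup (proj₁ (AllPairs-middle⁻ N₁ monoR)) c∈ (proj₁ rr , proj₁ l-LL))
            freeN₂ : All Free N₂
            freeN₂ = all-∈ λ c∈ → noncore-free (subst (_ ∈_) (sym R≡) (∈-++⁺ʳ N₁ (there (∈-++⁺ʳ M (there c∈))))) (noncore
              (λ ll → All.lookup (proj₂ (AllPairs-middle⁻ (l ∷ M) (proj₁ (proj₂ (AllPairs-++⁻ N₁ monoR))))) c∈ (proj₁ r-RR , proj₁ ll))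
              (All.lookup N₂-RR c∈))
          -- Absorption need not keep the list monotone. But the path from `l` to `r` closes up
          -- through `x` and through `y`, and each of these cycles gives back monotonicity for the
          -- vertex it misses, or a Hamiltonian cycle.
          ... | Q , lQ , _ , permQ = by-mono (mono-or-hamiltonian heavy-x (cycle-through yx) permL) (mono-or-hamiltonian heavy-y (cycle-through xy) (↭-trans (↭.swap y x ↭-refl) permL))
            where
            permL : x ∷ y ∷ l ∷ Q ++ [ r ] ↭ allFin n
            permL = ↭-trans (↭-solve 5 (λ x y l r q → x ⊕ (y ⊕ (l ⊕ (q ⊕ r))) ⊜ x ⊕ (y ⊕ (l ⊕ (r ⊕ q)))) ↭-refl [ x ] [ y ] [ l ] [ r ] Q) permQ
            cycle-through : ∀ {s t} → Pr s t → Links s (l ∷ Q ++ [ r ]) s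
            cycle-through p = LL-arc p l-LL , Links-++ Q lQ (RR-arc p r-RR)
            by-mono : Hamiltonian D ⊎ Mono x (l ∷ Q ++ [ r ]) → Hamiltonian D ⊎ Mono y (l ∷ Q ++ [ r ]) → Hamiltonian D
            by-mono (inj₁ h) _ = h
            by-mono (inj₂ _) (inj₁ h) = h
            by-mono (inj₂ mx) (inj₂ my) = spread l-LL r-RR lQ permL λ { xy → mx ; yx → my }

        result : Hamiltonian D
        result with two-or-few LL? (λ ll → nbr xy (inj₁ (proj₁ ll))) | two-or-few RR? (λ rr → nbr xy (inj₂ (proj₁ rr)))
        ... | inj₂ few | _ = few-sources few
        ... | inj₁ _ | inj₂ few = few-sinks few
        ... | inj₁ twoL | inj₁ twoR = Many.result twoL twoR

      hamilton : Hamiltonian D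
      hamilton with first-split (λ v → arc? y v ×-dec arc? v x) (allFin n) | first-split (λ v → arc? x v ×-dec arc? v y) (allFin n)
      ... | inj₂ (_ , v , _ , _ , (y→v , v→x) , _) | _ = Mixed.result xy y→v v→x
      ... | inj₁ _ | inj₂ (_ , v , _ , _ , (x→v , v→y) , _) = Mixed.result yx x→v v→y
      ... | inj₁ none-yx | inj₁ none-xy = Unmixed.result λ
        { {v = v} xy x→v v→y → All.lookup none-xy (∈-allFin v) (x→v , v→y)
        ; {v = v} yx y→v v→x → All.lookup none-yx (∈-allFin v) (y→v , v→x) }

-- Choice of a light pair

theorem1p12 : (n : ℕ) → (D : Digraph n) → Loopless D → 3 ≤ n → KStrong D 2 → ConditionM D → Hamiltonian D
theorem1p12 n D loopless 3≤n (_ , connected) M = by-light-pair (first-split light? (allFin n))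
  where
  open Walks D

  strong : ∀ t {u v} → u ≢ t → v ≢ t → ReachAvoiding D ⁅ t ⁆ u v
  strong t u≢t v≢t = connected ⁅ t ⁆ (≤-reflexive (∣⁅x⁆∣≡1 t)) _ _ (x≢y⇒x∉⁅y⁆ u≢t) (x≢y⇒x∉⁅y⁆ v≢t)

  open TwoStrong D loopless 3≤n strong

  Light : Fin n → Fin n → Set
  Light u v = u ≢ v × ¬ Adjacent D u v × deg D u + deg D v + 2 ≤ 2 * n

  light? : ∀ u → Dec (Any (Light u) (allFin n))
  light? u = any? (λ v → ¬? (u ≟ v) ×-dec (¬? (adjacent? u v) ×-dec (deg D u + deg D v + 2 ≤? 2 * n))) (allFin n)

  not-light : ∀ {s} → ¬ (s + 2 ≤ 2 * n) → 2 * n ≤ s + 1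
  not-light {s} h = ≤-pred (≤-trans (≰⇒> h) (≤-reflexive (+-suc s 1)))

  at-light-pair : ∀ {x y} → Light x y → Hamiltonian D
  at-light-pair {x} {y} (x≢y , x≁y , light) =
    [ id , BadPair.FreeDegrees.hamilton x≢y x≁y light others ]′ (BadPair.mono-path x≢y x≁y light others)
    where
    others : ∀ {u v} → u ≢ v → ¬ Adjacent D u v → ¬ ((x ≡ u × y ≡ v) ⊎ (x ≡ v × y ≡ u)) → 4 * n ≤ deg D x + deg D y + (deg D u + deg D v) + 3
    others {u} {v} u≢v u≁v distinct = begin
      4 * n                                            ≤⟨ m≤n+m∸n (4 * n) 3 ⟩
      3 + (4 * n ∸ 3)                                  ≤⟨ +-monoʳ-≤ 3 (M x y u v x≢y u≢v x≁y u≁v distinct) ⟩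
      3 + (deg D x + deg D y + deg D u + deg D v)      ≡⟨ +-comm 3 _ ⟩
      deg D x + deg D y + deg D u + deg D v + 3        ≡⟨ cong (_+ 3) (+-assoc (deg D x + deg D y) (deg D u) (deg D v)) ⟩
      deg D x + deg D y + (deg D u + deg D v) + 3      ∎
      where open ≤-Reasoning

  by-light-pair : All (λ u → ¬ Any (Light u) (allFin n)) (allFin n) ⊎
    (∃ λ L → ∃ λ x → ∃ λ L′ → allFin n ≡ L ++ x ∷ L′ × Any (Light x) (allFin n) × All (λ u → ¬ Any (Light u) (allFin n)) L) → Hamiltonian D
  by-light-pair (inj₁ none) = meyniel-hamiltonian
    (λ {u} {v} u≢v u≁v → not-light (λ le → All.lookup none (∈-allFin u) (lose (∈-allFin v) (u≢v , u≁v , le))))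
    (fromℕ< (≤-trans (s≤s z≤n) 3≤n))
  by-light-pair (inj₂ (_ , x , _ , _ , hit , _)) with find hit
  ... | y , _ , light = at-light-pair light
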